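{- Let $r\ge 3$ be an integer such that $r-1$ is a prime power. Then: (i) there exists an $[r,2r;3]$-bigraph of order $3r^2-3r+3$, whose defect is $\delta=\frac{3}{2}(r-1)$ if $r$ is odd and $\delta=\frac{3r}{2}-3$ if $r$ is even; (ii) there exists an $[r,2r;4]$-bigraph of order $3r^3-6r^2+6r$, whose defect is $\delta=3r^3-3r^2$; (iii) there exists an $[r,2r;6]$-bigraph of order $3r^5-12r^4+21r^3-18r^2+9r$, whose defect is $\delta=9r^5-24r^4+24r^3-9r^2$.
   Context: An $[a,b;d]$-bigraph is a connected bipartite graph with stable sets $V_1,V_2$, all vertices of $V_1$ of degree $a$, all vertices of $V_2$ of degree $b$, and diameter $d$. For degrees $2r>r$, the Moore bounds are: for odd diameter $3$, $M(2r,r;3)=3\left\lfloor\frac{1+r(2r-1)}{2}\right\rfloor$; for even diameter $2m$, $M(2r,r;2m)=3r\frac{[(2r-1)(r-1)]^m-1}{(2r-1)(r-1)-1}$ (so $M(2r,r;4)=6r^3-9r^2+6r$ and $M(2r,r;6)=12r^5-36r^4+45r^3-27r^2+9r$). The defect of an $[r,2r;d]$-bigraph is $M(2r,r;d)$ minus its order. -}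

module Defs where

open import Data.Nat using (ℕ; zero; suc; _+_; _*_; _∸_; _^_; _≤_; pred)
open import Data.Nat.DivMod using (_/_)
open import Data.Nat.Primality using (Prime)
open import Data.Bool using (Bool; true; false; if_then_else_)
open import Data.Fin using (Fin)
open import Data.List using (List; map; allFin)
open import Data.Nat.ListAction using (sum)
open import Data.Product using (Σ; ∃; _×_)
open import Relation.Binary.PropositionalEquality using (_≡_; _≢_)
open import Relation.Nullary using (¬_)

IsPrimePower : ℕ → Set
IsPrimePower n = Σ ℕ λ p → Σ ℕ λ k → Prime p × (1 ≤ k) × (n ≡ p ^ k)

degree : {n : ℕ} → (Fin n → Fin n → Bool) → Fin n → ℕ
degree {n} adj u = sum (map (λ v → if adj u v then 1 else 0) (allFin n))

data Reach {n : ℕ} (adj : Fin n → Fin n → Bool) : ℕ → Fin n → Fin n → Set where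
  here  : ∀ {k u} → Reach adj k u u
  there : ∀ {k u w v} → adj u w ≡ true → Reach adj k w v → Reach adj (suc k) u v

-- the graph has diameter d (d ≥ 1): all distances ≤ d, and some distance = d
-- (in particular the graph is connected)
HasDiameter : {n : ℕ} → (Fin n → Fin n → Bool) → ℕ → Set
HasDiameter {n} adj d =
  (∀ u v → Reach adj d u v) ×
  (Σ (Fin n) λ u → Σ (Fin n) λ v → ¬ Reach adj (pred d) u v)

-- An [a,b;d]-bigraph on the vertex set Fin n (so its order is n):
-- a simple graph (symmetric adjacency, edges only between the two stable
-- sets V1 = {side ≡ true}, V2 = {side ≡ false}, hence loopless), with all
-- vertices of V1 of degree a, all of V2 of degree b, and diameter d.
record Bigraph (a b d n : ℕ) : Set where
  field
    side   : Fin n → Bool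
    adj    : Fin n → Fin n → Bool
    symm   : ∀ u v → adj u v ≡ adj v u
    stable : ∀ u v → adj u v ≡ true → side u ≢ side v
    degV1  : ∀ u → side u ≡ true  → degree adj u ≡ a
    degV2  : ∀ u → side u ≡ false → degree adj u ≡ b
    diam   : HasDiameter adj d

moore3 : ℕ → ℕ
moore3 r = 3 * ((1 + r * (2 * r ∸ 1)) / 2)

geom : ℕ → ℕ → ℕ
geom x zero    = 0
geom x (suc m) = 1 + x * geom x m

-- Moore bound M(2r,r;2m) = 3r ([(2r-1)(r-1)]^m - 1)/((2r-1)(r-1) - 1)
--                        = 3r Σ_{i<m} [(2r-1)(r-1)]^i   (exact quotient)
mooreEven : ℕ → ℕ → ℕ
mooreEven r m = 3 * r * geom ((2 * r ∸ 1) * (r ∸ 1)) m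

defect : ℕ → ℕ → ℕ
defect M n = M ∸ n

-- Let q = r − 1.  Doubling every point in the incidence graph of a generalized
-- n-gon of order q, with n = 3, 4, 6, yields the [r,2r;n]-bigraph.
--
-- Points and lines of the n-gon are the words of length less than n over the
-- field with q elements (Van Maldeghem's coordinates).  A word of one kind is
-- incident with its one-letter extensions, which are words of the other kind;
-- the two empty words are incident, and two words of length n − 1 are incident
-- if their letters satisfy certain polynomial equations.  Word length bounds
-- distances from below.  For the upper bounds, embed the points into a
-- projective space.  For n = 4 collinearity becomes orthogonality for a
-- symplectic form, and every line has a point orthogonal to a given one.  For
-- n = 6 the points become the singular trace zero split octonions, collinear if
-- their product x z vanishes; if only the trace B x z of the product vanishes,
-- then the point x z is collinear with both x and z.
--
-- For the field, adjoin roots of x^q − x to ℤ/p one after the other, through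
-- rings R[x]/(g) that need not be domains, and divide the finite ring obtained
-- by a maximal ideal.  The roots of x^q − x in the quotient form the field; they
-- are distinct, since a double root a would give (a + ε)^q = a + ε in the dual
-- numbers.
module Submission where

-- Doubling turns the degrees q + 1, q + 1 into q + 1 for points and 2 (q + 1) for lines, and the
-- only new distance is 2, between the two copies of a point. Coordinates make order and degrees
-- immediate: words are counted by their letters, and each word has its parent and q further
-- neighbours. The price is that joins must be found from explicit equations, one case for each pair
-- of word lengths, and in all characteristics at once, including 2 and 3. Every such step is
-- therefore an identity between integer polynomials modulo the hypotheses, with the coefficients of
-- the combination written down and the identity checked by computation.
--
-- The detour through rings that need not be domains avoids the search for an irreducible polynomial
-- of degree k: roots are adjoined formally, and a field is reached only at the end, where
-- finiteness makes the search for a maximal ideal a terminating procedure. That the result has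
-- exactly q elements is then a statement about the distinctness of the q roots.

module Graphs where

  open import Defs
  open import Data.Bool.Base using (Bool; true; false; if_then_else_)
  open import Data.Bool.Properties using () renaming (_≟_ to _≟ᵇ_)
  open import Data.Fin.Base using (Fin; zero; suc)
  open import Data.Fin.Properties using (any?; *↔×; +↔⊎; 2↔Bool; 1↔⊤) renaming (_≟_ to _≟ᶠ_)
  open import Data.List.Base using (List; []; _∷_; map; length; filter; allFin)
  open import Data.List.Membership.Propositional using (_∈_)
  open import Data.List.Membership.Propositional.Properties using (∈-filter⁺; ∈-filter⁻; ∈-map⁺; ∈-map⁻; ∈-allFin)
  open import Data.List.Membership.Propositional.Properties.WithK using (unique∧set⇒bag)
  open import Data.List.Properties using (length-map; length-tabulate)
  open import Data.List.Relation.Binary.BagAndSetEquality using (∼bag⇒↭)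
  open import Data.List.Relation.Binary.Permutation.Propositional.Properties using (↭-length)
  open import Data.List.Relation.Unary.Unique.Propositional.Properties using (allFin⁺) renaming (map⁺ to unique-map⁺; filter⁺ to unique-filter⁺)
  open import Data.Maybe.Base using (Maybe; just; nothing)
  open import Data.Nat.Base using (ℕ; zero; suc; _+_; _*_; _≤_; pred)
  open import Data.Nat.ListAction using (sum)
  open import Data.Nat.Properties using (≤-trans; ≤-reflexive; +-suc; +-monoˡ-≤; m≤m+n)
  open import Data.Product.Base using (∃; _×_; _,_; proj₁; proj₂)
  open import Data.Product.Function.NonDependent.Propositional using (_×-↔_)
  open import Data.Product.Properties using (,-injectiveˡ; ,-injectiveʳ)
  open import Data.Sum.Base using (_⊎_; inj₁; inj₂)
  open import Data.Sum.Function.Propositional using (_⊎-↔_)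
  open import Data.Sum.Properties using (inj₁-injective; inj₂-injective)
  open import Data.Unit.Base using (tt)
  open import Function.Base using (_∘_)
  open import Function.Bundles using (_↔_; Inverse; mk↔ₛ′; mk⇔)
  open import Function.Construct.Composition using (_↔-∘_)
  open import Function.Construct.Symmetry using (↔-sym)
  open import Relation.Binary.PropositionalEquality using (_≡_; _≢_; refl; sym; trans; cong; cong₂; subst)
  open import Relation.Nullary using (¬_; Dec; yes; does)
  open import Relation.Nullary.Decidable using (dec-true)

  -- Graphs given by enumerated neighbours

  private variable
    A B : Set
    k m n : ℕ

  to-injective : (e : A ↔ B) → ∀ {x y} → Inverse.to e x ≡ Inverse.to e y → x ≡ y
  to-injective e {x} {y} eq = trans (sym (strictlyInverseʳ x)) (trans (cong from eq) (strictlyInverseʳ y))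
    where open Inverse e

  dec-true⁻¹ : (d : Dec A) → does d ≡ true → A
  dec-true⁻¹ (yes a) _ = a

  sum-indicator : (f : A → Bool) (xs : List A) →
    sum (map (λ x → if f x then 1 else 0) xs) ≡ length (filter (λ x → f x ≟ᵇ true) xs)
  sum-indicator f []       = refl
  sum-indicator f (x ∷ xs) with f x
  ... | true  = cong suc (sum-indicator f xs)
  ... | false = sum-indicator f xs

  -- The neighbours filtered from `allFin n` and the values of `f` form two lists without
  -- repetitions and with the same members, hence permutations of each other.
  degree-enumerated : (adj : Fin n → Fin n → Bool) (u : Fin n) (f : Fin m → Fin n) →
    (∀ {i j} → f i ≡ f j → i ≡ j) →
    (∀ i → adj u (f i) ≡ true) → (∀ v → adj u v ≡ true → ∃ λ i → f i ≡ v) →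
    degree adj u ≡ m
  degree-enumerated {n} {m} adj u f f-inj sound complete =
    trans (sum-indicator (adj u) (allFin n))
      (trans (↭-length (∼bag⇒↭ (unique∧set⇒bag (unique-filter⁺ adj? (allFin⁺ n)) (unique-map⁺ f-inj (allFin⁺ m)) (mk⇔ into outof))))
        (trans (length-map f (allFin m)) (length-tabulate (λ i → i))))
    where
    adj? : ∀ v → Dec (adj u v ≡ true)
    adj? v = adj u v ≟ᵇ true

    into : ∀ {v} → v ∈ filter adj? (allFin n) → v ∈ map f (allFin m)
    into {v} v∈ with i , refl ← complete v (proj₂ (∈-filter⁻ adj? {xs = allFin n} v∈)) = ∈-map⁺ f (∈-allFin i)

    outof : ∀ {v} → v ∈ map f (allFin m) → v ∈ filter adj? (allFin n)
    outof v∈ with i , _ , refl ← ∈-map⁻ f v∈ = ∈-filter⁺ adj? (∈-allFin (f i)) (sound i)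

  -- Each edge of a walk is named by its index at the current vertex, so walks can be built by
  -- computing neighbours, without deciding adjacency.
  data Within {V : Set} {D : V → Set} (nb : ∀ v → D v → V) : ℕ → V → V → Set where
    here : ∀ {k u} → Within nb k u u
    step : ∀ {k u v} i → Within nb k (nb u i) v → Within nb (suc k) u v

  module _ {V : Set} {D : V → Set} {nb : ∀ v → D v → V} where

    infixr 5 _⟫_
    infixl 6 _▷_

    weaken : ∀ {k u v} → Within nb k u v → Within nb (suc k) u v
    weaken here       = here
    weaken (step i p) = step i (weaken p)

    _▷_ : ∀ {k u v} → Within nb k u v → ∀ i → Within nb (suc k) u (nb v i)
    here     ▷ j = step j here
    step i p ▷ j = step i (p ▷ j)

    _⟫_ : ∀ {k m u v w} → Within nb k u v → Within nb m v w → Within nb (k + m) u w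
    _⟫_ {zero}  here   q = q
    _⟫_ {suc k} here   q = weaken (_⟫_ {k} here q)
    step i p ⟫ q = step i (p ⟫ q)

    -- This is the only source of lower bounds on distances: no step raises the level by more than
    -- one.
    level-bound : (level : V → ℕ) → (∀ v i → level (nb v i) ≤ suc (level v)) →
                  ∀ {k u v} → Within nb k u v → level v ≤ level u + k
    level-bound level lip here       = m≤m+n _ _
    level-bound level lip {u = u} (step {k = k} i p) =
      ≤-trans (level-bound level lip p) (≤-trans (+-monoˡ-≤ k (lip u i)) (≤-reflexive (sym (+-suc (level u) k))))

  -- The degree is part of the type of `nb`, so regularity amounts to `nb-injective`. Boolean
  -- adjacency and the vertex set `Fin n` enter only in `bigraph`.
  record TypedBigraph (V : Set) (a b d : ℕ) : Set where
    field
      side         : V → Bool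
      nb           : ∀ v → Fin (if side v then a else b) → V
      nb-injective : ∀ v {i j} → nb v i ≡ nb v j → i ≡ j
      nb-symmetric : ∀ v i → ∃ λ j → nb (nb v i) j ≡ v
      nb-side      : ∀ v i → side (nb v i) ≢ side v
      near         : ∀ u v → Within nb d u v
      far          : ∃ λ u → ∃ λ v → ¬ Within nb (pred d) u v

  bigraph : ∀ {V a b d} → TypedBigraph V a b d → V ↔ Fin n → Bigraph a b d n
  bigraph {n} {V} {a} {b} {d} G e = record
    { side   = λ u → side (from u)
    ; adj    = adj
    ; symm   = adj-symmetric
    ; stable = λ u v uv eq → let i , nb≡v = adj⁻ uv in nb-side (from u) i (trans (cong side nb≡v) (sym eq))
    ; degV1  = λ u s → trans (degree-nb u) (cong (λ s → if s then a else b) s)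
    ; degV2  = λ u s → trans (degree-nb u) (cong (λ s → if s then a else b) s)
    ; diam   = (λ u v → at-ends (reach (near (from u) (from v)))) ,
               (let u , v , u≁v = far in to u , to v , λ r → u≁v (within⁻ r))
    }
    where
    open TypedBigraph G
    open Inverse e

    nb? : ∀ u v → Dec (∃ λ i → to (nb (from u) i) ≡ v)
    nb? u v = any? (λ i → to (nb (from u) i) ≟ᶠ v)

    adj : Fin n → Fin n → Bool
    adj u v = does (nb? u v)

    adj⁺ : ∀ u i → adj u (to (nb (from u) i)) ≡ true
    adj⁺ u i = dec-true (nb? u _) (i , refl)

    adj⁻ : ∀ {u v} → adj u v ≡ true → ∃ λ i → nb (from u) i ≡ from v
    adj⁻ {u} {v} uv with i , eq ← dec-true⁻¹ (nb? u v) uv =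
      i , trans (sym (strictlyInverseʳ _)) (cong from eq)

    adj-reverse : ∀ u v → adj u v ≡ true → adj v u ≡ true
    adj-reverse u v uv with i , eq ← adj⁻ uv with j , eq′ ← nb-symmetric (from u) i =
      dec-true (nb? v u) (subst (λ w → ∃ λ i → to (nb w i) ≡ u) eq (j , trans (cong to eq′) (strictlyInverseˡ u)))

    adj-symmetric : ∀ u v → adj u v ≡ adj v u
    adj-symmetric u v with adj u v in uv | adj v u in vu
    ... | true  | true  = refl
    ... | false | false = refl
    ... | true  | false = trans (sym (adj-reverse u v uv)) vu
    ... | false | true  = trans (sym uv) (adj-reverse v u vu)

    degree-nb : ∀ u → degree adj u ≡ (if side (from u) then a else b)
    degree-nb u = degree-enumerated adj u (to ∘ nb (from u)) (nb-injective (from u) ∘ to-injective e) (adj⁺ u)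
      (λ v uv → let i , eq = adj⁻ uv in i , trans (cong to eq) (strictlyInverseˡ v))

    reach : ∀ {k u v} → Within nb k u v → Reach adj k (to u) (to v)
    reach here                  = here
    reach {u = u} (step i p) = there edge (reach p)
      where
      edge : adj (to u) (to (nb u i)) ≡ true
      edge = dec-true (nb? (to u) _) (subst (λ w → ∃ λ j → to (nb w j) ≡ to (nb u i)) (sym (strictlyInverseʳ u)) (i , refl))

    at-ends : ∀ {u v} → Reach adj d (to (from u)) (to (from v)) → Reach adj d u v
    at-ends {u} {v} r = subst (λ w → Reach adj d w v) (strictlyInverseˡ u) (subst (Reach adj d _) (strictlyInverseˡ v) r)

    within : ∀ {k u v} → Reach adj k u v → Within nb k (from u) (from v)
    within here         = here
    within (there uw p) with i , eq ← adj⁻ uw = step i (subst (λ w → Within nb _ w _) (sym eq) (within p))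

    within⁻ : ∀ {k u v} → Reach adj k (to u) (to v) → Within nb k u v
    within⁻ {u = u} {v} r with p ← within r rewrite strictlyInverseʳ u | strictlyInverseʳ v = p

  -- Incidence structures and the doubling of points

  record Incidence (P L I : Set) : Set where
    field
      line            : P → I → L
      point           : L → I → P
      line-injective  : ∀ p {i j} → line p i ≡ line p j → i ≡ j
      point-injective : ∀ l {i j} → point l i ≡ point l j → i ≡ j
      line-back       : ∀ p i → ∃ λ j → point (line p i) j ≡ p
      point-back      : ∀ l i → ∃ λ j → line (point l i) j ≡ l

  module Doubling {P L I : Set} {s : ℕ} (Γ : Incidence P L I) (index : I ↔ Fin s) where
    open Incidence Γ

    Vertex : Set
    Vertex = (Bool × P) ⊎ L

    isPoint : Vertex → Bool
    isPoint (inj₁ _) = true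
    isPoint (inj₂ _) = false

    pattern pt c p = inj₁ (c , p)
    pattern ln l   = inj₂ l

    index₂ : (Bool × I) ↔ Fin (2 * s)
    index₂ = ↔-sym *↔× ↔-∘ (↔-sym 2↔Bool ×-↔ index)

    -- An index at a line decodes to a copy and an index of the original line, so a line sees both
    -- copies of each of its points, while both copies of a point see the same lines.
    nb : ∀ v → Fin (if isPoint v then s else 2 * s) → Vertex
    nb (pt _ p) i = ln (line p (Inverse.from index i))
    nb (ln l)   i = let c , j = Inverse.from index₂ i in pt c (point l j)

    infix 4 _∋_
    _∋_ : L → P → Set
    l ∋ p = ∃ λ i → point l i ≡ p

    on-line : ∀ {l p} → l ∋ p → ∃ λ i → line p i ≡ l
    on-line {l} (i , refl) = point-back l i

    private
      -- `nb` decodes its index with `from`, which cancels `to` only up to a propositional equality;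
      -- the transport is confined to this lemma and the next.
      point-step : ∀ c {k l p v} → l ∋ p → Within nb k (pt c p) v → Within nb (suc k) (ln l) v
      point-step c {k} {l} {p} {v} (i , refl) w = step (Inverse.to index₂ (c , i))
        (subst (λ ci → Within nb k (pt (proj₁ ci) (point l (proj₂ ci))) v) (sym (Inverse.strictlyInverseʳ index₂ (c , i))) w)

      line-step : ∀ {c k l p v} → l ∋ p → Within nb k (ln l) v → Within nb (suc k) (pt c p) v
      line-step {c} {k} {l} {p} {v} l∋p w with i , refl ← on-line l∋p =
        step (Inverse.to index i) (subst (λ i → Within nb k (ln (line p i)) v) (sym (Inverse.strictlyInverseʳ index i)) w)

    private variable
      c c′ : Bool
      p p′ : P
      l l′ : L

    pt→ln : l ∋ p → Within nb 1 (pt c p) (ln l)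
    pt→ln l∋p = line-step l∋p here

    ln→pt : l ∋ p → Within nb 1 (ln l) (pt c p)
    ln→pt {c = c} l∋p = point-step c l∋p here

    collinear : l ∋ p → l ∋ p′ → Within nb 2 (pt c p) (pt c′ p′)
    collinear l∋p l∋p′ = pt→ln l∋p ⟫ ln→pt l∋p′

    concurrent : l ∋ p → l′ ∋ p → Within nb 2 (ln l) (ln l′)
    concurrent l∋p l′∋p = ln→pt {c = true} l∋p ⟫ pt→ln l′∋p

    nb-symmetric : ∀ v i → ∃ λ j → nb (nb v i) j ≡ v
    nb-symmetric (pt c p) i with j , eq ← line-back p (Inverse.from index i) =
      Inverse.to index₂ (c , j) , trans
        (cong (λ (c , j) → pt c (point (line p (Inverse.from index i)) j)) (Inverse.strictlyInverseʳ index₂ (c , j))) (cong (pt c) eq)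
    nb-symmetric (ln l) i with j , eq ← point-back l (proj₂ (Inverse.from index₂ i)) =
      Inverse.to index j , trans
        (cong (λ j → ln (line (point l (proj₂ (Inverse.from index₂ i))) j)) (Inverse.strictlyInverseʳ index j)) (cong ln eq)

    reverse : ∀ {k u v} → Within nb k u v → Within nb k v u
    reverse here = here
    reverse {u = u} (step i w) with j , eq ← nb-symmetric u i = subst (Within nb _ _) eq (reverse w ▷ j)

    -- From one of two vertices of the same kind, a single step leads to a vertex of the other kind,
    -- and the assumed bound covers the rest. The index `i` supplies that step. This suits even
    -- diameters, whose extreme pairs are of the same kind.
    near-even : ∀ {d} → I → (∀ c p l → Within nb d (pt c p) (ln l)) → ∀ u v → Within nb (suc d) u v
    near-even i near (pt c p) (ln l)    = weaken (near c p l)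
    near-even i near (ln l)   (pt c p)  = reverse (near-even i near (pt c p) (ln l))
    near-even i near (pt c p) (pt c′ p′) = reverse (line-step (line-back p′ i) (reverse (near c p (line p′ i))))
    near-even i near (ln l)   (ln l′)   = point-step true (i , refl) (near true (point l i) l′)

    typedBigraph : ∀ {d} → (∀ u v → Within nb d u v) → (∃ λ u → ∃ λ v → ¬ Within nb (pred d) u v) →
                   TypedBigraph Vertex s (2 * s) d
    typedBigraph near far = record
      { side         = isPoint
      ; nb           = nb
      ; nb-injective = λ where
          (pt _ p) eq → to-injective (↔-sym index) (line-injective p (inj₂-injective eq))
          (ln l)   eq → to-injective (↔-sym index₂) (cong₂ _,_ (,-injectiveˡ (inj₁-injective eq)) (point-injective l (,-injectiveʳ (inj₁-injective eq))))
      ; nb-symmetric = nb-symmetric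
      ; nb-side      = λ { (pt _ _) _ () ; (ln _) _ () }
      ; near         = near
      ; far          = far
      }

    vertex↔ : ∀ {m} → P ↔ Fin m → L ↔ Fin m → Vertex ↔ Fin (2 * m + m)
    vertex↔ P↔ L↔ = ↔-sym +↔⊎ ↔-∘ ((↔-sym *↔× ↔-∘ (↔-sym 2↔Bool ×-↔ P↔)) ⊎-↔ L↔)

  -- Words

  infixr 5 _∷_

  -- The number bounds the length from above, so one type holds all vertices of a kind; it has 1 + q
  -- + ... + qⁿ elements.
  data Word (A : Set) : ℕ → Set where
    []  : Word A n
    _∷_ : A → Word A n → Word A (suc n)

  words : ℕ → ℕ → ℕ
  words q zero    = 1
  words q (suc n) = 1 + q * words q n

  word↔ : ∀ {q} → A ↔ Fin q → ∀ n → Word A n ↔ Fin (words q n)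
  word↔ e zero    = mk↔ₛ′ (λ { [] → zero }) (λ { zero → [] }) (λ { zero → refl }) (λ { [] → refl })
  word↔ e (suc n) = ↔-sym +↔⊎ ↔-∘ ((↔-sym 1↔⊤ ⊎-↔ (↔-sym *↔× ↔-∘ (e ×-↔ word↔ e n))) ↔-∘
    mk↔ₛ′ (λ { [] → inj₁ tt ; (a ∷ w) → inj₂ (a , w) }) (λ { (inj₁ _) → [] ; (inj₂ (a , w)) → a ∷ w })
          (λ { (inj₁ _) → refl ; (inj₂ _) → refl }) (λ { [] → refl ; (_ ∷ _) → refl }))

  maybe↔ : ∀ {q} → A ↔ Fin q → Maybe A ↔ Fin (suc q)
  maybe↔ e = mk↔ₛ′ (λ { nothing → zero ; (just a) → suc (to a) }) (λ { zero → nothing ; (suc i) → just (from i) })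
    (λ { zero → refl ; (suc i) → cong suc (strictlyInverseˡ i) }) (λ { nothing → refl ; (just a) → cong just (strictlyInverseʳ a) })
    where open Inverse e

  -- The parent of a word is a word of the other kind; parent [] = [] makes the
  -- empty point and the empty line incident.
  parent : Word A n → Word A n
  parent []          = []
  parent (a ∷ [])    = []
  parent (a ∷ b ∷ w) = a ∷ parent (b ∷ w)

-- Incidence of words and the level of a vertex

module Polygons where

  open import Defs
  open Graphs
  open import Data.Bool.Base using (true)
  open import Data.Fin.Base using (Fin)
  open import Data.Maybe.Base as Maybe using (Maybe; just; nothing; maybe′)
  open import Data.Maybe.Properties using (just-injective)
  open import Data.Nat.Base using (ℕ; zero; suc; _+_; _*_; _≤_; z≤n; s≤s; ⌊_/2⌋; ⌈_/2⌉)
  open import Data.Nat.Properties using (≤-trans; ≤-reflexive; n≤1+n; *-monoʳ-≤; *-suc; ⌊n/2⌋-mono; 1+n≰n; suc-injective)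
  open import Data.Product.Base using (∃; _,_; proj₂)
  open import Data.Vec.Base using (Vec; []; _∷_; head)
  open import Function.Base using (case_of_)
  open import Function.Bundles using (_↔_; Inverse)
  open import Relation.Binary.PropositionalEquality using (_≡_; _≢_; refl; sym; trans; cong)
  open import Relation.Nullary using (contradiction)

  private variable
    A : Set
    n : ℕ

  length : Word A n → ℕ
  length []      = 0
  length (_ ∷ w) = suc (length w)

  ⌜_⌝ : Vec A n → Word A n
  ⌜ [] ⌝    = []
  ⌜ x ∷ u ⌝ = x ∷ ⌜ u ⌝

  -- Recognises the words of maximal length, at which extension by a letter gives way to the
  -- equations of `Coordinates`.
  full : Word A n → Maybe (Vec A n)
  full {n = zero}  []      = just []
  full {n = suc n} []      = nothing
  full             (x ∷ w) = Maybe.map (x ∷_) (full w)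

  -- A full word has no room for another letter; there the value is junk.
  _∷ʳ_ : Word A n → A → Word A n
  _∷ʳ_ {n = zero}  []      a = []
  _∷ʳ_ {n = suc n} []      a = a ∷ []
  (x ∷ w) ∷ʳ a = x ∷ (w ∷ʳ a)

  full-⌜⌝ : (u : Vec A n) → full ⌜ u ⌝ ≡ just u
  full-⌜⌝ []      = refl
  full-⌜⌝ (x ∷ u) rewrite full-⌜⌝ u = refl

  full⇒⌜⌝ : (w : Word A n) {u : Vec A n} → full w ≡ just u → w ≡ ⌜ u ⌝
  full⇒⌜⌝ {n = zero} [] {[]} _ = refl
  full⇒⌜⌝ (x ∷ w) eq with full w in eq′
  full⇒⌜⌝ (x ∷ w) refl | just u = cong (x ∷_) (full⇒⌜⌝ w eq′)

  length-⌜⌝ : (u : Vec A n) → length ⌜ u ⌝ ≡ n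
  length-⌜⌝ []      = refl
  length-⌜⌝ (x ∷ u) = cong suc (length-⌜⌝ u)

  ⌜⌝-injective : {u v : Vec A n} → ⌜ u ⌝ ≡ ⌜ v ⌝ → u ≡ v
  ⌜⌝-injective {u = u} {v} eq = just-injective (trans (sym (full-⌜⌝ u)) (trans (cong full eq) (full-⌜⌝ v)))

  full-tail : (x : A) (w : Word A n) → full (x ∷ w) ≡ nothing → full w ≡ nothing
  full-tail x w eq with full w
  ... | nothing = refl

  length-∷ʳ : (w : Word A n) (a : A) → full w ≡ nothing → length (w ∷ʳ a) ≡ suc (length w)
  length-∷ʳ {n = suc n} [] a _ = refl
  length-∷ʳ (x ∷ w) a eq = cong suc (length-∷ʳ w a (full-tail x w eq))

  ∷-injective-tail : {x y : A} {w v : Word A n} → _≡_ {A = Word A (suc n)} (x ∷ w) (y ∷ v) → w ≡ v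
  ∷-injective-tail refl = refl

  ∷ʳ-injective : (w : Word A n) {a b : A} → full w ≡ nothing → w ∷ʳ a ≡ w ∷ʳ b → a ≡ b
  ∷ʳ-injective {n = suc n} [] _ refl = refl
  ∷ʳ-injective (x ∷ w) eq eq′ = ∷ʳ-injective w (full-tail x w eq) (∷-injective-tail eq′)

  parent-∷ʳ : (w : Word A n) (a : A) → full w ≡ nothing → parent (w ∷ʳ a) ≡ w
  parent-∷ʳ {n = suc n} [] a _ = refl
  parent-∷ʳ {n = suc (suc n)} (x ∷ []) a _ = refl
  parent-∷ʳ (x ∷ y ∷ w) a eq = cong (x ∷_) (parent-∷ʳ (y ∷ w) a (full-tail x (y ∷ w) eq))

  length-parent : (w : Word A n) → length (parent w) ≤ length w
  length-parent []          = z≤n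
  length-parent (a ∷ [])    = z≤n
  length-parent (a ∷ b ∷ w) = s≤s (length-parent (b ∷ w))

  parent-full : (x : A) (w : Word A n) → full (parent (x ∷ w)) ≡ nothing
  parent-full x []      = refl
  parent-full x (y ∷ w) rewrite parent-full y w = refl

  parent-last : (x : A) (w : Word A n) → ∃ λ a → parent (x ∷ w) ∷ʳ a ≡ x ∷ w
  parent-last x []      = x , refl
  parent-last x (y ∷ w) with a , eq ← parent-last y w = a , cong (x ∷_) eq

  length-parent≡⇒[] : (w : Word A n) → length (parent w) ≡ length w → w ≡ []
  length-parent≡⇒[] []          _  = refl
  length-parent≡⇒[] (a ∷ b ∷ w) eq with () ← length-parent≡⇒[] (b ∷ w) (suc-injective eq)

  -- `topLine u a` is the line of maximal length through the point `u` with first letter `a`. The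
  -- last two laws say that "being `topLine u a` for some `a`" and "being `topPoint l a` for some
  -- `a`" describe the same incidence.
  record Coordinates (A : Set) (n : ℕ) : Set where
    field
      topLine topPoint : Vec A (suc n) → A → Vec A (suc n)
      topLine-head     : ∀ u a → head (topLine u a) ≡ a
      topPoint-head    : ∀ u a → head (topPoint u a) ≡ a
      topPoint-topLine : ∀ u a → topPoint (topLine u a) (head u) ≡ u
      topLine-topPoint : ∀ u a → topLine (topPoint u a) (head u) ≡ u

  module Growth {A : Set} {n : ℕ} where

    private W = Word A (suc n)

    -- The index `nothing` stands for the parent, so `Maybe A` provides the q + 1 neighbours of
    -- every word, whatever its length.
    grow : (Vec A (suc n) → A → Vec A (suc n)) → W → Maybe A → W
    grow top w nothing  = parent w
    grow top w (just a) = maybe′ (λ u → ⌜ top u a ⌝) (w ∷ʳ a) (full w)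

    module _ (top : Vec A (suc n) → A → Vec A (suc n)) where

      length-grow : ∀ w i → length (grow top w i) ≤ suc (length w)
      length-grow w nothing  = ≤-trans (length-parent w) (n≤1+n _)
      length-grow w (just a) with full w in eq
      ... | nothing = ≤-reflexive (length-∷ʳ w a eq)
      ... | just u rewrite full⇒⌜⌝ w eq = ≤-trans (≤-reflexive (trans (length-⌜⌝ (top u a)) (sym (length-⌜⌝ u)))) (n≤1+n _)

      -- An extension is longer than the word and the parent is not. For a full word the other
      -- neighbours have its length, which the parent attains only at the empty word; but there is
      -- room for at least one letter, so the empty word is not full.
      parent≢grow : ∀ w a → parent w ≢ grow top w (just a)
      parent≢grow w a eq with full w in eq′
      ... | nothing = 1+n≰n (≤-trans (≤-reflexive (trans (sym (length-∷ʳ w a eq′)) (sym (cong length eq)))) (length-parent w))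
      ... | just u with refl ← full⇒⌜⌝ w eq′ =
        case length-parent≡⇒[] ⌜ u ⌝ (trans (cong length eq) (trans (length-⌜⌝ (top u a)) (sym (length-⌜⌝ u)))) of λ eq″ →
        case trans (sym (length-⌜⌝ u)) (cong length eq″) of λ ()

      grow-injective : (∀ u a → head (top u a) ≡ a) → ∀ w {i j} → grow top w i ≡ grow top w j → i ≡ j
      grow-injective _  w {nothing} {nothing} eq = refl
      grow-injective _  w {nothing} {just b}  eq = contradiction eq (parent≢grow w b)
      grow-injective _  w {just a}  {nothing} eq = contradiction (sym eq) (parent≢grow w a)
      grow-injective hd w {just a}  {just b}  eq with full w in eq′
      ... | nothing = cong just (∷ʳ-injective w eq′ eq)
      ... | just u  = cong just (trans (sym (hd u a)) (trans (cong head (⌜⌝-injective eq)) (hd u b)))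

      grow-back : (top′ : Vec A (suc n) → A → Vec A (suc n)) → (∀ u a → top′ (top u a) (head u) ≡ u) →
                  ∀ w i → ∃ λ j → grow top′ (grow top w i) j ≡ w
      grow-back top′ inv []      nothing = nothing , refl
      grow-back top′ inv (x ∷ w) nothing with a , eq ← parent-last x w =
        just a , trans (cong (maybe′ _ _) (parent-full x w)) eq
      grow-back top′ inv w (just a) with full w in eq
      ... | nothing = nothing , parent-∷ʳ w a eq
      ... | just u with refl ← full⇒⌜⌝ w eq =
        just (head u) , trans (cong (maybe′ _ _) (full-⌜⌝ (top u a))) (cong ⌜_⌝ (inv u a))

  module Polygon {A : Set} {n q : ℕ} (C : Coordinates A n) (A↔ : A ↔ Fin q) where
    open Coordinates C
    open Growth

    incidence : Incidence (Word A (suc n)) (Word A (suc n)) (Maybe A)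
    incidence = record
      { line            = grow topLine
      ; point           = grow topPoint
      ; line-injective  = grow-injective topLine topLine-head
      ; point-injective = grow-injective topPoint topPoint-head
      ; line-back       = grow-back topLine topPoint topPoint-topLine
      ; point-back      = grow-back topPoint topLine topLine-topPoint
      }

    open Doubling incidence (maybe↔ A↔) public

    -- This is the distance from the empty point. Deleting letters one by one ends at the empty
    -- point or at the empty line, one step away from it, depending on parity; hence the rounding,
    -- and hence even levels for points and odd ones for lines.
    level : Vertex → ℕ
    level (pt _ p) = 2 * ⌈ length p /2⌉
    level (ln l)   = suc (2 * ⌊ length l /2⌋)

    level-step : ∀ v i → level (nb v i) ≤ suc (level v)
    -- `⌈ m /2⌉` computes to `⌊ suc m /2⌋`, so in both cases monotonicity of the floor is enough.
    level-step (pt _ p) i = s≤s (*-monoʳ-≤ 2 (⌊n/2⌋-mono (length-grow topLine p (Inverse.from (maybe↔ A↔) i))))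
    level-step (ln l)   i = ≤-trans (*-monoʳ-≤ 2 (⌊n/2⌋-mono (s≤s (length-grow topPoint l (proj₂ (Inverse.from index₂ i)))))) (≤-reflexive (*-suc 2 ⌊ length l /2⌋))

    polygonBigraph : ∀ {d} (v : Vertex) → level v ≡ suc d → (∀ u v → Within nb (suc d) u v) →
                     Bigraph (suc q) (2 * suc q) (suc d) (2 * words q (suc n) + words q (suc n))
    polygonBigraph v eq near = bigraph (typedBigraph near (pt true [] , v , λ w →
      1+n≰n (≤-trans (≤-reflexive (sym eq)) (level-bound level level-step w)))) (vertex↔ (word↔ A↔ _) (word↔ A↔ _))

-- Polynomial identities modulo hypotheses

module Solver where

  open import Algebra.Bundles using (CommutativeRing)
  import Algebra.Properties.Ring as RingProperties
  open import Data.Bool.Base using (Bool; true; false; if_then_else_; not; _xor_; _∧_; T)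
  open import Data.List.Base using (List; []; _∷_; foldr; map)
  open import Data.Nat.Base using (ℕ; zero; suc; _<ᵇ_; _≡ᵇ_)
  open import Data.Nat.Properties using (≡ᵇ⇒≡)
  open import Data.Product.Base using (_×_; _,_)
  open import Data.Unit.Base using (⊤; tt)
  open import Data.Vec.Base using (Vec; []; _∷_; toList)
  open import Level using (0ℓ)
  import Relation.Binary.PropositionalEquality as P
  import Relation.Binary.Reasoning.Setoid as SetoidReasoning
  open P using (_≡_)

  -- A formula over any type with operations is written once and read both in a ring and in `Expr`.
  -- Evaluating the second reading computes to the first, so coordinate maps and forms can be used
  -- directly inside the problems given to the solver.
  record Ops (A : Set) : Set where
    infixl 6 _+_ _-_
    infixl 7 _*_
    infix  8 -_
    field
      _+_ _*_ : A → A → A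
      -_      : A → A
      0# 1#   : A
    _-_ : A → A → A
    x - y = x + - y

  open Ops ⦃ ... ⦄ public

  data Expr : Set where
    var       : ℕ → Expr
    _:+_ _:*_ : Expr → Expr → Expr
    :-_       : Expr → Expr
    :0 :1     : Expr

  instance
    exprOps : Ops Expr
    exprOps = record { _+_ = _:+_ ; _*_ = _:*_ ; -_ = :-_ ; 0# = :0 ; 1# = :1 }

  vars : ℕ → ∀ n → Vec Expr n
  vars k zero    = []
  vars k (suc n) = var k ∷ vars (suc k) n

  -- A polynomial is a sorted list of signed monomials; the coefficient 3 is a
  -- threefold repetition.
  Mono Poly : Set
  Mono = List ℕ
  Poly = List (Bool × Mono)

  _≡ᴹ_ _<ᴹ_ : Mono → Mono → Bool
  []      ≡ᴹ []      = true
  (i ∷ m) ≡ᴹ (j ∷ n) = (i ≡ᵇ j) ∧ (m ≡ᴹ n)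
  _       ≡ᴹ _       = false
  []      <ᴹ []      = false
  []      <ᴹ (_ ∷ _) = true
  (_ ∷ _) <ᴹ []      = false
  (i ∷ m) <ᴹ (j ∷ n) = if i ≡ᵇ j then m <ᴹ n else (i <ᵇ j)

  insertVar : ℕ → Mono → Mono
  insertVar i []      = i ∷ []
  insertVar i (j ∷ m) = if i <ᵇ j then i ∷ j ∷ m else j ∷ insertVar i m

  -- Equal monomials of opposite signs cancel when they meet, so an expression that vanishes over
  -- the integers is normalised to the empty list.
  insert : Bool × Mono → Poly → Poly
  insert t [] = t ∷ []
  insert (s , m) ((s′ , m′) ∷ p) =
    if m <ᴹ m′ then (s , m) ∷ (s′ , m′) ∷ p else
    (if m ≡ᴹ m′ then (if s xor s′ then p else (s , m) ∷ (s′ , m′) ∷ p)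
     else (s′ , m′) ∷ insert (s , m) p)

  mulTerm : Bool × Mono → Bool × Mono → Bool × Mono
  mulTerm (s , m) (s′ , m′) = (s xor s′) , foldr insertVar m′ m

  normalise : Expr → Poly
  normalise (var i)  = (false , i ∷ []) ∷ []
  normalise (e :+ f) = foldr insert (normalise f) (normalise e)
  normalise (e :* f) = foldr (λ t p → foldr (λ t′ → insert (mulTerm t t′)) p (normalise f)) [] (normalise e)
  normalise (:- e)   = map (λ (s , m) → not s , m) (normalise e)
  normalise :0       = []
  normalise :1       = (false , []) ∷ []

  record Problem : Set where
    constructor _≐_by_
    field
      lhs rhs : Expr
      hyps    : List (Expr × Expr × Expr)

  infix 2 _≐_by_ _≐_

  _≐_ : Expr → Expr → Problem
  l ≐ r = l ≐ r by []

  -- lhs = rhs + Σ c (a − b), summed over the hypotheses (c , a , b), which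
  -- read a ≈ b.
  combination : Expr → List (Expr × Expr × Expr) → Expr
  combination r []                 = r
  combination r ((c , a , b) ∷ hs) = combination r hs + c * (a - b)

  module RingSolver (R : CommutativeRing 0ℓ 0ℓ) where

    private module R = CommutativeRing R
    open R using (Carrier; _≈_; setoid; +-cong; *-cong; -‿cong; +-assoc; +-comm; *-assoc; *-comm)
    open SetoidReasoning setoid
    open RingProperties R.ring using (-0#≈0#; -‿distribˡ-*; -‿distribʳ-*; -‿+-comm; -‿involutive)

    instance
      ringOps : Ops Carrier
      ringOps = record { _+_ = R._+_ ; _*_ = R._*_ ; -_ = R.-_ ; 0# = R.0# ; 1# = R.1# }

    private
      nth : List Carrier → ℕ → Carrier
      nth []       _       = R.0#
      nth (x ∷ xs) zero    = x
      nth (x ∷ xs) (suc i) = nth xs i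

    module _ (ρ : List Carrier) where

      ⟦_⟧ : Expr → Carrier
      ⟦ var i ⟧  = nth ρ i
      ⟦ e :+ f ⟧ = ⟦ e ⟧ R.+ ⟦ f ⟧
      ⟦ e :* f ⟧ = ⟦ e ⟧ R.* ⟦ f ⟧
      ⟦ :- e ⟧   = R.- ⟦ e ⟧
      ⟦ :0 ⟧     = R.0#
      ⟦ :1 ⟧     = R.1#

      Hyps : List (Expr × Expr × Expr) → Set
      Hyps []                 = ⊤
      Hyps ((c , a , b) ∷ hs) = ⟦ a ⟧ ≈ ⟦ b ⟧ × Hyps hs

      private
        mono : Mono → Carrier
        mono []      = R.1#
        mono (i ∷ m) = nth ρ i R.* mono m

        term : Bool × Mono → Carrier
        term (false , m) = mono m
        term (true  , m) = R.- mono m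

        poly : Poly → Carrier
        poly []      = R.0#
        poly (t ∷ p) = term t R.+ poly p

        swap+ : ∀ x y z → x R.+ (y R.+ z) ≈ y R.+ (x R.+ z)
        swap+ x y z = R.trans (R.sym (+-assoc x y z)) (R.trans (+-cong (+-comm x y) R.refl) (+-assoc y x z))

        swap* : ∀ x y z → x R.* (y R.* z) ≈ y R.* (x R.* z)
        swap* x y z = R.trans (R.sym (*-assoc x y z)) (R.trans (*-cong (*-comm x y) R.refl) (*-assoc y x z))

        ≡ᴹ⇒≡ : ∀ m n → m ≡ᴹ n ≡ true → m ≡ n
        ≡ᴹ⇒≡ []      []      _ = P.refl
        ≡ᴹ⇒≡ (i ∷ m) (j ∷ n) e with i ≡ᵇ j in eq
        ... | true = P.cong₂ _∷_ (≡ᵇ⇒≡ i j (P.subst T (P.sym eq) tt)) (≡ᴹ⇒≡ m n e)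

        insertVar-sound : ∀ i m → mono (insertVar i m) ≈ nth ρ i R.* mono m
        insertVar-sound i []      = R.refl
        insertVar-sound i (j ∷ m) with i <ᵇ j
        ... | true  = R.refl
        ... | false = R.trans (*-cong R.refl (insertVar-sound i m)) (swap* (nth ρ j) (nth ρ i) (mono m))

        foldr-insertVar-sound : ∀ m n → mono (foldr insertVar n m) ≈ mono m R.* mono n
        foldr-insertVar-sound []      n = R.sym (R.*-identityˡ _)
        foldr-insertVar-sound (i ∷ m) n =
          R.trans (insertVar-sound i (foldr insertVar n m)) (R.trans (*-cong R.refl (foldr-insertVar-sound m n)) (R.sym (*-assoc _ _ _)))

        cancel : ∀ s s′ m → s xor s′ ≡ true → term (s , m) R.+ term (s′ , m) ≈ R.0#
        cancel false true  m _ = R.-‿inverseʳ _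
        cancel true  false m _ = R.-‿inverseˡ _

        insert-sound : ∀ t p → poly (insert t p) ≈ term t R.+ poly p
        insert-sound t [] = R.refl
        insert-sound (s , m) ((s′ , m′) ∷ p) with m <ᴹ m′
        ... | true = R.refl
        ... | false with m ≡ᴹ m′ in eq
        ...   | false = R.trans (+-cong R.refl (insert-sound (s , m) p)) (swap+ _ _ _)
        ...   | true with s xor s′ in eq′
        ...     | false = R.refl
        ...     | true with P.refl ← ≡ᴹ⇒≡ m m′ eq = begin
          poly p                                        ≈⟨ R.+-identityˡ _ ⟨
          R.0# R.+ poly p                               ≈⟨ +-cong (cancel s s′ m eq′) R.refl ⟨
          (term (s , m) R.+ term (s′ , m)) R.+ poly p   ≈⟨ +-assoc _ _ _ ⟩
          term (s , m) R.+ (term (s′ , m) R.+ poly p)   ∎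

        mulTerm-sound : ∀ t t′ → term (mulTerm t t′) ≈ term t R.* term t′
        mulTerm-sound (false , m) (false , n) = foldr-insertVar-sound m n
        mulTerm-sound (false , m) (true  , n) = R.trans (-‿cong (foldr-insertVar-sound m n)) (-‿distribʳ-* _ _)
        mulTerm-sound (true  , m) (false , n) = R.trans (-‿cong (foldr-insertVar-sound m n)) (-‿distribˡ-* _ _)
        mulTerm-sound (true  , m) (true  , n) = R.trans (foldr-insertVar-sound m n) (begin
          mono m R.* mono n             ≈⟨ -‿involutive _ ⟨
          R.- (R.- (mono m R.* mono n)) ≈⟨ -‿cong (-‿distribʳ-* _ _) ⟩
          R.- (mono m R.* R.- mono n)   ≈⟨ -‿distribˡ-* _ _ ⟩
          R.- mono m R.* R.- mono n     ∎)

        add-sound : ∀ p q → poly (foldr insert q p) ≈ poly p R.+ poly q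
        add-sound []      q = R.sym (R.+-identityˡ _)
        add-sound (t ∷ p) q =
          R.trans (insert-sound t (foldr insert q p)) (R.trans (+-cong R.refl (add-sound p q)) (R.sym (+-assoc _ _ _)))

        scale-sound : ∀ t q p → poly (foldr (λ t′ → insert (mulTerm t t′)) p q) ≈ term t R.* poly q R.+ poly p
        scale-sound t []       p = R.sym (R.trans (+-cong (R.zeroʳ _) R.refl) (R.+-identityˡ _))
        scale-sound t (t′ ∷ q) p = begin
          poly (insert (mulTerm t t′) r)                              ≈⟨ insert-sound (mulTerm t t′) r ⟩
          term (mulTerm t t′) R.+ poly r                              ≈⟨ +-cong (mulTerm-sound t t′) (scale-sound t q p) ⟩
          term t R.* term t′ R.+ (term t R.* poly q R.+ poly p)       ≈⟨ +-assoc _ _ _ ⟨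
          (term t R.* term t′ R.+ term t R.* poly q) R.+ poly p       ≈⟨ +-cong (R.distribˡ _ _ _) R.refl ⟨
          term t R.* (term t′ R.+ poly q) R.+ poly p                  ∎
          where r = foldr (λ t′ → insert (mulTerm t t′)) p q

        mul-sound : ∀ p q → poly (foldr (λ t r → foldr (λ t′ → insert (mulTerm t t′)) r q) [] p) ≈ poly p R.* poly q
        mul-sound []      q = R.sym (R.zeroˡ _)
        mul-sound (t ∷ p) q =
          R.trans (scale-sound t q _) (R.trans (+-cong R.refl (mul-sound p q)) (R.sym (R.distribʳ _ _ _)))

        neg-sound : ∀ p → poly (map (λ (s , m) → not s , m) p) ≈ R.- poly p
        neg-sound []                = R.sym -0#≈0#
        neg-sound ((false , m) ∷ p) = R.trans (+-cong R.refl (neg-sound p)) (-‿+-comm _ _)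
        neg-sound ((true  , m) ∷ p) =
          R.trans (+-cong (R.sym (-‿involutive _)) (neg-sound p)) (-‿+-comm _ _)

        normalise-sound : ∀ e → ⟦ e ⟧ ≈ poly (normalise e)
        normalise-sound (var i)  = R.sym (R.trans (R.+-identityʳ _) (R.*-identityʳ _))
        normalise-sound (e :+ f) =
          R.trans (+-cong (normalise-sound e) (normalise-sound f)) (R.sym (add-sound (normalise e) (normalise f)))
        normalise-sound (e :* f) =
          R.trans (*-cong (normalise-sound e) (normalise-sound f)) (R.sym (mul-sound (normalise e) (normalise f)))
        normalise-sound (:- e)   = R.trans (-‿cong (normalise-sound e)) (R.sym (neg-sound (normalise e)))
        normalise-sound :0       = R.refl
        normalise-sound :1       = R.sym (R.+-identityʳ _)

        combination-sound : ∀ r hs → Hyps hs → ⟦ combination r hs ⟧ ≈ ⟦ r ⟧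
        combination-sound r []                 _        = R.refl
        combination-sound r ((c , a , b) ∷ hs) (h , hh) = begin
          ⟦ combination r hs ⟧ R.+ ⟦ c ⟧ R.* (⟦ a ⟧ R.+ R.- ⟦ b ⟧) ≈⟨ +-cong (combination-sound r hs hh) (*-cong R.refl (+-cong h R.refl)) ⟩
          ⟦ r ⟧ R.+ ⟦ c ⟧ R.* (⟦ b ⟧ R.+ R.- ⟦ b ⟧)                ≈⟨ +-cong R.refl (*-cong R.refl (R.-‿inverseʳ _)) ⟩
          ⟦ r ⟧ R.+ ⟦ c ⟧ R.* R.0#                                 ≈⟨ +-cong R.refl (R.zeroʳ _) ⟩
          ⟦ r ⟧ R.+ R.0#                                           ≈⟨ R.+-identityʳ _ ⟩
          ⟦ r ⟧                                                    ∎

      abstract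
        -- The coefficients in `hs` certify that `l - r` lies in the ideal generated by the
        -- differences of the hypotheses. The check takes place in integer polynomials and so is
        -- valid over every commutative ring.
        combine : ∀ l r hs → normalise (l - combination r hs) ≡ [] → Hyps hs → ⟦ l ⟧ ≈ ⟦ r ⟧
        combine l r hs nf h = begin
          ⟦ l ⟧                                  ≈⟨ R.+-identityʳ _ ⟨
          ⟦ l ⟧ R.+ R.0#                         ≈⟨ +-cong R.refl (R.-‿inverseˡ _) ⟨
          ⟦ l ⟧ R.+ (R.- ⟦ k ⟧ R.+ ⟦ k ⟧)        ≈⟨ +-assoc _ _ _ ⟨
          (⟦ l ⟧ R.+ R.- ⟦ k ⟧) R.+ ⟦ k ⟧        ≈⟨ +-cong vanishes (combination-sound r hs h) ⟩
          R.0# R.+ ⟦ r ⟧                         ≈⟨ R.+-identityˡ _ ⟩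
          ⟦ r ⟧                                  ∎
          where
          k : Expr
          k = combination r hs

          vanishes : ⟦ l - k ⟧ ≈ R.0#
          vanishes = R.trans (normalise-sound (l - k)) (R.reflexive (P.cong poly nf))

    module _ {n : ℕ} (ρ : Vec Carrier n) (problem : Vec Expr n → Problem) where
      open Problem (problem (vars 0 n))

      linear : normalise (lhs - combination rhs hyps) ≡ [] → Hyps (toList ρ) hyps → ⟦_⟧ (toList ρ) lhs ≈ ⟦_⟧ (toList ρ) rhs
      linear = combine (toList ρ) lhs rhs hyps

      -- With an empty list of hypotheses `Hyps` computes to the unit type, and the implicit
      -- argument is filled in by itself.
      solve : normalise (lhs - combination rhs hyps) ≡ [] → {Hyps (toList ρ) hyps} → ⟦_⟧ (toList ρ) lhs ≈ ⟦_⟧ (toList ρ) rhs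
      solve nf {h} = linear nf h

-- Finite fields and identities between vectors over them

module FiniteFields where

  open Graphs
  open Solver
  open import Algebra.Bundles using (CommutativeRing)
  open import Algebra.Structures using (IsCommutativeRing)
  open import Data.Fin.Base using (Fin)
  open import Data.Fin.Properties using () renaming (_≟_ to _≟ᶠ_)
  open import Data.List.Base using (List; []; _∷_)
  open import Data.Nat.Base using (ℕ; suc)
  open import Data.Product.Base using (∃; _×_; _,_)
  open import Data.Unit.Base using (⊤; tt)
  open import Data.Vec.Base using (Vec; []; _∷_; head; tail; map; replicate; toList)
  open import Function.Bundles using (_↔_; Inverse)
  open import Level using (0ℓ)
  open import Relation.Binary.Definitions using (DecidableEquality)
  open import Relation.Binary.PropositionalEquality using (_≡_; _≢_; refl; trans; cong; cong₂)
  open import Relation.Nullary.Decidable using (map′)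

  record FiniteField (q : ℕ) : Set₁ where
    field
      F                 : Set
      enumeration       : F ↔ Fin q
      ⦃ ops ⦄           : Ops F
      isCommutativeRing : IsCommutativeRing _≡_ (_+_ {F}) _*_ -_ 0# 1#
      1≢0               : _≢_ {A = F} 1# 0#
      inverse           : (x : F) → x ≢ 0# → ∃ λ y → x * y ≡ 1#

    infix 4 _≟_
    _≟_ : DecidableEquality F
    x ≟ y = map′ (to-injective enumeration) (cong (Inverse.to enumeration)) (Inverse.to enumeration x ≟ᶠ Inverse.to enumeration y)

    commutativeRing : CommutativeRing 0ℓ 0ℓ
    commutativeRing = record { isCommutativeRing = isCommutativeRing }

  module FieldProperties {q : ℕ} (𝔽 : FiniteField q) where
    open FiniteField 𝔽 public hiding (ops)
    open RingSolver commutativeRing public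

    -- This finds the point of a line at which a linear form vanishes, since the points of a line
    -- other than one are parametrised affinely.
    affine-root : (f : F → F) (c : F) → (∀ t → f t ≡ f 0# + t * c) → c ≢ 0# → ∃ λ t → f t ≡ 0#
    affine-root f c affine c≢0 with c⁻¹ , cc⁻¹≡1 ← inverse c c≢0 = t , trans (affine t)
      (linear (f 0# ∷ c ∷ c⁻¹ ∷ []) (λ { (f₀ ∷ c ∷ c⁻¹ ∷ []) →
        f₀ + - (f₀ * c⁻¹) * c ≐ 0# by (- f₀ , c * c⁻¹ , 1#) ∷ [] }) refl (cc⁻¹≡1 , tt))
      where
      t : F
      t = - (f 0# * c⁻¹)

    difference-zero : ∀ {x y} → x - y ≡ 0# → x ≡ y
    difference-zero {x} {y} h = linear (x ∷ y ∷ []) (λ { (x ∷ y ∷ []) → x ≐ y by (1# , x - y , 0#) ∷ [] }) refl (h , tt)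

    -- Division in the form in which it occurs: as the first letter of the line through two points
    -- whose own first letters differ.
    slope : ∀ {x y} → x ≢ y → (z : F) → ∃ λ k → (x - y) * k ≡ z
    slope {x} {y} x≢y z with d , e ← inverse (x - y) (λ h → x≢y (difference-zero h)) = z * d ,
      linear (x - y ∷ z ∷ d ∷ []) (λ { (x ∷ z ∷ d ∷ []) → x * (z * d) ≐ z by (z , x * d , 1#) ∷ [] }) refl (e , tt)

    private
      heads : ∀ {m} → List (Vec Expr (suc m) × Expr × Expr) → List (Expr × Expr × Expr)
      heads []                     = []
      heads ((c ∷ _ , a , b) ∷ hs) = (c , a , b) ∷ heads hs

      tails : ∀ {m} → List (Vec Expr (suc m) × Expr × Expr) → List (Vec Expr m × Expr × Expr)
      tails []                      = []
      tails ((_ ∷ cs , a , b) ∷ hs) = (cs , a , b) ∷ tails hs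

      residues : ∀ {m} → Vec Expr m → Vec Expr m → List (Vec Expr m × Expr × Expr) → Vec Poly m
      residues []       []       hs = []
      residues (l ∷ ls) (r ∷ rs) hs = normalise (l - combination r (heads hs)) ∷ residues ls rs (tails hs)

    Hypsᵛ : ∀ {m} → List F → List (Vec Expr m × Expr × Expr) → Set
    Hypsᵛ ρ []                 = ⊤
    Hypsᵛ ρ ((_ , a , b) ∷ hs) = ⟦_⟧ ρ a ≡ ⟦_⟧ ρ b × Hypsᵛ ρ hs

    abstract
      -- A hypothesis now carries a vector of coefficients, one for each coordinate of the equation
      -- to be proved.
      combineᵛ : ∀ {m} ρ (ls rs : Vec Expr m) hs → residues ls rs hs ≡ replicate m [] → Hypsᵛ ρ hs →
                 map (⟦_⟧ ρ) ls ≡ map (⟦_⟧ ρ) rs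
      combineᵛ ρ []       []       hs nf h = refl
      combineᵛ ρ (l ∷ ls) (r ∷ rs) hs nf h = cong₂ _∷_
        (combine ρ l r (heads hs) (cong head nf) (head-hyps hs h))
        (combineᵛ ρ ls rs (tails hs) (cong tail nf) (tail-hyps hs h))
        where
        head-hyps : ∀ {m} (hs : List (Vec Expr (suc m) × Expr × Expr)) → Hypsᵛ ρ hs → Hyps ρ (heads hs)
        head-hyps []                     _        = tt
        head-hyps ((_ ∷ _ , _ , _) ∷ hs) (h , hh) = h , head-hyps hs hh

        tail-hyps : ∀ {m} (hs : List (Vec Expr (suc m) × Expr × Expr)) → Hypsᵛ ρ hs → Hypsᵛ ρ (tails hs)
        tail-hyps []                     _        = tt
        tail-hyps ((_ ∷ _ , _ , _) ∷ hs) (h , hh) = h , tail-hyps hs hh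

    module _ {n m : ℕ} (ρ : Vec F n) (lhs rhs : Vec Expr n → Vec Expr m) where

      linearᵛ : (hyps : Vec Expr n → List (Vec Expr m × Expr × Expr)) →
                residues (lhs (vars 0 n)) (rhs (vars 0 n)) (hyps (vars 0 n)) ≡ replicate m [] →
                Hypsᵛ (toList ρ) (hyps (vars 0 n)) →
                map (⟦_⟧ (toList ρ)) (lhs (vars 0 n)) ≡ map (⟦_⟧ (toList ρ)) (rhs (vars 0 n))
      linearᵛ hyps = combineᵛ (toList ρ) (lhs (vars 0 n)) (rhs (vars 0 n)) (hyps (vars 0 n))

      solveᵛ : residues (lhs (vars 0 n)) (rhs (vars 0 n)) [] ≡ replicate m [] →
               map (⟦_⟧ (toList ρ)) (lhs (vars 0 n)) ≡ map (⟦_⟧ (toList ρ)) (rhs (vars 0 n))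
      solveᵛ nf = linearᵛ (λ _ → []) nf tt

module PlaneAndQuadrangle where

  open import Defs
  open FiniteFields
  open Graphs
  open Solver
  open import Data.Bool.Base using (true)
  open import Data.Empty using (⊥-elim)
  open import Data.List.Base using ([]; _∷_)
  open import Data.Maybe.Base using (Maybe; just; nothing)
  import Data.Nat.Base as ℕ
  open import Data.Nat.Base using (ℕ; suc)
  open import Data.Product.Base using (∃; _×_; _,_; swap; map₂)
  open import Data.Unit.Base using (tt)
  open import Data.Vec.Base using (Vec; []; _∷_; take; drop; _++_)
  open import Relation.Binary.PropositionalEquality using (_≡_; _≢_; refl; cong)
  open import Relation.Nullary using (yes; no)
  open Polygons

  -- The projective plane

  module Plane {q : ℕ} (𝔽 : FiniteField q) where
    open FieldProperties 𝔽

    cancel : ∀ a l k → a * k + (l - a * k) ≡ l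
    cancel a l k = solve (a ∷ l ∷ k ∷ []) (λ { (a ∷ l ∷ k ∷ []) → a * k + (l - a * k) ≐ l }) refl

    cancel′ : ∀ a b k → a * k + b - a * k ≡ b
    cancel′ a b k = solve (a ∷ b ∷ k ∷ []) (λ { (a ∷ b ∷ k ∷ []) → a * k + b - a * k ≐ b }) refl

    join-slope : ∀ a b l m k → (a - b) * k ≡ l - m → b * k + (l - a * k) ≡ m
    join-slope a b l m k h = linear (a ∷ b ∷ l ∷ m ∷ k ∷ []) (λ { (a ∷ b ∷ l ∷ m ∷ k ∷ []) →
      b * k + (l - a * k) ≐ m by (- 1# , (a - b) * k , l - m) ∷ [] }) refl (h , tt)

    meet-slope : ∀ a k b m c → (k - m) * a ≡ c - b → a * m + c ≡ a * k + b
    meet-slope a k b m c h = linear (a ∷ k ∷ b ∷ m ∷ c ∷ []) (λ { (a ∷ k ∷ b ∷ m ∷ c ∷ []) →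
      a * m + c ≐ a * k + b by (- 1# , (k - m) * a , c - b) ∷ [] }) refl (h , tt)

    -- The full point (x , y) lies on the full line (k , b) if y = x k + b. Points of length one are
    -- the directions of slope k and lines of length one the verticals; the empty words are the
    -- vertical direction and the line at infinity.
    coordinates : Coordinates F 1
    coordinates = record
      { topLine          = λ { (a ∷ l ∷ []) k → k ∷ (l - a * k) ∷ [] }
      ; topPoint         = λ { (k ∷ b ∷ []) a → a ∷ (a * k + b) ∷ [] }
      ; topLine-head     = λ { (a ∷ l ∷ []) k → refl }
      ; topPoint-head    = λ { (k ∷ b ∷ []) a → refl }
      ; topPoint-topLine = λ { (a ∷ l ∷ []) k → cong (λ l → a ∷ l ∷ []) (cancel a l k) }
      ; topLine-topPoint = λ { (k ∷ b ∷ []) a → cong (λ b → k ∷ b ∷ []) (cancel′ a b k) }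
      }

    open Polygon coordinates enumeration

    join : (p p′ : Word F 2) → ∃ λ l → l ∋ p × l ∋ p′
    join []           []              = [] , (nothing , refl) , (nothing , refl)
    join []           (a ∷ [])        = [] , (nothing , refl) , (just a , refl)
    join []           (a ∷ l ∷ [])    = (a ∷ []) , (nothing , refl) , (just l , refl)
    join (a ∷ [])     (b ∷ [])        = [] , (just a , refl) , (just b , refl)
    join (m ∷ [])     (a ∷ l ∷ [])    = (m ∷ (l - a * m) ∷ []) , (nothing , refl) ,
      (just a , cong (λ l → a ∷ l ∷ []) (cancel a l m))
    join (a ∷ l ∷ []) (b ∷ m ∷ [])    with a ≟ b
    ... | yes refl = (a ∷ []) , (just l , refl) , (just m , refl)
    ... | no a≢b with k , h ← slope a≢b (l - m) = (k ∷ (l - a * k) ∷ []) ,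
      (just a , cong (λ l → a ∷ l ∷ []) (cancel a l k)) ,
      (just b , cong (λ l → b ∷ l ∷ []) (join-slope a b l m k h))
    join p@(_ ∷ [])     []            = map₂ swap (join [] p)
    join p@(_ ∷ _ ∷ []) []            = map₂ swap (join [] p)
    join p@(_ ∷ _ ∷ []) (b ∷ [])      = map₂ swap (join (b ∷ []) p)

    meet : (l l′ : Word F 2) → ∃ λ p → l ∋ p × l′ ∋ p
    meet []           []              = [] , (nothing , refl) , (nothing , refl)
    meet []           (k ∷ [])        = [] , (nothing , refl) , (nothing , refl)
    meet []           (k ∷ b ∷ [])    = (k ∷ []) , (just k , refl) , (nothing , refl)
    meet (k ∷ [])     (m ∷ [])        = [] , (nothing , refl) , (nothing , refl)
    meet (a ∷ [])     (k ∷ b ∷ [])    = (a ∷ (a * k + b) ∷ []) , (just (a * k + b) , refl) , (just a , refl)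
    meet (k ∷ b ∷ []) (m ∷ c ∷ [])    with k ≟ m
    ... | yes refl = (k ∷ []) , (nothing , refl) , (nothing , refl)
    ... | no k≢m with a , h ← slope k≢m (c - b) = (a ∷ (a * k + b) ∷ []) , (just a , refl) ,
      (just a , cong (λ l → a ∷ l ∷ []) (meet-slope a k b m c h))
    meet l@(_ ∷ [])     []            = map₂ swap (meet [] l)
    meet l@(_ ∷ _ ∷ []) []            = map₂ swap (meet [] l)
    meet l@(_ ∷ _ ∷ []) (m ∷ [])      = map₂ swap (meet (m ∷ []) l)

    -- The extreme pairs are now a point and a line, so joins of points and meets of lines are both
    -- called for. A point reaches a line through the join with the parent of that line, which is
    -- one of its points.
    near : ∀ u v → Within nb 3 u v
    near (pt c p) (pt c′ p′) with _ , l∋p , l∋p′ ← join p p′ = weaken (collinear l∋p l∋p′)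
    near (pt c p) (ln l)     with _ , m∋p , m∋p′ ← join p (parent l) = collinear {c′ = c} m∋p m∋p′ ⟫ pt→ln (nothing , refl)
    near (ln l)   (pt c p)   = reverse (near (pt c p) (ln l))
    near (ln l)   (ln l′)    with _ , l∋p , l′∋p ← meet l l′ = weaken (concurrent l∋p l′∋p)

    bigraph₃ : Bigraph (suc q) (2 ℕ.* suc q) 3 (2 ℕ.* words q 2 ℕ.+ words q 2)
    bigraph₃ = polygonBigraph (ln (0# ∷ 0# ∷ [])) refl near

  -- The symplectic quadrangle

  module Quadrangle {q : ℕ} (𝔽 : FiniteField q) where
    open FieldProperties 𝔽

    module _ {A : Set} ⦃ _ : Ops A ⦄ where

      -- The letters k′ and b of a full line are those of its point with first letter 0, which is (0
      -- , k′ , b). Orthogonality to that point and to the parent (k , b) gives the formulas.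
      topLine topPoint : Vec A 3 → A → Vec A 3
      topLine  (a ∷ l ∷ a′ ∷ []) k = k ∷ (a′ - a * k) ∷ (l - (a * a′ + a * a′) + a * a * k) ∷ []
      topPoint (k ∷ b ∷ k′ ∷ []) a = a ∷ (k′ + (a * b + a * b) + a * a * k) ∷ (b + a * k) ∷ []

      point : Word A 3 → Maybe A → Word A 3
      point = Growth.grow topPoint

      vec : Word A 3 → Vec A 4
      vec []                = 1# ∷ 0# ∷ 0# ∷ 0# ∷ []
      vec (a ∷ [])          = - a ∷ 1# ∷ 0# ∷ 0# ∷ []
      vec (k ∷ b ∷ [])      = b ∷ k ∷ 1# ∷ 0# ∷ []
      vec (a ∷ l ∷ a′ ∷ []) = (l - a * a′) ∷ a′ ∷ a ∷ 1# ∷ []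

      ω : Vec A 4 → Vec A 4 → A
      ω (x₀ ∷ x₁ ∷ x₂ ∷ x₃ ∷ []) (y₀ ∷ y₁ ∷ y₂ ∷ y₃ ∷ []) = x₀ * y₃ - x₃ * y₀ + (x₁ * y₂ - x₂ * y₁)

      -- The slope of the form along the line `l`: the points `point l (just t)` move in the
      -- direction of `point l nothing`. On the empty line `vec (t ∷ [])` moves against `vec []`,
      -- whence the sign.
      pencil : Word A 3 → Vec A 4 → A
      pencil []         x = - ω x (vec [])
      pencil w@(_ ∷ _) x = ω x (vec (parent w))

    coordinates : Coordinates F 2
    coordinates = record
      { topLine          = topLine
      ; topPoint         = topPoint
      ; topLine-head     = λ { (a ∷ l ∷ a′ ∷ []) k → refl }
      ; topPoint-head    = λ { (k ∷ b ∷ k′ ∷ []) a → refl }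
      ; topPoint-topLine = λ { (a ∷ l ∷ a′ ∷ []) k → solveᵛ (k ∷ a ∷ l ∷ a′ ∷ [])
          (λ { (k ∷ u@(a ∷ _)) → topPoint (topLine u k) a }) (λ { (k ∷ u) → u }) refl }
      ; topLine-topPoint = λ { (k ∷ b ∷ k′ ∷ []) a → solveᵛ (a ∷ k ∷ b ∷ k′ ∷ [])
          (λ { (a ∷ u@(k ∷ _)) → topLine (topPoint u a) k }) (λ { (a ∷ u) → u }) refl }
      }

    open Coordinates coordinates using (topPoint-topLine)
    open Polygon coordinates enumeration

    private
      affine : Expr → Word Expr 3 → Vec Expr 4 → Problem
      affine t l x = ω x (vec (point l (just t))) ≐ ω x (vec (point l (just 0#))) + t * pencil l x

    vec-point : ∀ x l t → ω x (vec (point l (just t))) ≡ ω x (vec (point l (just 0#))) + t * pencil l x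
    vec-point x@(_ ∷ _ ∷ _ ∷ _ ∷ []) [] t = solve (t ∷ x) (λ { (t ∷ x) → affine t [] x }) refl
    vec-point x@(_ ∷ _ ∷ _ ∷ _ ∷ []) (k ∷ []) t = solve (t ∷ k ∷ x) (λ { (t ∷ k ∷ x) → affine t (k ∷ []) x }) refl
    vec-point x@(_ ∷ _ ∷ _ ∷ _ ∷ []) (a ∷ l ∷ []) t = solve (t ∷ a ∷ l ∷ x) (λ { (t ∷ a ∷ l ∷ x) → affine t (a ∷ l ∷ []) x }) refl
    vec-point x@(_ ∷ _ ∷ _ ∷ _ ∷ []) (k ∷ b ∷ k′ ∷ []) t = solve (t ∷ k ∷ b ∷ k′ ∷ x) (λ { (t ∷ k ∷ b ∷ k′ ∷ x) → affine t (k ∷ b ∷ k′ ∷ []) x }) refl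

    -- Up to sign the slope of the affine function is the value at the parent: if it is zero, the
    -- parent is orthogonal to `x`, and otherwise the function has a root.
    foot : ∀ x l → ∃ λ i → ω x (vec (point l i)) ≡ 0#
    foot x l@(_ ∷ _) with ω x (vec (parent l)) ≟ 0#
    ... | yes h = nothing , h
    ... | no h  = let t , e = affine-root _ _ (vec-point x l) h in just t , e
    foot x [] with - ω x (vec []) ≟ 0#
    ... | yes h = nothing , linear (ω x (vec []) ∷ []) (λ { (y ∷ []) → y ≐ 0# by (- 1# , - y , 0#) ∷ [] }) refl (h , tt)
    ... | no h  = let t , e = affine-root _ _ (vec-point x []) h in just t , e

    ω-03 : ∀ a l a′ → ω (vec []) (vec (a ∷ l ∷ a′ ∷ [])) ≢ 0#
    ω-03 a l a′ h = 1≢0 (linear (a ∷ l ∷ a′ ∷ []) (λ { (a ∷ l ∷ a′ ∷ []) →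
      1# ≐ 0# by (1# , ω (vec []) (vec (a ∷ l ∷ a′ ∷ [])) , 0#) ∷ [] }) refl (h , tt))

    ω-12 : ∀ a k b → ω (vec (a ∷ [])) (vec (k ∷ b ∷ [])) ≢ 0#
    ω-12 a k b h = 1≢0 (linear (a ∷ k ∷ b ∷ []) (λ { (a ∷ k ∷ b ∷ []) →
      1# ≐ 0# by (1# , ω (vec (a ∷ [])) (vec (k ∷ b ∷ [])) , 0#) ∷ [] }) refl (h , tt))

    ω-13 : ∀ a A l a′ → ω (vec (a ∷ [])) (vec (A ∷ l ∷ a′ ∷ [])) ≡ 0# → A ≡ a
    ω-13 a A l a′ h = linear (a ∷ A ∷ l ∷ a′ ∷ []) (λ { (a ∷ A ∷ l ∷ a′ ∷ []) →
      A ≐ a by (1# , ω (vec (a ∷ [])) (vec (A ∷ l ∷ a′ ∷ [])) , 0#) ∷ [] }) refl (h , tt)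

    ω-22 : ∀ k b K B → ω (vec (k ∷ b ∷ [])) (vec (K ∷ B ∷ [])) ≡ 0# → k ≡ K
    ω-22 k b K B h = linear (k ∷ b ∷ K ∷ B ∷ []) (λ { (k ∷ b ∷ K ∷ B ∷ []) →
      k ≐ K by (1# , ω (vec (k ∷ b ∷ [])) (vec (K ∷ B ∷ [])) , 0#) ∷ [] }) refl (h , tt)

    ω-23 : ∀ k b a l a′ → ω (vec (k ∷ b ∷ [])) (vec (a ∷ l ∷ a′ ∷ [])) ≡ 0# → a′ - a * k ≡ b
    ω-23 k b a l a′ h = linear (k ∷ b ∷ a ∷ l ∷ a′ ∷ []) (λ { (k ∷ b ∷ a ∷ l ∷ a′ ∷ []) →
      a′ - a * k ≐ b by (- 1# , ω (vec (k ∷ b ∷ [])) (vec (a ∷ l ∷ a′ ∷ [])) , 0#) ∷ [] }) refl (h , tt)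

    ω-33 : ∀ a l a′ L A′ → ω (vec (a ∷ l ∷ a′ ∷ [])) (vec (a ∷ L ∷ A′ ∷ [])) ≡ 0# → l ≡ L
    ω-33 a l a′ L A′ h = linear (a ∷ l ∷ a′ ∷ L ∷ A′ ∷ []) (λ { (a ∷ l ∷ a′ ∷ L ∷ A′ ∷ []) →
      l ≐ L by (1# , ω (vec (a ∷ l ∷ a′ ∷ [])) (vec (a ∷ L ∷ A′ ∷ [])) , 0#) ∷ [] }) refl (h , tt)

    -- The form equals l - L - (a - A) (a′ + A′). The choice of `k` makes the last letters agree,
    -- and then the vanishing of the form is the equation between the middle letters.
    ω-33′ : ∀ a l a′ A L A′ k → ω (vec (a ∷ l ∷ a′ ∷ [])) (vec (A ∷ L ∷ A′ ∷ [])) ≡ 0# → (a - A) * k ≡ a′ - A′ →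
            topPoint (topLine (a ∷ l ∷ a′ ∷ []) k) A ≡ A ∷ L ∷ A′ ∷ []
    ω-33′ a l a′ A L A′ k h s = linearᵛ (k ∷ a ∷ l ∷ a′ ∷ A ∷ L ∷ A′ ∷ [])
      (λ { (k ∷ a ∷ l ∷ a′ ∷ A ∷ _) → topPoint (topLine (a ∷ l ∷ a′ ∷ []) k) A })
      (λ { (_ ∷ _ ∷ _ ∷ _ ∷ z) → z })
      (λ { (k ∷ a ∷ l ∷ a′ ∷ A ∷ L ∷ A′ ∷ []) →
        (0# ∷ a - A ∷ - 1# ∷ [] , (a - A) * k , a′ - A′) ∷
        (0# ∷ 1# ∷ 0# ∷ [] , ω (vec (a ∷ l ∷ a′ ∷ [])) (vec (A ∷ L ∷ A′ ∷ [])) , 0#) ∷ [] })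
      refl (s , h , tt)

    ω-sym : ∀ x y → ω x y ≡ 0# → ω y x ≡ 0#
    ω-sym x@(_ ∷ _ ∷ _ ∷ _ ∷ []) y@(_ ∷ _ ∷ _ ∷ _ ∷ []) h = linear (x ++ y)
      (λ z → let x = take 4 z ; y = drop 4 z in ω y x ≐ 0# by (- 1# , ω x y , 0#) ∷ []) refl (h , tt)

    -- The points on a line of length m have lengths m - 1 and m + 1, except 0 and 1 for m = 0 and 2
    -- and 3 for m = 3. This leaves out the lengths 0, 3 and 1, 2, for which the form takes the
    -- value 1. In the other cases its vanishing identifies the letters that must be shared.
    join : ∀ p z → ω (vec p) (vec z) ≡ 0# → ∃ λ l → l ∋ p × l ∋ z
    join []                    []                    _ = [] , (nothing , refl) , (nothing , refl)
    join []                    (a ∷ [])              _ = [] , (nothing , refl) , (just a , refl)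
    join []                    (k ∷ b ∷ [])          _ = (k ∷ []) , (nothing , refl) , (just b , refl)
    join []                    (a ∷ l ∷ a′ ∷ [])     h = ⊥-elim (ω-03 a l a′ h)
    join (a ∷ [])              (A ∷ [])              _ = [] , (just a , refl) , (just A , refl)
    join (a ∷ [])              (k ∷ b ∷ [])          h = ⊥-elim (ω-12 a k b h)
    join (a ∷ [])              (A ∷ l ∷ a′ ∷ [])     h with refl ← ω-13 a A l a′ h =
      (a ∷ l ∷ []) , (nothing , refl) , (just a′ , refl)
    join (k ∷ b ∷ [])          (K ∷ B ∷ [])          h with refl ← ω-22 k b K B h =
      (k ∷ []) , (just b , refl) , (just B , refl)
    join (k ∷ b ∷ [])          z@(a ∷ l ∷ a′ ∷ [])   h =
      ⌜ topLine u k ⌝ , (nothing , cong (λ b → k ∷ b ∷ []) (ω-23 k b a l a′ h)) ,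
      (just a , cong ⌜_⌝ (topPoint-topLine u k))
      where u = a ∷ l ∷ a′ ∷ []
    join (a ∷ l ∷ a′ ∷ [])     (A ∷ L ∷ A′ ∷ [])     h with a ≟ A
    ... | yes refl with refl ← ω-33 a l a′ L A′ h = (a ∷ l ∷ []) , (just a′ , refl) , (just A′ , refl)
    ... | no a≢A with k , s ← slope a≢A (a′ - A′) = ⌜ topLine u k ⌝ ,
      (just a , cong ⌜_⌝ (topPoint-topLine u k)) ,
      (just A , cong ⌜_⌝ (ω-33′ a l a′ A L A′ k h s))
      where u = a ∷ l ∷ a′ ∷ []
    join p@(_ ∷ [])         []               h = map₂ swap (join [] p (ω-sym (vec p) (vec []) h))
    join p@(_ ∷ _ ∷ [])     []               h = map₂ swap (join [] p (ω-sym (vec p) (vec []) h))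
    join p@(_ ∷ _ ∷ [])     z@(_ ∷ [])       h = map₂ swap (join z p (ω-sym (vec p) (vec z) h))
    join p@(_ ∷ _ ∷ _ ∷ []) []               h = map₂ swap (join [] p (ω-sym (vec p) (vec []) h))
    join p@(_ ∷ _ ∷ _ ∷ []) z@(_ ∷ [])       h = map₂ swap (join z p (ω-sym (vec p) (vec z) h))
    join p@(_ ∷ _ ∷ _ ∷ []) z@(_ ∷ _ ∷ [])   h = map₂ swap (join z p (ω-sym (vec p) (vec z) h))

    near : ∀ c p l → Within nb 3 (pt c p) (ln l)
    near c p l with i , h ← foot (vec p) l with _ , m∋p , m∋z ← join p (point l i) h =
      collinear {c′ = c} m∋p m∋z ⟫ pt→ln (i , refl)

    bigraph₄ : Bigraph (suc q) (2 ℕ.* suc q) 4 (2 ℕ.* words q 3 ℕ.+ words q 3)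
    bigraph₄ = polygonBigraph (pt true (0# ∷ 0# ∷ 0# ∷ [])) refl (near-even nothing near)

-- The split Cayley hexagon

module GeneralizedHexagon where

  open import Defs
  open FiniteFields
  open Graphs
  open Solver
  open import Data.Bool.Base using (true)
  open import Data.Empty using (⊥-elim)
  open import Data.Fin.Base using (Fin)
  open import Data.Fin.Patterns using (0F; 1F; 2F; 3F; 4F; 5F; 6F; 7F)
  open import Data.List.Base using ([]; _∷_)
  open import Data.Maybe.Base using (Maybe; just; nothing)
  import Data.Nat.Base as ℕ
  open import Data.Nat.Base using (ℕ; suc)
  open import Data.Product.Base using (∃; _×_; _,_; swap; map₂)
  open import Data.Unit.Base using (tt)
  open import Data.Vec.Base using (Vec; []; _∷_; lookup; replicate; map; head; take; drop; _++_)
  open import Data.Vec.Properties using (≡-dec; lookup-replicate)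
  open import Relation.Binary.PropositionalEquality using (_≡_; _≢_; refl; sym; trans; cong; cong₂; subst)
  open import Relation.Nullary using (yes; no)
  open Polygons

  module Hexagon {q : ℕ} (𝔽 : FiniteField q) where
    open FieldProperties 𝔽

    module _ {A : Set} ⦃ _ : Ops A ⦄ where

      twice thrice : A → A
      twice  x = x + x
      thrice x = x + x + x

      -- The second, third and fourth letters of `topLine u k` are forced by collinearity of `u`
      -- with a point of length 4 that begins with `k`, as `⊥₄₅-b` and its companions show; the last
      -- is minus the second letter of the point on the line with first letter 0. The multiples 2
      -- and 3 are never inverted, so characteristics 2 and 3 need no separate treatment.
      topLine topPoint : Vec A 5 → A → Vec A 5
      topLine (a ∷ l ∷ a′ ∷ l′ ∷ a″ ∷ []) k =
        k ∷
        (a * k - a″) ∷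
        (a * a * a * k * k - thrice (a * a * a″ * k) + l * k + thrice (a * a″ * a″) - thrice (a′ * a″) - l′) ∷
        (twice (a * a″) - a′ - a * a * k) ∷
        (a * a * a * k - thrice (a * a * a″) + thrice (a * a′) - l) ∷ []
      topPoint (k ∷ b ∷ k′ ∷ b′ ∷ k″ ∷ []) a =
        a ∷
        (a * a * a * k - thrice (a * a * b) - thrice (a * b′) - k″) ∷
        (a * a * k - twice (a * b) - b′) ∷
        (thrice (a * a * k * b) - a * a * a * k * k - thrice (a * b * b) - thrice (b * b′) - k * k″ - k′) ∷
        (a * k - b) ∷ []

      point : Word A 5 → Maybe A → Word A 5
      point = Growth.grow topPoint

      -- (α ; u ; v) is the trace zero split octonion given by Zorn's matrix
      -- with diagonal (α , − α) and off-diagonal vectors u and v.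
      vec : Word A 5 → Vec A 7
      vec []                            = 0# ∷ 1# ∷ 0# ∷ 0# ∷ 0# ∷ 0# ∷ 0# ∷ []
      vec (a ∷ [])                      = 0# ∷ - a ∷ 0# ∷ 0# ∷ 0# ∷ 0# ∷ 1# ∷ []
      vec (k ∷ b ∷ [])                  = 0# ∷ b ∷ 0# ∷ 0# ∷ 0# ∷ 1# ∷ - k ∷ []
      vec (a ∷ l ∷ a′ ∷ [])             = a ∷ (l - a * a′) ∷ 1# ∷ 0# ∷ 0# ∷ - (a * a) ∷ a′ ∷ []
      vec (k ∷ b ∷ k′ ∷ b′ ∷ [])        = b ∷ (k′ + b * b′) ∷ k ∷ 1# ∷ 0# ∷ b′ ∷ - (b * b + k * b′) ∷ []
      vec (a ∷ l ∷ a′ ∷ l′ ∷ a″ ∷ [])   =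
        (a * a″ - a′) ∷ (a″ * l - a * l′ - a′ * a′ - a * a′ * a″) ∷ a″ ∷ a ∷ 1# ∷
        (twice (a * a′) - a * a * a″ - l) ∷ (l′ + a′ * a″) ∷ []

      -- The square of a trace zero octonion x is Q x times the identity, and Q is minus the norm;
      -- `B` is its polar form. In characteristic 2 the form `B` does not determine `Q`, so both are
      -- carried along.
      Q : Vec A 7 → A
      Q (α ∷ u₁ ∷ u₂ ∷ u₃ ∷ v₁ ∷ v₂ ∷ v₃ ∷ []) = α * α + (u₁ * v₁ + u₂ * v₂ + u₃ * v₃)

      B : Vec A 7 → Vec A 7 → A
      B (α ∷ u₁ ∷ u₂ ∷ u₃ ∷ v₁ ∷ v₂ ∷ v₃ ∷ []) (β ∷ s₁ ∷ s₂ ∷ s₃ ∷ t₁ ∷ t₂ ∷ t₃ ∷ []) =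
        twice (α * β) + (u₁ * t₁ + u₂ * t₂ + u₃ * t₃) + (v₁ * s₁ + v₂ * s₂ + v₃ * s₃)

      -- The product of Zorn's matrices, lower right entry first; the other
      -- seven entries are the trace zero element x z if B x z vanishes.
      product : Vec A 7 → Vec A 7 → Vec A 8
      mul     : Vec A 7 → Vec A 7 → Vec A 7
      product x@(α ∷ u₁ ∷ u₂ ∷ u₃ ∷ v₁ ∷ v₂ ∷ v₃ ∷ []) z@(β ∷ s₁ ∷ s₂ ∷ s₃ ∷ t₁ ∷ t₂ ∷ t₃ ∷ []) =
        (α * β + (v₁ * s₁ + v₂ * s₂ + v₃ * s₃)) ∷ mul x z
      mul (α ∷ u₁ ∷ u₂ ∷ u₃ ∷ v₁ ∷ v₂ ∷ v₃ ∷ []) (β ∷ s₁ ∷ s₂ ∷ s₃ ∷ t₁ ∷ t₂ ∷ t₃ ∷ []) =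
        (α * β + (u₁ * t₁ + u₂ * t₂ + u₃ * t₃)) ∷
        (α * s₁ - β * u₁ - (v₂ * t₃ - v₃ * t₂)) ∷
        (α * s₂ - β * u₂ - (v₃ * t₁ - v₁ * t₃)) ∷
        (α * s₃ - β * u₃ - (v₁ * t₂ - v₂ * t₁)) ∷
        (β * v₁ - α * t₁ + (u₂ * s₃ - u₃ * s₂)) ∷
        (β * v₂ - α * t₂ + (u₃ * s₁ - u₁ * s₃)) ∷
        (β * v₃ - α * t₃ + (u₁ * s₂ - u₂ * s₁)) ∷ []

      entry : Fin 8 → Vec A 7 → Vec A 7 → A
      entry i x z = lookup (product x z) i

      -- Octonion conjugation, in the order of entries of `product`.
      flip : Vec A 8 → Vec A 8
      flip (d ∷ e ∷ w) = e ∷ d ∷ map -_ w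

      pencil : Word A 5 → Vec A 7 → A
      pencil []         x = - B x (vec [])
      pencil w@(_ ∷ _) x = B x (vec (parent w))

    coordinates : Coordinates F 4
    coordinates = record
      { topLine          = topLine
      ; topPoint         = topPoint
      ; topLine-head     = λ { (a ∷ l ∷ a′ ∷ l′ ∷ a″ ∷ []) k → refl }
      ; topPoint-head    = λ { (k ∷ b ∷ k′ ∷ b′ ∷ k″ ∷ []) a → refl }
      ; topPoint-topLine = λ { (a ∷ l ∷ a′ ∷ l′ ∷ a″ ∷ []) k → solveᵛ (k ∷ a ∷ l ∷ a′ ∷ l′ ∷ a″ ∷ [])
          (λ { (k ∷ u@(a ∷ _)) → topPoint (topLine u k) a }) (λ { (k ∷ u) → u }) refl }
      ; topLine-topPoint = λ { (k ∷ b ∷ k′ ∷ b′ ∷ k″ ∷ []) a → solveᵛ (a ∷ k ∷ b ∷ k′ ∷ b′ ∷ k″ ∷ [])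
          (λ { (a ∷ u@(k ∷ _)) → topLine (topPoint u a) k }) (λ { (a ∷ u) → u }) refl }
      }

    open Coordinates coordinates using (topPoint-topLine)
    open Polygon coordinates enumeration

    private
      affine : Expr → Word Expr 5 → Vec Expr 7 → Problem
      affine t l x = B x (vec (point l (just t))) ≐ B x (vec (point l (just 0#))) + t * pencil l x

    vec-point : ∀ x l t → B x (vec (point l (just t))) ≡ B x (vec (point l (just 0#))) + t * pencil l x
    vec-point x@(_ ∷ _ ∷ _ ∷ _ ∷ _ ∷ _ ∷ _ ∷ []) [] t = solve (t ∷ x) (λ { (t ∷ x) → affine t [] x }) refl
    vec-point x@(_ ∷ _ ∷ _ ∷ _ ∷ _ ∷ _ ∷ _ ∷ []) (k ∷ []) t = solve (t ∷ k ∷ x) (λ { (t ∷ k ∷ x) → affine t (k ∷ []) x }) refl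
    vec-point x@(_ ∷ _ ∷ _ ∷ _ ∷ _ ∷ _ ∷ _ ∷ []) (a ∷ l ∷ []) t = solve (t ∷ a ∷ l ∷ x) (λ { (t ∷ a ∷ l ∷ x) → affine t (a ∷ l ∷ []) x }) refl
    vec-point x@(_ ∷ _ ∷ _ ∷ _ ∷ _ ∷ _ ∷ _ ∷ []) (k ∷ b ∷ k′ ∷ []) t = solve (t ∷ k ∷ b ∷ k′ ∷ x)
      (λ { (t ∷ k ∷ b ∷ k′ ∷ x) → affine t (k ∷ b ∷ k′ ∷ []) x }) refl
    vec-point x@(_ ∷ _ ∷ _ ∷ _ ∷ _ ∷ _ ∷ _ ∷ []) (a ∷ l ∷ a′ ∷ l′ ∷ []) t = solve (t ∷ a ∷ l ∷ a′ ∷ l′ ∷ x)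
      (λ { (t ∷ a ∷ l ∷ a′ ∷ l′ ∷ x) → affine t (a ∷ l ∷ a′ ∷ l′ ∷ []) x }) refl
    vec-point x@(_ ∷ _ ∷ _ ∷ _ ∷ _ ∷ _ ∷ _ ∷ []) (k ∷ b ∷ k′ ∷ b′ ∷ k″ ∷ []) t = solve (t ∷ k ∷ b ∷ k′ ∷ b′ ∷ k″ ∷ x)
      (λ { (t ∷ k ∷ b ∷ k′ ∷ b′ ∷ k″ ∷ x) → affine t (k ∷ b ∷ k′ ∷ b′ ∷ k″ ∷ []) x }) refl

    foot : ∀ x l → ∃ λ i → B x (vec (point l i)) ≡ 0#
    foot x l@(_ ∷ _) with B x (vec (parent l)) ≟ 0#
    ... | yes h = nothing , h
    ... | no h  = let t , e = affine-root _ _ (vec-point x l) h in just t , e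
    foot x [] with - B x (vec []) ≟ 0#
    ... | yes h = nothing , linear (B x (vec []) ∷ []) (λ { (y ∷ []) → y ≐ 0# by (- 1# , - y , 0#) ∷ [] }) refl (h , tt)
    ... | no h  = let t , e = affine-root _ _ (vec-point x []) h in just t , e

    vec-singular : ∀ p → Q (vec p) ≡ 0#
    vec-singular [] = solve ([]) (λ { ([]) → Q (vec []) ≐ 0# }) refl
    vec-singular (a ∷ []) = solve (a ∷ []) (λ { (a ∷ []) → Q (vec (a ∷ [])) ≐ 0# }) refl
    vec-singular (k ∷ b ∷ []) = solve (k ∷ b ∷ []) (λ { (k ∷ b ∷ []) → Q (vec (k ∷ b ∷ [])) ≐ 0# }) refl
    vec-singular (a ∷ l ∷ a′ ∷ []) = solve (a ∷ l ∷ a′ ∷ []) (λ { (a ∷ l ∷ a′ ∷ []) → Q (vec (a ∷ l ∷ a′ ∷ [])) ≐ 0# }) refl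
    vec-singular (k ∷ b ∷ k′ ∷ b′ ∷ []) = solve (k ∷ b ∷ k′ ∷ b′ ∷ []) (λ { (k ∷ b ∷ k′ ∷ b′ ∷ []) → Q (vec (k ∷ b ∷ k′ ∷ b′ ∷ [])) ≐ 0# }) refl
    vec-singular (a ∷ l ∷ a′ ∷ l′ ∷ a″ ∷ []) = solve (a ∷ l ∷ a′ ∷ l′ ∷ a″ ∷ []) (λ { (a ∷ l ∷ a′ ∷ l′ ∷ a″ ∷ []) → Q (vec (a ∷ l ∷ a′ ∷ l′ ∷ a″ ∷ [])) ≐ 0# }) refl

    0ᵛ : ∀ {m} → Vec F m
    0ᵛ = replicate _ 0#

    Collinear : Vec F 7 → Vec F 7 → Set
    Collinear x z = product x z ≡ 0ᵛ

    infix 4 _⊥_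
    -- A record rather than a synonym, so that the words `p` and `z` can be inferred from a proof;
    -- the bare equation would unfold to their coordinates.
    record _⊥_ (p z : Word F 5) : Set where
      constructor perpendicular
      field
        isCollinear : Collinear (vec p) (vec z)

    open _⊥_ using (isCollinear)

    ⊥-entry : ∀ i {p z} → p ⊥ z → entry i (vec p) (vec z) ≡ 0#
    ⊥-entry i h = trans (cong (λ v → lookup v i) (isCollinear h)) (lookup-replicate i 0#)

    -- The one entry that `mul` omits is recovered from the trace: `B x z` is the sum of the two
    -- diagonal entries.
    mul≡0⇒collinear : ∀ x z → B x z ≡ 0# → mul x z ≡ 0ᵛ → Collinear x z
    mul≡0⇒collinear x@(_ ∷ _ ∷ _ ∷ _ ∷ _ ∷ _ ∷ _ ∷ []) z@(_ ∷ _ ∷ _ ∷ _ ∷ _ ∷ _ ∷ _ ∷ []) h w≡0 = cong₂ _∷_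
      (linear (x ++ z) (λ y → let x = take 7 y ; z = drop 7 y in
        entry 0F x z ≐ 0# by (1# , B x z , 0#) ∷ (- 1# , entry 1F x z , 0#) ∷ []) refl (h , cong head w≡0 , tt))
      w≡0

    -- x (x z) = Q x · z, up to the trace of x z.
    collinear-mulˡ : ∀ x z → Q x ≡ 0# → B x z ≡ 0# → Collinear x (mul x z)
    collinear-mulˡ x@(_ ∷ _ ∷ _ ∷ _ ∷ _ ∷ _ ∷ _ ∷ []) z@(_ ∷ _ ∷ _ ∷ _ ∷ _ ∷ _ ∷ _ ∷ []) hx hB = linearᵛ (x ++ z)
      (λ y → product (take 7 y) (mul (take 7 y) (drop 7 y)))
      (λ _ → replicate 8 0#)
      (λ { y@(α ∷ u₁ ∷ u₂ ∷ u₃ ∷ _) → let x = take 7 y ; z = drop 7 y in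
        (- head z ∷ z , Q x , 0#) ∷
        (α ∷ 0# ∷ - u₁ ∷ - u₂ ∷ - u₃ ∷ 0# ∷ 0# ∷ 0# ∷ [] , B x z , 0#) ∷ [] })
      refl (hx , hB , tt)

    -- By alternativity (x z) z = x z², which is Q z · x. The terms with `B x z` correct the lower
    -- right entry, which `mul` replaces by minus the upper left one.
    collinear-mulʳ : ∀ x z → Q z ≡ 0# → B x z ≡ 0# → Collinear (mul x z) z
    collinear-mulʳ x@(_ ∷ _ ∷ _ ∷ _ ∷ _ ∷ _ ∷ _ ∷ []) z@(_ ∷ _ ∷ _ ∷ _ ∷ _ ∷ _ ∷ _ ∷ []) hz hB = linearᵛ (z ++ x)
      (λ y → product (mul (drop 7 y) (take 7 y)) (take 7 y))
      (λ _ → replicate 8 0#)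
      (λ { y@(β ∷ _ ∷ _ ∷ _ ∷ t₁ ∷ t₂ ∷ t₃ ∷ _) → let z = take 7 y ; x = drop 7 y in
        (- head x ∷ x , Q z , 0#) ∷
        (β ∷ 0# ∷ 0# ∷ 0# ∷ 0# ∷ - t₁ ∷ - t₂ ∷ - t₃ ∷ [] , B x z , 0#) ∷ [] })
      refl (hz , hB , tt)

    -- The norm is multiplicative: Q (x z) = - Q x · Q z as soon as x z has trace zero.
    mul-singular : ∀ x z → Q x ≡ 0# → B x z ≡ 0# → Q (mul x z) ≡ 0#
    mul-singular x@(_ ∷ _ ∷ _ ∷ _ ∷ _ ∷ _ ∷ _ ∷ []) z@(_ ∷ _ ∷ _ ∷ _ ∷ _ ∷ _ ∷ _ ∷ []) hx hB = linear (x ++ z)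
      (λ y → let x = take 7 y ; z = drop 7 y in
        Q (mul x z) ≐ 0# by (entry 1F x z , B x z , 0#) ∷ (- Q z , Q x , 0#) ∷ [])
      refl (hB , hx , tt)

    -- Conjugation reverses products and negates elements of trace zero, so the conjugate of x z is
    -- (- z) (- x) = z x.
    product-flip : ∀ x z → product z x ≡ flip (product x z)
    product-flip x@(_ ∷ _ ∷ _ ∷ _ ∷ _ ∷ _ ∷ _ ∷ []) z@(_ ∷ _ ∷ _ ∷ _ ∷ _ ∷ _ ∷ _ ∷ []) = solveᵛ (x ++ z)
      (λ y → product (drop 7 y) (take 7 y)) (λ y → flip (product (take 7 y) (drop 7 y))) refl

    collinear-sym : ∀ x z → Collinear x z → Collinear z x
    collinear-sym x z h = trans (product-flip x z) (trans (cong flip h)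
      (solveᵛ [] (λ _ → flip (replicate 8 0#)) (λ _ → replicate 8 0#) refl))

    scale : F → Vec F 7 → Vec F 7
    scale c = map (c *_)

    product-scale : ∀ c x z → product x (scale c z) ≡ map (c *_) (product x z)
    product-scale c x@(_ ∷ _ ∷ _ ∷ _ ∷ _ ∷ _ ∷ _ ∷ []) z@(_ ∷ _ ∷ _ ∷ _ ∷ _ ∷ _ ∷ _ ∷ []) = solveᵛ (c ∷ x ++ z)
      (λ { (c ∷ y) → product (take 7 y) (map (c *_) (drop 7 y)) })
      (λ { (c ∷ y) → map (c *_) (product (take 7 y) (drop 7 y)) }) refl

    collinear-scale : ∀ c x z → Collinear x z → Collinear x (scale c z)
    collinear-scale c x z h = trans (product-scale c x z) (trans (cong (map (c *_)) h)
      (solveᵛ (c ∷ []) (λ { (c ∷ []) → map (c *_) (replicate 8 0#) }) (λ _ → replicate 8 0#) refl))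

    Q-scale : ∀ c x → Q x ≡ 0# → Q (scale c x) ≡ 0#
    Q-scale c x@(_ ∷ _ ∷ _ ∷ _ ∷ _ ∷ _ ∷ _ ∷ []) h = linear (c ∷ x) (λ { (c ∷ x) → Q (map (c *_) x) ≐ 0# by (c * c , Q x , 0#) ∷ [] }) refl (h , tt)

    square-zero : ∀ x → x * x ≡ 0# → x ≡ 0#
    square-zero x h with x ≟ 0#
    ... | yes x≡0 = x≡0
    ... | no x≢0 with y , e ← inverse x x≢0 =
      linear (x ∷ y ∷ []) (λ { (x ∷ y ∷ []) → x ≐ 0# by (- x , x * y , 1#) ∷ (y , x * x , 0#) ∷ [] }) refl (e , h , tt)

    -- The letters come from solving the formula for `vec` coordinate by coordinate. The coordinate
    -- 1 is paired in `Q` with one other coordinate, here u₁, in `normal₄` v₃ and in `normal₃` v₂;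
    -- that one is not matched by the letters but determined by Q w = 0.
    normal₅ : ∀ α u₁ u₂ u₃ v₂ v₃ → let w = α ∷ u₁ ∷ u₂ ∷ u₃ ∷ 1# ∷ v₂ ∷ v₃ ∷ [] in Q w ≡ 0# → ∃ λ p → vec p ≡ w
    normal₅ α u₁ u₂ u₃ v₂ v₃ h =
      (u₃ ∷ (u₃ * u₃ * u₂ - twice (u₃ * α) - v₂) ∷ (u₃ * u₂ - α) ∷ (v₃ - u₂ * (u₃ * u₂ - α)) ∷ u₂ ∷ []) ,
      linearᵛ (α ∷ u₁ ∷ u₂ ∷ u₃ ∷ v₂ ∷ v₃ ∷ [])
        (λ { (α ∷ u₁ ∷ u₂ ∷ u₃ ∷ v₂ ∷ v₃ ∷ []) →
          vec (u₃ ∷ (u₃ * u₃ * u₂ - twice (u₃ * α) - v₂) ∷ (u₃ * u₂ - α) ∷ (v₃ - u₂ * (u₃ * u₂ - α)) ∷ u₂ ∷ []) })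
        (λ { (α ∷ u₁ ∷ u₂ ∷ u₃ ∷ v₂ ∷ v₃ ∷ []) → α ∷ u₁ ∷ u₂ ∷ u₃ ∷ 1# ∷ v₂ ∷ v₃ ∷ [] })
        (λ { (α ∷ u₁ ∷ u₂ ∷ u₃ ∷ v₂ ∷ v₃ ∷ []) →
          (0# ∷ - 1# ∷ 0# ∷ 0# ∷ 0# ∷ 0# ∷ 0# ∷ [] , Q (α ∷ u₁ ∷ u₂ ∷ u₃ ∷ 1# ∷ v₂ ∷ v₃ ∷ []) , 0#) ∷ [] })
        refl (h , tt)

    normal₄ : ∀ α u₁ u₂ v₂ v₃ → let w = α ∷ u₁ ∷ u₂ ∷ 1# ∷ 0# ∷ v₂ ∷ v₃ ∷ [] in Q w ≡ 0# → ∃ λ p → vec p ≡ w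
    normal₄ α u₁ u₂ v₂ v₃ h = (u₂ ∷ α ∷ (u₁ - α * v₂) ∷ v₂ ∷ []) ,
      linearᵛ (α ∷ u₁ ∷ u₂ ∷ v₂ ∷ v₃ ∷ [])
        (λ { (α ∷ u₁ ∷ u₂ ∷ v₂ ∷ v₃ ∷ []) → vec (u₂ ∷ α ∷ (u₁ - α * v₂) ∷ v₂ ∷ []) })
        (λ { (α ∷ u₁ ∷ u₂ ∷ v₂ ∷ v₃ ∷ []) → α ∷ u₁ ∷ u₂ ∷ 1# ∷ 0# ∷ v₂ ∷ v₃ ∷ [] })
        (λ { (α ∷ u₁ ∷ u₂ ∷ v₂ ∷ v₃ ∷ []) →
          (0# ∷ 0# ∷ 0# ∷ 0# ∷ 0# ∷ 0# ∷ - 1# ∷ [] , Q (α ∷ u₁ ∷ u₂ ∷ 1# ∷ 0# ∷ v₂ ∷ v₃ ∷ []) , 0#) ∷ [] })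
        refl (h , tt)

    normal₃ : ∀ α u₁ v₂ v₃ → let w = α ∷ u₁ ∷ 1# ∷ 0# ∷ 0# ∷ v₂ ∷ v₃ ∷ [] in Q w ≡ 0# → ∃ λ p → vec p ≡ w
    normal₃ α u₁ v₂ v₃ h = (α ∷ (u₁ + α * v₃) ∷ v₃ ∷ []) ,
      linearᵛ (α ∷ u₁ ∷ v₂ ∷ v₃ ∷ [])
        (λ { (α ∷ u₁ ∷ v₂ ∷ v₃ ∷ []) → vec (α ∷ (u₁ + α * v₃) ∷ v₃ ∷ []) })
        (λ { (α ∷ u₁ ∷ v₂ ∷ v₃ ∷ []) → α ∷ u₁ ∷ 1# ∷ 0# ∷ 0# ∷ v₂ ∷ v₃ ∷ [] })
        (λ { (α ∷ u₁ ∷ v₂ ∷ v₃ ∷ []) →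
          (0# ∷ 0# ∷ 0# ∷ 0# ∷ 0# ∷ - 1# ∷ 0# ∷ [] , Q (α ∷ u₁ ∷ 1# ∷ 0# ∷ 0# ∷ v₂ ∷ v₃ ∷ []) , 0#) ∷ [] })
        refl (h , tt)

    normal₂ : ∀ u₁ v₃ → ∃ λ p → vec p ≡ 0# ∷ u₁ ∷ 0# ∷ 0# ∷ 0# ∷ 1# ∷ v₃ ∷ []
    normal₂ u₁ v₃ = (- v₃ ∷ u₁ ∷ []) , solveᵛ (u₁ ∷ v₃ ∷ []) (λ { (u₁ ∷ v₃ ∷ []) → vec (- v₃ ∷ u₁ ∷ []) })
      (λ { (u₁ ∷ v₃ ∷ []) → 0# ∷ u₁ ∷ 0# ∷ 0# ∷ 0# ∷ 1# ∷ v₃ ∷ [] }) refl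

    normal₁ : ∀ u₁ → ∃ λ p → vec p ≡ 0# ∷ u₁ ∷ 0# ∷ 0# ∷ 0# ∷ 0# ∷ 1# ∷ []
    normal₁ u₁ = (- u₁ ∷ []) , solveᵛ (u₁ ∷ []) (λ { (u₁ ∷ []) → vec (- u₁ ∷ []) })
      (λ { (u₁ ∷ []) → 0# ∷ u₁ ∷ 0# ∷ 0# ∷ 0# ∷ 0# ∷ 1# ∷ [] }) refl

    unit : ∀ {x} → x ≢ 0# → ∃ λ c → c * x ≡ 1#
    unit {x} x≢0 with c , e ← inverse x x≢0 =
      c , linear (c ∷ x ∷ []) (λ { (c ∷ x ∷ []) → c * x ≐ 1# by (1# , x * c , 1#) ∷ [] }) refl (e , tt)

    scale-0 : ∀ c → c * 0# ≡ 0#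
    scale-0 c = solve (c ∷ []) (λ { (c ∷ []) → c * 0# ≐ 0# }) refl

    -- The letters of the normalised vector are read off its first nonzero
    -- coordinate in the order v₁, u₃, u₂, v₂, v₃, u₁.
    normalised : ∀ w → Q w ≡ 0# → w ≢ 0ᵛ → ∃ λ p → ∃ λ c → vec p ≡ scale c w
    normalised w@(α ∷ u₁ ∷ u₂ ∷ u₃ ∷ v₁ ∷ v₂ ∷ v₃ ∷ []) h w≢0 with v₁ ≟ 0#
    ... | no v₁≢0 = let c , e = unit v₁≢0 ; p , eq = from₅ e (Q-scale c w h) in p , c , eq
      where
      -- The coordinates are abstracted to variables, because the equation c · v₁ = 1 cannot be
      -- matched with `refl` as it stands.
      from₅ : ∀ {α u₁ u₂ u₃ v₁ v₂ v₃} → v₁ ≡ 1# →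
        let w = α ∷ u₁ ∷ u₂ ∷ u₃ ∷ v₁ ∷ v₂ ∷ v₃ ∷ [] in Q w ≡ 0# → ∃ λ p → vec p ≡ w
      from₅ refl = normal₅ _ _ _ _ _ _
    ... | yes refl with u₃ ≟ 0#
    ...   | no u₃≢0 = let c , e = unit u₃≢0 ; p , eq = from₄ (scale-0 c) e (Q-scale c w h) in p , c , eq
      where
      from₄ : ∀ {α u₁ u₂ u₃ v₁ v₂ v₃} → v₁ ≡ 0# → u₃ ≡ 1# →
        let w = α ∷ u₁ ∷ u₂ ∷ u₃ ∷ v₁ ∷ v₂ ∷ v₃ ∷ [] in Q w ≡ 0# → ∃ λ p → vec p ≡ w
      from₄ refl refl = normal₄ _ _ _ _ _
    ...   | yes refl with u₂ ≟ 0#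
    ...     | no u₂≢0 = let c , e = unit u₂≢0 ; p , eq = from₃ (scale-0 c) (scale-0 c) e (Q-scale c w h) in p , c , eq
      where
      from₃ : ∀ {α u₁ u₂ u₃ v₁ v₂ v₃} → v₁ ≡ 0# → u₃ ≡ 0# → u₂ ≡ 1# →
        let w = α ∷ u₁ ∷ u₂ ∷ u₃ ∷ v₁ ∷ v₂ ∷ v₃ ∷ [] in Q w ≡ 0# → ∃ λ p → vec p ≡ w
      from₃ refl refl refl = normal₃ _ _ _ _
    -- Each product uᵢ vᵢ now has a zero factor, so Q w = 0 leaves α² = 0. Hence α is never the
    -- first nonzero coordinate.
    ...     | yes refl
      with refl ← square-zero α (linear (α ∷ u₁ ∷ v₂ ∷ v₃ ∷ []) (λ { (α ∷ u₁ ∷ v₂ ∷ v₃ ∷ []) →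
        α * α ≐ 0# by (1# , Q (α ∷ u₁ ∷ 0# ∷ 0# ∷ 0# ∷ v₂ ∷ v₃ ∷ []) , 0#) ∷ [] }) refl (h , tt))
      with v₂ ≟ 0#
    ...       | no v₂≢0 = let c , e = unit v₂≢0 ; p , eq = normal₂ (c * u₁) (c * v₃) in
      p , c , trans eq (cong₂ (λ z e → z ∷ c * u₁ ∷ z ∷ z ∷ z ∷ e ∷ c * v₃ ∷ []) (sym (scale-0 c)) (sym e))
    ...       | yes refl with v₃ ≟ 0#
    ...         | no v₃≢0 = let c , e = unit v₃≢0 ; p , eq = normal₁ (c * u₁) in
      p , c , trans eq (cong₂ (λ z e → z ∷ c * u₁ ∷ z ∷ z ∷ z ∷ z ∷ e ∷ []) (sym (scale-0 c)) (sym e))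
    ...         | yes refl with u₁ ≟ 0#
    ...           | no u₁≢0 = let c , e = unit u₁≢0 in
      [] , c , cong₂ (λ z e → z ∷ e ∷ z ∷ z ∷ z ∷ z ∷ z ∷ []) (sym (scale-0 c)) (sym e)
    ...           | yes refl = ⊥-elim (w≢0 refl)

    ⊥-sym : ∀ {p z} → p ⊥ z → z ⊥ p
    ⊥-sym {p} {z} h = perpendicular (collinear-sym (vec p) (vec z) (isCollinear h))

    private
      reading : Fin 8 → Word Expr 5 → Word Expr 5 → Expr → Expr → Expr → Problem
      reading i p z c l r = l ≐ r by (c , entry i (vec p) (vec z) , 0#) ∷ []

    -- Subscripts are word lengths. Each of the following lemmas reads a single well-chosen entry of
    -- the vanishing product: it is 1 or - 1 if the lengths exclude collinearity, and otherwise plus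
    -- or minus the difference of two letters, once the letters already identified are substituted.
    ⊥₀₃ : ∀ A L A′ → [] ⊥ (A ∷ L ∷ A′ ∷ []) → 1# ≡ 0#
    ⊥₀₃ A L A′ h = linear (A ∷ L ∷ A′ ∷ [])
      (λ { (A ∷ L ∷ A′ ∷ []) → reading 7F [] (A ∷ L ∷ A′ ∷ []) 1# 1# 0# })
      refl (⊥-entry 7F h , tt)

    ⊥₀₄ : ∀ K β K′ β′ → [] ⊥ (K ∷ β ∷ K′ ∷ β′ ∷ []) → 1# ≡ 0#
    ⊥₀₄ K β K′ β′ h = linear (K ∷ β ∷ K′ ∷ β′ ∷ [])
      (λ { (K ∷ β ∷ K′ ∷ β′ ∷ []) → reading 6F [] (K ∷ β ∷ K′ ∷ β′ ∷ []) (- 1#) 1# 0# })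
      refl (⊥-entry 6F h , tt)

    ⊥₀₅ : ∀ A L A′ L′ A″ → [] ⊥ (A ∷ L ∷ A′ ∷ L′ ∷ A″ ∷ []) → 1# ≡ 0#
    ⊥₀₅ A L A′ L′ A″ h = linear (A ∷ L ∷ A′ ∷ L′ ∷ A″ ∷ [])
      (λ { (A ∷ L ∷ A′ ∷ L′ ∷ A″ ∷ []) → reading 1F [] (A ∷ L ∷ A′ ∷ L′ ∷ A″ ∷ []) 1# 1# 0# })
      refl (⊥-entry 1F h , tt)

    ⊥₁₂ : ∀ a K β → (a ∷ []) ⊥ (K ∷ β ∷ []) → 1# ≡ 0#
    ⊥₁₂ a K β h = linear (a ∷ K ∷ β ∷ [])
      (λ { (a ∷ K ∷ β ∷ []) → reading 2F (a ∷ []) (K ∷ β ∷ []) 1# 1# 0# })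
      refl (⊥-entry 2F h , tt)

    ⊥₁₄ : ∀ a K β K′ β′ → (a ∷ []) ⊥ (K ∷ β ∷ K′ ∷ β′ ∷ []) → 1# ≡ 0#
    ⊥₁₄ a K β K′ β′ h = linear (a ∷ K ∷ β ∷ K′ ∷ β′ ∷ [])
      (λ { (a ∷ K ∷ β ∷ K′ ∷ β′ ∷ []) → reading 0F (a ∷ []) (K ∷ β ∷ K′ ∷ β′ ∷ []) 1# 1# 0# })
      refl (⊥-entry 0F h , tt)

    ⊥₁₅ : ∀ a A L A′ L′ A″ → (a ∷ []) ⊥ (A ∷ L ∷ A′ ∷ L′ ∷ A″ ∷ []) → 1# ≡ 0#
    ⊥₁₅ a A L A′ L′ A″ h = linear (a ∷ A ∷ L ∷ A′ ∷ L′ ∷ A″ ∷ [])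
      (λ { (a ∷ A ∷ L ∷ A′ ∷ L′ ∷ A″ ∷ []) → reading 3F (a ∷ []) (A ∷ L ∷ A′ ∷ L′ ∷ A″ ∷ []) (- 1#) 1# 0# })
      refl (⊥-entry 3F h , tt)

    ⊥₂₃ : ∀ k b A L A′ → (k ∷ b ∷ []) ⊥ (A ∷ L ∷ A′ ∷ []) → 1# ≡ 0#
    ⊥₂₃ k b A L A′ h = linear (k ∷ b ∷ A ∷ L ∷ A′ ∷ [])
      (λ { (k ∷ b ∷ A ∷ L ∷ A′ ∷ []) → reading 0F (k ∷ b ∷ []) (A ∷ L ∷ A′ ∷ []) 1# 1# 0# })
      refl (⊥-entry 0F h , tt)

    ⊥₂₅ : ∀ k b A L A′ L′ A″ → (k ∷ b ∷ []) ⊥ (A ∷ L ∷ A′ ∷ L′ ∷ A″ ∷ []) → 1# ≡ 0#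
    ⊥₂₅ k b A L A′ L′ A″ h = linear (k ∷ b ∷ A ∷ L ∷ A′ ∷ L′ ∷ A″ ∷ [])
      (λ { (k ∷ b ∷ A ∷ L ∷ A′ ∷ L′ ∷ A″ ∷ []) → reading 4F (k ∷ b ∷ []) (A ∷ L ∷ A′ ∷ L′ ∷ A″ ∷ []) 1# 1# 0# })
      refl (⊥-entry 4F h , tt)

    ⊥₃₄ : ∀ a l a′ K β K′ β′ → (a ∷ l ∷ a′ ∷ []) ⊥ (K ∷ β ∷ K′ ∷ β′ ∷ []) → 1# ≡ 0#
    ⊥₃₄ a l a′ K β K′ β′ h = linear (a ∷ l ∷ a′ ∷ K ∷ β ∷ K′ ∷ β′ ∷ [])
      (λ { (a ∷ l ∷ a′ ∷ K ∷ β ∷ K′ ∷ β′ ∷ []) → reading 5F (a ∷ l ∷ a′ ∷ []) (K ∷ β ∷ K′ ∷ β′ ∷ []) 1# 1# 0# })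
      refl (⊥-entry 5F h , tt)

    ⊥₁₃ : ∀ a A L A′ → (a ∷ []) ⊥ (A ∷ L ∷ A′ ∷ []) → A ≡ a
    ⊥₁₃ a A L A′ h = linear (a ∷ A ∷ L ∷ A′ ∷ [])
      (λ { (a ∷ A ∷ L ∷ A′ ∷ []) → reading 7F (a ∷ []) (A ∷ L ∷ A′ ∷ []) 1# A a })
      refl (⊥-entry 7F h , tt)

    ⊥₂₂ : ∀ k b K β → (k ∷ b ∷ []) ⊥ (K ∷ β ∷ []) → K ≡ k
    ⊥₂₂ k b K β h = linear (k ∷ b ∷ K ∷ β ∷ [])
      (λ { (k ∷ b ∷ K ∷ β ∷ []) → reading 2F (k ∷ b ∷ []) (K ∷ β ∷ []) 1# K k })
      refl (⊥-entry 2F h , tt)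

    ⊥₂₄-k : ∀ k b K β K′ β′ → (k ∷ b ∷ []) ⊥ (K ∷ β ∷ K′ ∷ β′ ∷ []) → K ≡ k
    ⊥₂₄-k k b K β K′ β′ h = linear (k ∷ b ∷ K ∷ β ∷ K′ ∷ β′ ∷ [])
      (λ { (k ∷ b ∷ K ∷ β ∷ K′ ∷ β′ ∷ []) → reading 0F (k ∷ b ∷ []) (K ∷ β ∷ K′ ∷ β′ ∷ []) 1# K k })
      refl (⊥-entry 0F h , tt)

    ⊥₂₄-b : ∀ k b β K′ β′ → (k ∷ b ∷ []) ⊥ (k ∷ β ∷ K′ ∷ β′ ∷ []) → β ≡ b
    ⊥₂₄-b k b β K′ β′ h = linear (k ∷ b ∷ β ∷ K′ ∷ β′ ∷ [])
      (λ { (k ∷ b ∷ β ∷ K′ ∷ β′ ∷ []) → reading 6F (k ∷ b ∷ []) (k ∷ β ∷ K′ ∷ β′ ∷ []) 1# β b })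
      refl (⊥-entry 6F h , tt)

    ⊥₃₃-a : ∀ a l a′ A L A′ → (a ∷ l ∷ a′ ∷ []) ⊥ (A ∷ L ∷ A′ ∷ []) → a ≡ A
    ⊥₃₃-a a l a′ A L A′ h = linear (a ∷ l ∷ a′ ∷ A ∷ L ∷ A′ ∷ [])
      (λ { (a ∷ l ∷ a′ ∷ A ∷ L ∷ A′ ∷ []) → reading 3F (a ∷ l ∷ a′ ∷ []) (A ∷ L ∷ A′ ∷ []) 1# a A })
      refl (⊥-entry 3F h , tt)

    ⊥₃₃-l : ∀ a l a′ L A′ → (a ∷ l ∷ a′ ∷ []) ⊥ (a ∷ L ∷ A′ ∷ []) → l ≡ L
    ⊥₃₃-l a l a′ L A′ h = linear (a ∷ l ∷ a′ ∷ L ∷ A′ ∷ [])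
      (λ { (a ∷ l ∷ a′ ∷ L ∷ A′ ∷ []) → reading 7F (a ∷ l ∷ a′ ∷ []) (a ∷ L ∷ A′ ∷ []) 1# l L })
      refl (⊥-entry 7F h , tt)

    ⊥₃₅-a : ∀ a l a′ A L A′ L′ A″ → (a ∷ l ∷ a′ ∷ []) ⊥ (A ∷ L ∷ A′ ∷ L′ ∷ A″ ∷ []) → A ≡ a
    ⊥₃₅-a a l a′ A L A′ L′ A″ h = linear (a ∷ l ∷ a′ ∷ A ∷ L ∷ A′ ∷ L′ ∷ A″ ∷ [])
      (λ { (a ∷ l ∷ a′ ∷ A ∷ L ∷ A′ ∷ L′ ∷ A″ ∷ []) →
        reading 5F (a ∷ l ∷ a′ ∷ []) (A ∷ L ∷ A′ ∷ L′ ∷ A″ ∷ []) 1# A a })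
      refl (⊥-entry 5F h , tt)

    ⊥₃₅-a′ : ∀ a l a′ L A′ L′ A″ → (a ∷ l ∷ a′ ∷ []) ⊥ (a ∷ L ∷ A′ ∷ L′ ∷ A″ ∷ []) → A′ ≡ a′
    ⊥₃₅-a′ a l a′ L A′ L′ A″ h = linear (a ∷ l ∷ a′ ∷ L ∷ A′ ∷ L′ ∷ A″ ∷ [])
      (λ { (a ∷ l ∷ a′ ∷ L ∷ A′ ∷ L′ ∷ A″ ∷ []) →
        reading 3F (a ∷ l ∷ a′ ∷ []) (a ∷ L ∷ A′ ∷ L′ ∷ A″ ∷ []) 1# A′ a′ })
      refl (⊥-entry 3F h , tt)

    ⊥₃₅-l : ∀ a l L A′ L′ A″ → (a ∷ l ∷ A′ ∷ []) ⊥ (a ∷ L ∷ A′ ∷ L′ ∷ A″ ∷ []) → L ≡ l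
    ⊥₃₅-l a l L A′ L′ A″ h = linear (a ∷ l ∷ L ∷ A′ ∷ L′ ∷ A″ ∷ [])
      (λ { (a ∷ l ∷ L ∷ A′ ∷ L′ ∷ A″ ∷ []) → reading 1F (a ∷ l ∷ A′ ∷ []) (a ∷ L ∷ A′ ∷ L′ ∷ A″ ∷ []) (- 1#) L l })
      refl (⊥-entry 1F h , tt)

    ⊥₄₄-k : ∀ k b k′ b′ K β K′ β′ → (k ∷ b ∷ k′ ∷ b′ ∷ []) ⊥ (K ∷ β ∷ K′ ∷ β′ ∷ []) → k ≡ K
    ⊥₄₄-k k b k′ b′ K β K′ β′ h = linear (k ∷ b ∷ k′ ∷ b′ ∷ K ∷ β ∷ K′ ∷ β′ ∷ [])
      (λ { (k ∷ b ∷ k′ ∷ b′ ∷ K ∷ β ∷ K′ ∷ β′ ∷ []) →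
        reading 5F (k ∷ b ∷ k′ ∷ b′ ∷ []) (K ∷ β ∷ K′ ∷ β′ ∷ []) 1# k K })
      refl (⊥-entry 5F h , tt)

    ⊥₄₄-b : ∀ k b k′ b′ β K′ β′ → (k ∷ b ∷ k′ ∷ b′ ∷ []) ⊥ (k ∷ β ∷ K′ ∷ β′ ∷ []) → b ≡ β
    ⊥₄₄-b k b k′ b′ β K′ β′ h = linear (k ∷ b ∷ k′ ∷ b′ ∷ β ∷ K′ ∷ β′ ∷ [])
      (λ { (k ∷ b ∷ k′ ∷ b′ ∷ β ∷ K′ ∷ β′ ∷ []) → reading 4F (k ∷ b ∷ k′ ∷ b′ ∷ []) (k ∷ β ∷ K′ ∷ β′ ∷ []) 1# b β })
      refl (⊥-entry 4F h , tt)

    ⊥₄₄-k′ : ∀ k b k′ b′ K′ β′ → (k ∷ b ∷ k′ ∷ b′ ∷ []) ⊥ (k ∷ b ∷ K′ ∷ β′ ∷ []) → k′ ≡ K′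
    ⊥₄₄-k′ k b k′ b′ K′ β′ h = linear (k ∷ b ∷ k′ ∷ b′ ∷ K′ ∷ β′ ∷ [])
      (λ { (k ∷ b ∷ k′ ∷ b′ ∷ K′ ∷ β′ ∷ []) →
        reading 6F (k ∷ b ∷ k′ ∷ b′ ∷ []) (k ∷ b ∷ K′ ∷ β′ ∷ []) (- 1#) k′ K′ })
      refl (⊥-entry 6F h , tt)

    -- Each equation is used to eliminate a letter before the next one is read.
    ⊥₄₅-b : ∀ k b k′ b′ a l a′ l′ a″ →
      let u = a ∷ l ∷ a′ ∷ l′ ∷ a″ ∷ [] ; m = topLine u k in
      (k ∷ b ∷ k′ ∷ b′ ∷ []) ⊥ ⌜ u ⌝ → lookup m 1F ≡ b
    ⊥₄₅-b k b k′ b′ a l a′ l′ a″ h = linear (k ∷ b ∷ k′ ∷ b′ ∷ a ∷ l ∷ a′ ∷ l′ ∷ a″ ∷ [])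
      (λ { (k ∷ b ∷ k′ ∷ b′ ∷ a ∷ l ∷ a′ ∷ l′ ∷ a″ ∷ []) → let u = a ∷ l ∷ a′ ∷ l′ ∷ a″ ∷ [] ; m = topLine u k in
        reading 5F (k ∷ b ∷ k′ ∷ b′ ∷ []) ⌜ u ⌝ 1# (lookup m 1F) b })
      refl (⊥-entry 5F h , tt)

    ⊥₄₅-b′ : ∀ k k′ b′ a l a′ l′ a″ →
      let u = a ∷ l ∷ a′ ∷ l′ ∷ a″ ∷ [] ; m = topLine u k in
      (k ∷ lookup m 1F ∷ k′ ∷ b′ ∷ []) ⊥ ⌜ u ⌝ → lookup m 3F ≡ b′
    ⊥₄₅-b′ k k′ b′ a l a′ l′ a″ h = linear (k ∷ k′ ∷ b′ ∷ a ∷ l ∷ a′ ∷ l′ ∷ a″ ∷ [])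
      (λ { (k ∷ k′ ∷ b′ ∷ a ∷ l ∷ a′ ∷ l′ ∷ a″ ∷ []) → let u = a ∷ l ∷ a′ ∷ l′ ∷ a″ ∷ [] ; m = topLine u k in
        reading 4F (k ∷ lookup m 1F ∷ k′ ∷ b′ ∷ []) ⌜ u ⌝ (- 1#) (lookup m 3F) b′ })
      refl (⊥-entry 4F h , tt)

    ⊥₄₅-k′ : ∀ k k′ a l a′ l′ a″ →
      let u = a ∷ l ∷ a′ ∷ l′ ∷ a″ ∷ [] ; m = topLine u k in
      (k ∷ lookup m 1F ∷ k′ ∷ lookup m 3F ∷ []) ⊥ ⌜ u ⌝ → lookup m 2F ≡ k′
    ⊥₄₅-k′ k k′ a l a′ l′ a″ h = linear (k ∷ k′ ∷ a ∷ l ∷ a′ ∷ l′ ∷ a″ ∷ [])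
      (λ { (k ∷ k′ ∷ a ∷ l ∷ a′ ∷ l′ ∷ a″ ∷ []) → let u = a ∷ l ∷ a′ ∷ l′ ∷ a″ ∷ [] ; m = topLine u k in
        reading 1F (k ∷ lookup m 1F ∷ k′ ∷ lookup m 3F ∷ []) ⌜ u ⌝ (- 1#) (lookup m 2F) k′ })
      refl (⊥-entry 1F h , tt)

    ⊥₅₅-a′ : ∀ a l a′ l′ a″ L A′ L′ A″ → (a ∷ l ∷ a′ ∷ l′ ∷ a″ ∷ []) ⊥ (a ∷ L ∷ A′ ∷ L′ ∷ A″ ∷ []) → a′ ≡ A′
    ⊥₅₅-a′ a l a′ l′ a″ L A′ L′ A″ h = linear (a ∷ l ∷ a′ ∷ l′ ∷ a″ ∷ L ∷ A′ ∷ L′ ∷ A″ ∷ [])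
      (λ { (a ∷ l ∷ a′ ∷ l′ ∷ a″ ∷ L ∷ A′ ∷ L′ ∷ A″ ∷ []) →
        reading 5F (a ∷ l ∷ a′ ∷ l′ ∷ a″ ∷ []) (a ∷ L ∷ A′ ∷ L′ ∷ A″ ∷ []) 1# a′ A′ })
      refl (⊥-entry 5F h , tt)

    ⊥₅₅-l : ∀ a l a′ l′ a″ L L′ A″ → (a ∷ l ∷ a′ ∷ l′ ∷ a″ ∷ []) ⊥ (a ∷ L ∷ a′ ∷ L′ ∷ A″ ∷ []) → l ≡ L
    ⊥₅₅-l a l a′ l′ a″ L L′ A″ h = linear (a ∷ l ∷ a′ ∷ l′ ∷ a″ ∷ L ∷ L′ ∷ A″ ∷ [])
      (λ { (a ∷ l ∷ a′ ∷ l′ ∷ a″ ∷ L ∷ L′ ∷ A″ ∷ []) →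
        reading 4F (a ∷ l ∷ a′ ∷ l′ ∷ a″ ∷ []) (a ∷ L ∷ a′ ∷ L′ ∷ A″ ∷ []) (- 1#) l L })
      refl (⊥-entry 4F h , tt)

    ⊥₅₅-l′ : ∀ a l a′ l′ a″ L′ A″ → (a ∷ l ∷ a′ ∷ l′ ∷ a″ ∷ []) ⊥ (a ∷ l ∷ a′ ∷ L′ ∷ A″ ∷ []) → l′ ≡ L′
    ⊥₅₅-l′ a l a′ l′ a″ L′ A″ h = linear (a ∷ l ∷ a′ ∷ l′ ∷ a″ ∷ L′ ∷ A″ ∷ [])
      (λ { (a ∷ l ∷ a′ ∷ l′ ∷ a″ ∷ L′ ∷ A″ ∷ []) →
        reading 3F (a ∷ l ∷ a′ ∷ l′ ∷ a″ ∷ []) (a ∷ l ∷ a′ ∷ L′ ∷ A″ ∷ []) (- 1#) l′ L′ })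
      refl (⊥-entry 3F h , tt)

    ⊥₅₅-opposite-a′ : ∀ k a l a′ l′ a″ A L A′ L′ →
      let u = a ∷ l ∷ a′ ∷ l′ ∷ a″ ∷ [] ; y = topPoint (topLine u k) A in
      ⌜ u ⌝ ⊥ (A ∷ L ∷ A′ ∷ L′ ∷ lookup y 4F ∷ []) → lookup y 2F ≡ A′
    ⊥₅₅-opposite-a′ k a l a′ l′ a″ A L A′ L′ h = linear (k ∷ a ∷ l ∷ a′ ∷ l′ ∷ a″ ∷ A ∷ L ∷ A′ ∷ L′ ∷ [])
      (λ { (k ∷ a ∷ l ∷ a′ ∷ l′ ∷ a″ ∷ A ∷ L ∷ A′ ∷ L′ ∷ []) → let u = a ∷ l ∷ a′ ∷ l′ ∷ a″ ∷ [] ; y = topPoint (topLine u k) A in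
        reading 5F ⌜ u ⌝ (A ∷ L ∷ A′ ∷ L′ ∷ lookup y 4F ∷ []) 1# (lookup y 2F) A′ })
      refl (⊥-entry 5F h , tt)

    ⊥₅₅-opposite-l : ∀ k a l a′ l′ a″ A L L′ →
      let u = a ∷ l ∷ a′ ∷ l′ ∷ a″ ∷ [] ; y = topPoint (topLine u k) A in
      ⌜ u ⌝ ⊥ (A ∷ L ∷ lookup y 2F ∷ L′ ∷ lookup y 4F ∷ []) → lookup y 1F ≡ L
    ⊥₅₅-opposite-l k a l a′ l′ a″ A L L′ h = linear (k ∷ a ∷ l ∷ a′ ∷ l′ ∷ a″ ∷ A ∷ L ∷ L′ ∷ [])
      (λ { (k ∷ a ∷ l ∷ a′ ∷ l′ ∷ a″ ∷ A ∷ L ∷ L′ ∷ []) → let u = a ∷ l ∷ a′ ∷ l′ ∷ a″ ∷ [] ; y = topPoint (topLine u k) A in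
        reading 4F ⌜ u ⌝ (A ∷ L ∷ lookup y 2F ∷ L′ ∷ lookup y 4F ∷ []) (- 1#) (lookup y 1F) L })
      refl (⊥-entry 4F h , tt)

    ⊥₅₅-opposite-l′ : ∀ k a l a′ l′ a″ A L′ →
      let u = a ∷ l ∷ a′ ∷ l′ ∷ a″ ∷ [] ; y = topPoint (topLine u k) A in
      ⌜ u ⌝ ⊥ (A ∷ lookup y 1F ∷ lookup y 2F ∷ L′ ∷ lookup y 4F ∷ []) → lookup y 3F ≡ L′
    ⊥₅₅-opposite-l′ k a l a′ l′ a″ A L′ h = linear (k ∷ a ∷ l ∷ a′ ∷ l′ ∷ a″ ∷ A ∷ L′ ∷ [])
      (λ { (k ∷ a ∷ l ∷ a′ ∷ l′ ∷ a″ ∷ A ∷ L′ ∷ []) → let u = a ∷ l ∷ a′ ∷ l′ ∷ a″ ∷ [] ; y = topPoint (topLine u k) A in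
        reading 3F ⌜ u ⌝ (A ∷ lookup y 1F ∷ lookup y 2F ∷ L′ ∷ lookup y 4F ∷ []) (- 1#) (lookup y 3F) L′ })
      refl (⊥-entry 3F h , tt)

    ⊥₅₅-opposite-a″ : ∀ k a a″ A A″ → (a - A) * k ≡ a″ - A″ → A * k - (a * k - a″) ≡ A″
    ⊥₅₅-opposite-a″ k a a″ A A″ h = linear (k ∷ a ∷ a″ ∷ A ∷ A″ ∷ []) (λ { (k ∷ a ∷ a″ ∷ A ∷ A″ ∷ []) →
      A * k - (a * k - a″) ≐ A″ by (- 1# , (a - A) * k , a″ - A″) ∷ [] }) refl (h , tt)

    -- The slope settles the last letter. The product then yields the third, second and fourth
    -- letters in this order, each entry becoming a plain difference only after the earlier letters
    -- are eliminated.
    ⊥₅₅-opposite : ∀ k a l a′ l′ a″ A L A′ L′ A″ → (a - A) * k ≡ a″ - A″ →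
      (a ∷ l ∷ a′ ∷ l′ ∷ a″ ∷ []) ⊥ (A ∷ L ∷ A′ ∷ L′ ∷ A″ ∷ []) →
      topPoint (topLine (a ∷ l ∷ a′ ∷ l′ ∷ a″ ∷ []) k) A ≡ A ∷ L ∷ A′ ∷ L′ ∷ A″ ∷ []
    ⊥₅₅-opposite k a l a′ l′ a″ A L A′ L′ A″ s h
      with refl ← ⊥₅₅-opposite-a″ k a a″ A A″ s
      with refl ← ⊥₅₅-opposite-a′ k a l a′ l′ a″ A L A′ L′ h
      with refl ← ⊥₅₅-opposite-l k a l a′ l′ a″ A L L′ h
      with refl ← ⊥₅₅-opposite-l′ k a l a′ l′ a″ A L′ h = refl

    -- The points on a line of length m have lengths m - 1 and m + 1, except 0 and 1 for m = 0 and 4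
    -- and 5 for m = 5. All other pairs of lengths are refuted; for these, the equations between
    -- letters say that both points lie on the line written down.
    join : ∀ p z → p ⊥ z → ∃ λ l → l ∋ p × l ∋ z
    join []                                []                                _ = [] , (nothing , refl) , (nothing , refl)
    join []                                (A ∷ [])                          _ = [] , (nothing , refl) , (just A , refl)
    join []                                (K ∷ β ∷ [])                      _ = (K ∷ []) , (nothing , refl) , (just β , refl)
    join []                                (A ∷ L ∷ A′ ∷ [])                 h = ⊥-elim (1≢0 (⊥₀₃ A L A′ h))
    join []                                (K ∷ β ∷ K′ ∷ β′ ∷ [])            h = ⊥-elim (1≢0 (⊥₀₄ K β K′ β′ h))
    join []                                (A ∷ L ∷ A′ ∷ L′ ∷ A″ ∷ [])       h = ⊥-elim (1≢0 (⊥₀₅ A L A′ L′ A″ h))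
    join (a ∷ [])                          (A ∷ [])                          _ = [] , (just a , refl) , (just A , refl)
    join (a ∷ [])                          (K ∷ β ∷ [])                      h = ⊥-elim (1≢0 (⊥₁₂ a K β h))
    join (a ∷ [])                          (A ∷ L ∷ A′ ∷ [])                 h with refl ← ⊥₁₃ a A L A′ h =
      (a ∷ L ∷ []) , (nothing , refl) , (just A′ , refl)
    join (a ∷ [])                          (K ∷ β ∷ K′ ∷ β′ ∷ [])            h = ⊥-elim (1≢0 (⊥₁₄ a K β K′ β′ h))
    join (a ∷ [])                          (A ∷ L ∷ A′ ∷ L′ ∷ A″ ∷ [])       h = ⊥-elim (1≢0 (⊥₁₅ a A L A′ L′ A″ h))
    join (k ∷ b ∷ [])                      (K ∷ β ∷ [])                      h with refl ← ⊥₂₂ k b K β h =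
      (k ∷ []) , (just b , refl) , (just β , refl)
    join (k ∷ b ∷ [])                      (A ∷ L ∷ A′ ∷ [])                 h = ⊥-elim (1≢0 (⊥₂₃ k b A L A′ h))
    join (k ∷ b ∷ [])                      (K ∷ β ∷ K′ ∷ β′ ∷ [])            h
      with refl ← ⊥₂₄-k k b K β K′ β′ h
      with refl ← ⊥₂₄-b k b β K′ β′ h =
      (k ∷ b ∷ K′ ∷ []) , (nothing , refl) , (just β′ , refl)
    join (k ∷ b ∷ [])                      (A ∷ L ∷ A′ ∷ L′ ∷ A″ ∷ [])       h = ⊥-elim (1≢0 (⊥₂₅ k b A L A′ L′ A″ h))
    join (a ∷ l ∷ a′ ∷ [])                 (A ∷ L ∷ A′ ∷ [])                 h
      with refl ← ⊥₃₃-a a l a′ A L A′ h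
      with refl ← ⊥₃₃-l a l a′ L A′ h =
      (a ∷ l ∷ []) , (just a′ , refl) , (just A′ , refl)
    join (a ∷ l ∷ a′ ∷ [])                 (K ∷ β ∷ K′ ∷ β′ ∷ [])            h = ⊥-elim (1≢0 (⊥₃₄ a l a′ K β K′ β′ h))
    join (a ∷ l ∷ a′ ∷ [])                 (A ∷ L ∷ A′ ∷ L′ ∷ A″ ∷ [])       h
      with refl ← ⊥₃₅-a a l a′ A L A′ L′ A″ h
      with refl ← ⊥₃₅-a′ a l a′ L A′ L′ A″ h
      with refl ← ⊥₃₅-l a l L A′ L′ A″ h =
      (a ∷ l ∷ a′ ∷ L′ ∷ []) , (nothing , refl) , (just A″ , refl)
    join (k ∷ b ∷ k′ ∷ b′ ∷ [])            (K ∷ β ∷ K′ ∷ β′ ∷ [])            h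
      with refl ← ⊥₄₄-k k b k′ b′ K β K′ β′ h
      with refl ← ⊥₄₄-b k b k′ b′ β K′ β′ h
      with refl ← ⊥₄₄-k′ k b k′ b′ K′ β′ h =
      (k ∷ b ∷ k′ ∷ []) , (just b′ , refl) , (just β′ , refl)
    join (k ∷ b ∷ k′ ∷ b′ ∷ [])            (a ∷ l ∷ a′ ∷ l′ ∷ a″ ∷ [])       h
      with refl ← ⊥₄₅-b k b k′ b′ a l a′ l′ a″ h
      with refl ← ⊥₄₅-b′ k k′ b′ a l a′ l′ a″ h
      with refl ← ⊥₄₅-k′ k k′ a l a′ l′ a″ h =
      ⌜ topLine u k ⌝ , (nothing , refl) , (just a , cong ⌜_⌝ (topPoint-topLine u k))
      where u = a ∷ l ∷ a′ ∷ l′ ∷ a″ ∷ []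
    join (a ∷ l ∷ a′ ∷ l′ ∷ a″ ∷ [])       (A ∷ L ∷ A′ ∷ L′ ∷ A″ ∷ [])       h with a ≟ A
    ... | yes refl
      with refl ← ⊥₅₅-a′ a l a′ l′ a″ L A′ L′ A″ h
      with refl ← ⊥₅₅-l a l a′ l′ a″ L L′ A″ h
      with refl ← ⊥₅₅-l′ a l a′ l′ a″ L′ A″ h =
      (a ∷ l ∷ a′ ∷ l′ ∷ []) , (just a″ , refl) , (just A″ , refl)
    ... | no a≢A with k , s ← slope a≢A (a″ - A″) = ⌜ topLine u k ⌝ ,
      (just a , cong ⌜_⌝ (topPoint-topLine u k)) ,
      (just A , cong ⌜_⌝ (⊥₅₅-opposite k a l a′ l′ a″ A L A′ L′ A″ s h))
      where u = a ∷ l ∷ a′ ∷ l′ ∷ a″ ∷ []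
    join p@(_ ∷ [])                    []                         h = map₂ swap (join [] p (⊥-sym h))
    join p@(_ ∷ _ ∷ [])                []                         h = map₂ swap (join [] p (⊥-sym h))
    join p@(_ ∷ _ ∷ [])                z@(_ ∷ [])                 h = map₂ swap (join z p (⊥-sym h))
    join p@(_ ∷ _ ∷ _ ∷ [])            []                         h = map₂ swap (join [] p (⊥-sym h))
    join p@(_ ∷ _ ∷ _ ∷ [])            z@(_ ∷ [])                 h = map₂ swap (join z p (⊥-sym h))
    join p@(_ ∷ _ ∷ _ ∷ [])            z@(_ ∷ _ ∷ [])             h = map₂ swap (join z p (⊥-sym h))
    join p@(_ ∷ _ ∷ _ ∷ _ ∷ [])        []                         h = map₂ swap (join [] p (⊥-sym h))
    join p@(_ ∷ _ ∷ _ ∷ _ ∷ [])        z@(_ ∷ [])                 h = map₂ swap (join z p (⊥-sym h))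
    join p@(_ ∷ _ ∷ _ ∷ _ ∷ [])        z@(_ ∷ _ ∷ [])             h = map₂ swap (join z p (⊥-sym h))
    join p@(_ ∷ _ ∷ _ ∷ _ ∷ [])        z@(_ ∷ _ ∷ _ ∷ [])         h = map₂ swap (join z p (⊥-sym h))
    join p@(_ ∷ _ ∷ _ ∷ _ ∷ _ ∷ [])    []                         h = map₂ swap (join [] p (⊥-sym h))
    join p@(_ ∷ _ ∷ _ ∷ _ ∷ _ ∷ [])    z@(_ ∷ [])                 h = map₂ swap (join z p (⊥-sym h))
    join p@(_ ∷ _ ∷ _ ∷ _ ∷ _ ∷ [])    z@(_ ∷ _ ∷ [])             h = map₂ swap (join z p (⊥-sym h))
    join p@(_ ∷ _ ∷ _ ∷ _ ∷ _ ∷ [])    z@(_ ∷ _ ∷ _ ∷ [])         h = map₂ swap (join z p (⊥-sym h))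
    join p@(_ ∷ _ ∷ _ ∷ _ ∷ _ ∷ [])    z@(_ ∷ _ ∷ _ ∷ _ ∷ [])     h = map₂ swap (join z p (⊥-sym h))

    -- The product of the two octonions is singular but need not be of the form `vec r`;
    -- `normalised` supplies such an `r` up to a scalar, and scaling preserves collinearity.
    path : ∀ c p z → B (vec p) (vec z) ≡ 0# → Within nb 4 (pt c p) (pt c z)
    path c p z h with ≡-dec _≟_ (mul (vec p) (vec z)) 0ᵛ
    ... | yes w≡0 = let _ , l∋p , l∋z = join p z (perpendicular (mul≡0⇒collinear (vec p) (vec z) h w≡0)) in
      weaken (weaken (collinear l∋p l∋z))
    ... | no w≢0 =
      let r , d , eq      = normalised (mul (vec p) (vec z)) (mul-singular (vec p) (vec z) (vec-singular p) h) w≢0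
          _ , l∋p , l∋r   = join p r (perpendicular (subst (Collinear (vec p)) (sym eq)
                              (collinear-scale d (vec p) _ (collinear-mulˡ (vec p) (vec z) (vec-singular p) h))))
          _ , m∋z , m∋r   = join z r (perpendicular (subst (Collinear (vec z)) (sym eq)
                              (collinear-scale d (vec z) _ (collinear-sym _ (vec z) (collinear-mulʳ (vec p) (vec z) (vec-singular z) h)))))
      in collinear {c′ = c} l∋p l∋r ⟫ collinear m∋r m∋z

    near : ∀ c p l → Within nb 5 (pt c p) (ln l)
    near c p l = let i , h = foot (vec p) l in path c p (point l i) h ⟫ pt→ln (i , refl)

    bigraph₆ : Bigraph (suc q) (2 ℕ.* suc q) 6 (2 ℕ.* words q 5 ℕ.+ words q 5)
    bigraph₆ = polygonBigraph (pt true (0# ∷ 0# ∷ 0# ∷ 0# ∷ 0# ∷ [])) refl (near-even nothing near)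

-- Rings up to an equivalence, quotients and residue fields

module Rings where

  open Solver
  open import Algebra.Bundles using (CommutativeRing)
  open import Data.Empty using (⊥-elim)
  open import Data.List.Base using (List; []; _∷_; length)
  open import Data.List.Relation.Unary.All using ([]; _∷_)
  open import Data.List.Relation.Unary.Any as Any using (Any; here; there)
  open import Data.Nat.Base using (zero; suc; _≤_; s≤s⁻¹)
  open import Data.Nat.Properties using (≤-trans; ≤-reflexive)
  open import Data.Product.Base using (Σ; ∃; _×_; _,_; proj₁; proj₂)
  open import Data.Sum.Base as Sum using (_⊎_; inj₁; inj₂)
  open import Data.Unit.Base using (tt)
  open import Data.Vec.Base using ([]; _∷_)
  open import Function.Base using (_∘_; id)
  open import Level using (0ℓ)
  open import Relation.Binary.Core using (Rel)
  open import Relation.Binary.Definitions using (Decidable)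
  import Relation.Binary.PropositionalEquality as P
  open import Relation.Binary.Structures using (IsEquivalence)
  open import Relation.Nullary using (¬_; Dec; yes; no)
  open import Relation.Nullary.Decidable using (map′)
  open P using (_≡_)

  -- Equality is a relation of the ring, so that a quotient keeps the carrier and merely coarsens
  -- the relation.
  Ring : Set₁
  Ring = CommutativeRing 0ℓ 0ℓ

  module Theory (R : Ring) where
    open CommutativeRing R public hiding (_+_; _*_; -_; 0#; 1#; _-_; zero)
    open RingSolver R public

  record RingLaws {A : Set} (_≈_ : Rel A 0ℓ) ⦃ o : Ops A ⦄ : Set where
    field
      isEquivalence : IsEquivalence _≈_
      +-cong        : ∀ {x y u v} → x ≈ y → u ≈ v → (x + u) ≈ (y + v)
      *-cong        : ∀ {x y u v} → x ≈ y → u ≈ v → (x * u) ≈ (y * v)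
      -‿cong        : ∀ {x y} → x ≈ y → (- x) ≈ (- y)
      +-assoc       : ∀ x y z → ((x + y) + z) ≈ (x + (y + z))
      +-comm        : ∀ x y → (x + y) ≈ (y + x)
      +-identityˡ   : ∀ x → (0# + x) ≈ x
      -‿inverseˡ    : ∀ x → (- x + x) ≈ 0#
      *-assoc       : ∀ x y z → ((x * y) * z) ≈ (x * (y * z))
      *-comm        : ∀ x y → (x * y) ≈ (y * x)
      *-identityˡ   : ∀ x → (1# * x) ≈ x
      distribˡ      : ∀ x y z → (x * (y + z)) ≈ (x * y + x * z)

  mkRing : {A : Set} (_≈_ : Rel A 0ℓ) ⦃ o : Ops A ⦄ → RingLaws _≈_ → Ring
  mkRing {A} _≈_ ⦃ o ⦄ r = record
    { Carrier = A ; _≈_ = _≈_ ; _+_ = _+_ ; _*_ = _*_ ; -_ = -_ ; 0# = 0# ; 1# = 1#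
    ; isCommutativeRing = record
      { isRing = record
        { +-isAbelianGroup = record
          { isGroup = record
            { isMonoid = record
              { isSemigroup = record { isMagma = record { isEquivalence = isEquivalence ; ∙-cong = +-cong } ; assoc = +-assoc }
              ; identity    = +-identityˡ , λ x → trans (+-comm x 0#) (+-identityˡ x)
              }
            ; inverse = -‿inverseˡ , λ x → trans (+-comm x (- x)) (-‿inverseˡ x)
            ; ⁻¹-cong = -‿cong
            }
          ; comm = +-comm
          }
        ; *-cong     = *-cong
        ; *-assoc    = *-assoc
        ; *-identity = *-identityˡ , λ x → trans (*-comm x 1#) (*-identityˡ x)
        ; distrib    = distribˡ , λ x y z → trans (*-comm (y + z) x) (trans (distribˡ x y z) (+-cong (*-comm x y) (*-comm x z)))
        }
      ; *-comm = *-comm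
      }
    }
    where
    open RingLaws r
    open IsEquivalence isEquivalence

  record Hom (R S : Ring) : Set where
    private
      module R = CommutativeRing R
      module S = CommutativeRing S
    field
      ⟪_⟫    : R.Carrier → S.Carrier
      cong   : ∀ {x y} → x R.≈ y → ⟪ x ⟫ S.≈ ⟪ y ⟫
      +-homo : ∀ x y → ⟪ x R.+ y ⟫ S.≈ ⟪ x ⟫ S.+ ⟪ y ⟫
      *-homo : ∀ x y → ⟪ x R.* y ⟫ S.≈ ⟪ x ⟫ S.* ⟪ y ⟫
      0-homo : ⟪ R.0# ⟫ S.≈ S.0#
      1-homo : ⟪ R.1# ⟫ S.≈ S.1#

  idHom : ∀ {R} → Hom R R
  idHom {R} = record { ⟪_⟫ = id ; cong = id ; +-homo = λ _ _ → refl ; *-homo = λ _ _ → refl ; 0-homo = refl ; 1-homo = refl }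
    where open CommutativeRing R

  infixr 9 _∘ʰ_

  _∘ʰ_ : ∀ {R S T} → Hom S T → Hom R S → Hom R T
  _∘ʰ_ {T = T} g f = record
    { ⟪_⟫    = G.⟪_⟫ ∘ F.⟪_⟫
    ; cong   = G.cong ∘ F.cong
    ; +-homo = λ x y → trans (G.cong (F.+-homo x y)) (G.+-homo _ _)
    ; *-homo = λ x y → trans (G.cong (F.*-homo x y)) (G.*-homo _ _)
    ; 0-homo = trans (G.cong F.0-homo) G.0-homo
    ; 1-homo = trans (G.cong F.1-homo) G.1-homo
    }
    where
    module F = Hom f
    module G = Hom g
    open CommutativeRing T using (trans)

  -- A class may be listed several times. The list serves for exhaustive search, and its length for
  -- the induction in `residueField`.
  record Finite (R : Ring) : Set where
    open Theory R
    field
      cover    : List Carrier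
      complete : ∀ x → Any (x ≈_) cover
      _≟_      : Decidable _≈_
      1≉0      : ¬ 1# ≈ 0#

  module Quotient (R : Ring) (a : CommutativeRing.Carrier R) where
    private module R = CommutativeRing R
    open Theory R using (Carrier; _≈_; linear; ringOps)

    infix 4 _~_
    _~_ : Carrier → Carrier → Set
    x ~ y = ∃ λ c → x ≈ y + c * a

    ≈⇒~ : ∀ {x y} → x ≈ y → x ~ y
    ≈⇒~ {x} {y} h = 0# , linear (x ∷ y ∷ a ∷ []) (λ { (x ∷ y ∷ a ∷ []) → x ≐ y + 0# * a by (1# , x , y) ∷ [] }) P.refl (h , tt)

    quotient : Ring
    quotient = mkRing _~_ (record
      { isEquivalence = record
        { refl  = ≈⇒~ R.refl
        ; sym   = λ { {x} {y} (c , h) → - c , linear (x ∷ y ∷ c ∷ a ∷ []) (λ { (x ∷ y ∷ c ∷ a ∷ []) →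
                    y ≐ x + - c * a by (- 1# , x , y + c * a) ∷ [] }) P.refl (h , tt) }
        ; trans = λ { {x} {y} {z} (c , h) (d , k) → c + d , linear (x ∷ y ∷ z ∷ c ∷ d ∷ a ∷ []) (λ { (x ∷ y ∷ z ∷ c ∷ d ∷ a ∷ []) →
                    x ≐ z + (c + d) * a by (1# , x , y + c * a) ∷ (1# , y , z + d * a) ∷ [] }) P.refl (h , k , tt) }
        }
      ; +-cong      = λ { {x} {y} {u} {v} (c , h) (d , k) → c + d , linear (x ∷ y ∷ u ∷ v ∷ c ∷ d ∷ a ∷ []) (λ { (x ∷ y ∷ u ∷ v ∷ c ∷ d ∷ a ∷ []) →
                        x + u ≐ y + v + (c + d) * a by (1# , x , y + c * a) ∷ (1# , u , v + d * a) ∷ [] }) P.refl (h , k , tt) }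
      ; *-cong      = λ { {x} {y} {u} {v} (c , h) (d , k) → c * u + y * d , linear (x ∷ y ∷ u ∷ v ∷ c ∷ d ∷ a ∷ []) (λ { (x ∷ y ∷ u ∷ v ∷ c ∷ d ∷ a ∷ []) →
                        x * u ≐ y * v + (c * u + y * d) * a by (u , x , y + c * a) ∷ (y , u , v + d * a) ∷ [] }) P.refl (h , k , tt) }
      ; -‿cong      = λ { {x} {y} (c , h) → - c , linear (x ∷ y ∷ c ∷ a ∷ []) (λ { (x ∷ y ∷ c ∷ a ∷ []) →
                        - x ≐ - y + - c * a by (- 1# , x , y + c * a) ∷ [] }) P.refl (h , tt) }
      ; +-assoc     = λ x y z → ≈⇒~ (R.+-assoc x y z)
      ; +-comm      = λ x y → ≈⇒~ (R.+-comm x y)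
      ; +-identityˡ = λ x → ≈⇒~ (R.+-identityˡ x)
      ; -‿inverseˡ  = λ x → ≈⇒~ (R.-‿inverseˡ x)
      ; *-assoc     = λ x y z → ≈⇒~ (R.*-assoc x y z)
      ; *-comm      = λ x y → ≈⇒~ (R.*-comm x y)
      ; *-identityˡ = λ x → ≈⇒~ (R.*-identityˡ x)
      ; distribˡ    = λ x y z → ≈⇒~ (R.distribˡ x y z)
      })

    projection : Hom R quotient
    projection = record
      { ⟪_⟫ = id ; cong = ≈⇒~ ; +-homo = λ _ _ → ≈⇒~ R.refl ; *-homo = λ _ _ → ≈⇒~ R.refl ; 0-homo = ≈⇒~ R.refl ; 1-homo = ≈⇒~ R.refl }

  record IsField (K : Ring) : Set where
    open Theory K
    field
      inverse : ∀ x → ¬ x ≈ 0# → ∃ λ y → x * y ≈ 1#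
      _≟_     : Decidable _≈_
      1≉0     : ¬ 1# ≈ 0#

  module _ (R : Ring) where
    open Theory R

    split : ∀ {a x} {l : List Carrier} (i : Any (a ≈_) l) → Any (x ≈_) l → Any (x ≈_) (l Any.─ i) ⊎ x ≈ a
    split (here a≈y) (here x≈y) = inj₂ (trans x≈y (sym a≈y))
    split (here _)   (there k)  = inj₁ k
    split (there i)  (here x≈y) = inj₁ (here x≈y)
    split (there i)  (there k)  = Sum.map₁ there (split i k)

    length-─ : ∀ {a} {l : List Carrier} (i : Any (a ≈_) l) → suc (length (l Any.─ i)) ≡ length l
    length-─ (here _)  = P.refl
    length-─ (there i) = P.cong suc (length-─ i)

  -- If some a ≠ 0 has no inverse, then R / (a) is a smaller nonzero ring.
  residueField : ∀ n (R : Ring) (fin : Finite R) → length (Finite.cover fin) ≤ n → Σ Ring λ K → IsField K × Hom R K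
  residueField n R fin bound with Any.any? noInverse? cover
    where
    open Theory R
    open Finite fin
    noInverse? : ∀ a → Dec (¬ a ≈ 0# × ¬ Any (λ y → a * y ≈ 1#) cover)
    noInverse? a with a ≟ 0# | Any.any? (λ y → (a * y) ≟ 1#) cover
    ... | yes a≈0 | _       = no λ (a≉0 , _) → a≉0 a≈0
    ... | no _    | yes inv = no λ (_ , ninv) → ninv inv
    ... | no a≉0  | no ninv = yes (a≉0 , ninv)
  ... | no all = R , record { inverse = invert ; _≟_ = _≟_ ; 1≉0 = 1≉0 } , idHom
    where
    open Theory R
    open Finite fin
    invert : ∀ x → ¬ x ≈ 0# → ∃ λ y → x * y ≈ 1#
    invert x x≉0 with Any.any? (λ y → (x * y) ≟ 1#) cover
    ... | yes inv = Any.lookup inv , lookup-result inv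
      where
      lookup-result : ∀ {l} (i : Any (λ y → x * y ≈ 1#) l) → x * Any.lookup i ≈ 1#
      lookup-result (here h)  = h
      lookup-result (there i) = lookup-result i
    ... | no ninv = ⊥-elim (all (Any.map (λ {y} x≈y → (λ y≈0 → x≉0 (trans x≈y y≈0)) ,
                      λ inv → ninv (Any.map (λ h → trans (*-congʳ x≈y) h) inv)) (complete x)))
  residueField zero R fin bound | yes bad with Finite.cover fin
  residueField zero R fin () | yes (here _)  | _ ∷ _
  residueField zero R fin () | yes (there _) | _ ∷ _
  residueField (suc n) R fin bound | yes bad =
    let K , field′ , φ = residueField n quotient finite (s≤s⁻¹ (≤-trans (≤-reflexive (length-─ R i)) bound))
    in K , field′ , φ ∘ʰ projection
    where
    open Theory R
    open Finite fin

    find : ∀ {l} → Any (λ a → ¬ a ≈ 0# × ¬ Any (λ y → a * y ≈ 1#) cover) l →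
           ∃ λ a → ¬ a ≈ 0# × ¬ Any (λ y → a * y ≈ 1#) cover
    find (here h)  = _ , h
    find (there k) = find k

    a : Carrier
    a = proj₁ (find bad)

    open Quotient R a

    i : Any (a ≈_) cover
    i = complete a

    -- Modulo `a` the class of `a` is that of 0. As a ≠ 0, striking `a` from the cover leaves an
    -- entry for 0, which can stand in for it.
    zero∈ : Any (0# ≈_) (cover Any.─ i)
    zero∈ with split R i (complete 0#)
    ... | inj₁ k   = k
    ... | inj₂ 0≈a = ⊥-elim (proj₁ (proj₂ (find bad)) (sym 0≈a))

    a~0 : a ~ 0#
    a~0 = 1# , trans (sym (*-identityˡ a)) (sym (+-identityˡ _))

    finite : Finite quotient
    finite = record
      { cover    = cover Any.─ i
      ; complete = λ x → keep x (split R i (complete x))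
      ; _≟_      = λ x y → map′ search found (Any.any? (λ c → x ≟ (y + c * a)) cover)
      -- If 1 is a multiple c a, then c is an inverse of `a`, against the choice of `a`.
      ; 1≉0      = λ (c , h) → proj₂ (proj₂ (find bad)) (Any.map
          (λ {y} c≈y → trans (*-congˡ (sym c≈y)) (trans (*-comm a c) (trans (sym (+-identityˡ _)) (sym h)))) (complete c))
      }
      where
      keep : ∀ x → Any (x ≈_) (cover Any.─ i) ⊎ x ≈ a → Any (x ~_) (cover Any.─ i)
      keep x (inj₁ k)   = Any.map ≈⇒~ k
      keep x (inj₂ x≈a) = Any.map (λ 0≈y → Q.trans (≈⇒~ x≈a) (Q.trans a~0 (≈⇒~ 0≈y))) zero∈
        where module Q = CommutativeRing quotient

      search : ∀ {x y l} → Any (λ c → x ≈ y + c * a) l → x ~ y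
      search (here h)  = _ , h
      search (there k) = search k

      found : ∀ {x y} → x ~ y → Any (λ c → x ≈ y + c * a) cover
      found (c , h) = Any.map (λ c≈d → trans h (+-congˡ (*-congʳ c≈d))) (complete c)

-- Adjoining a root of a monic polynomial

module RootAdjunction where

  open Rings
  open Solver
  open import Algebra.Bundles using (CommutativeRing)
  open import Data.List.Base using (List; []; _∷_; cartesianProductWith)
  open import Data.List.Relation.Unary.Any as Any using (Any; here)
  open import Data.List.Relation.Unary.Any.Properties using (cartesianProductWith⁺)
  open import Data.Nat.Base using (ℕ; zero; suc; _≤_; _<_; z≤n; s≤s; s≤s⁻¹)
  open import Data.Nat.Properties using (≤-trans; ≤-refl; n≤1+n; <⇒≤)
  open import Data.Product.Base using (_,_)
  open import Data.Unit.Base using (tt)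
  open import Data.Vec.Base using ([]; _∷_)
  open import Function.Base using (_∘_)
  import Relation.Binary.PropositionalEquality as P
  open import Relation.Nullary using (Dec; yes; no)

  -- g stands for the monic polynomial g₀ + g₁ x + … + xᵐ.
  module _ (R : Ring) where
    open Theory R

    monicEval : ℕ → (ℕ → Carrier) → Carrier → Carrier
    monicEval zero    g x = 1#
    monicEval (suc m) g x = g 0 + x * monicEval m (g ∘ suc) x

    monicEval-cong : ∀ m {g h x y} → (∀ i → g i ≈ h i) → x ≈ y → monicEval m g x ≈ monicEval m h y
    monicEval-cong zero    e x≈y = refl
    monicEval-cong (suc m) e x≈y = +-cong (e 0) (*-cong x≈y (monicEval-cong m (e ∘ suc) x≈y))

    -- Coefficients of the quotient of g by x - b, as in synthetic division: the i-th one is the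
    -- value at b of what remains of g after removing the i + 1 lowest terms and dividing by a power
    -- of x.
    deflate : ℕ → (ℕ → Carrier) → Carrier → ℕ → Carrier
    deflate zero    g b i       = 0#
    deflate (suc m) g b zero    = monicEval m (g ∘ suc) b
    deflate (suc m) g b (suc i) = deflate m (g ∘ suc) b i

    deflate-cong : ∀ m {g h b c} → (∀ i → g i ≈ h i) → b ≈ c → ∀ i → deflate m g b i ≈ deflate m h c i
    deflate-cong zero    e b≈c i       = refl
    deflate-cong (suc m) e b≈c zero    = monicEval-cong m (e ∘ suc) b≈c
    deflate-cong (suc m) e b≈c (suc i) = deflate-cong m (e ∘ suc) b≈c i

    -- The remainder theorem. With g(x) = g₀ + x h(x) and h(x) = h(b) + (x - b) d(x), the quotient
    -- for g is h(b) + x d(x).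
    monicEval-deflate : ∀ m g b x →
      monicEval (suc m) g x ≈ monicEval (suc m) g b + (x - b) * monicEval m (deflate (suc m) g b) x
    monicEval-deflate zero    g b x = solve (g 0 ∷ b ∷ x ∷ []) (λ { (g₀ ∷ b ∷ x ∷ []) →
      g₀ + x * 1# ≐ g₀ + b * 1# + (x - b) * 1# }) P.refl
    monicEval-deflate (suc m) g b x = linear (g 0 ∷ b ∷ x ∷ hx ∷ hb ∷ d ∷ [])
      (λ { (g₀ ∷ b ∷ x ∷ hx ∷ hb ∷ d ∷ []) →
        g₀ + x * hx ≐ g₀ + b * hb + (x - b) * (hb + x * d) by (x , hx , hb + (x - b) * d) ∷ [] })
      P.refl (monicEval-deflate m (g ∘ suc) b x , tt)
      where
      hx hb d : Carrier
      hx = monicEval (suc m) (g ∘ suc) x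
      hb = monicEval (suc m) (g ∘ suc) b
      d  = monicEval m (deflate (suc m) (g ∘ suc) b) x

  module _ {R S : Ring} (φ : Hom R S) where
    private
      module R = CommutativeRing R
    open Theory S
    open Hom φ

    monicEval-homo : ∀ m g x → ⟪ monicEval R m g x ⟫ ≈ monicEval S m (⟪_⟫ ∘ g) ⟪ x ⟫
    monicEval-homo zero    g x = 1-homo
    monicEval-homo (suc m) g x = trans (+-homo _ _)
      (+-congˡ (trans (*-homo _ _) (*-congˡ (monicEval-homo m (g ∘ suc) x))))

    deflate-homo : ∀ m g b i → ⟪ deflate R m g b i ⟫ ≈ deflate S m (⟪_⟫ ∘ g) ⟪ b ⟫ i
    deflate-homo zero    g b i       = 0-homo
    deflate-homo (suc m) g b zero    = monicEval-homo m (g ∘ suc) b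
    deflate-homo (suc m) g b (suc i) = deflate-homo m (g ∘ suc) b i

  -- R[x]/(g) for g monic of degree n + 1: coefficient sequences, compared up
  -- to the index n.  Multiplication by x is the operator T, and a sequence a
  -- acts on R[x]/(g) as the polynomial a(T).  Polynomials in T commute and
  -- a(T) e₀ = a, whence the ring laws.
  module Adjoin (R : Ring) (n : ℕ) (g : ℕ → CommutativeRing.Carrier R) where
    open Theory R

    M : Set
    M = ℕ → Carrier

    infix 4 _≋_
    _≋_ : M → M → Set
    f ≋ h = ∀ i → i ≤ n → f i ≈ h i

    ≋-refl : ∀ {f} → f ≋ f
    ≋-refl i _ = refl

    ≋-sym : ∀ {f h} → f ≋ h → h ≋ f
    ≋-sym e i p = sym (e i p)

    ≋-trans : ∀ {f h k} → f ≋ h → h ≋ k → f ≋ k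
    ≋-trans e e′ i p = trans (e i p) (e′ i p)

    infixl 6 _⊕_
    infixl 7 _·_
    _⊕_ : M → M → M
    (f ⊕ h) i = f i + h i

    _·_ : Carrier → M → M
    (r · f) i = r * f i

    0ᴹ e₀ : M
    0ᴹ i = 0#
    e₀ zero    = 1#
    e₀ (suc i) = 0#

    ⊕-cong : ∀ {f f′ h h′} → f ≋ f′ → h ≋ h′ → f ⊕ h ≋ f′ ⊕ h′
    ⊕-cong e e′ i p = +-cong (e i p) (e′ i p)

    ·-cong : ∀ {r s f h} → r ≈ s → f ≋ h → r · f ≋ s · h
    ·-cong e e′ i p = *-cong e (e′ i p)

    -- The coefficient at index n overflows and is reduced by xⁿ⁺¹ = - (g₀ + g₁ x + ... + gₙ xⁿ).
    T : M → M
    T f zero    = - (f n * g 0)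
    T f (suc i) = f i - f n * g (suc i)

    T-cong : ∀ {f h} → f ≋ h → T f ≋ T h
    T-cong e zero    p = -‿cong (*-congʳ (e n ≤-refl))
    T-cong e (suc i) p = +-cong (e i (<⇒≤ p)) (-‿cong (*-congʳ (e n ≤-refl)))

    T-⊕ : ∀ f h → T (f ⊕ h) ≋ T f ⊕ T h
    T-⊕ f h zero    p = solve (f n ∷ h n ∷ g 0 ∷ []) (λ { (x ∷ y ∷ z ∷ []) →
      - ((x + y) * z) ≐ - (x * z) + - (y * z) }) P.refl
    T-⊕ f h (suc i) p = solve (f i ∷ h i ∷ f n ∷ h n ∷ g (suc i) ∷ []) (λ { (u ∷ v ∷ x ∷ y ∷ z ∷ []) →
      u + v - (x + y) * z ≐ u - x * z + (v - y * z) }) P.refl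

    T-· : ∀ r f → T (r · f) ≋ r · T f
    T-· r f zero    p = solve (r ∷ f n ∷ g 0 ∷ []) (λ { (r ∷ x ∷ z ∷ []) → - (r * x * z) ≐ r * - (x * z) }) P.refl
    T-· r f (suc i) p = solve (r ∷ f i ∷ f n ∷ g (suc i) ∷ []) (λ { (r ∷ u ∷ x ∷ z ∷ []) →
      r * u - r * x * z ≐ r * (u - x * z) }) P.refl

    T-0 : T 0ᴹ ≋ 0ᴹ
    T-0 zero    p = solve (g 0 ∷ []) (λ { (z ∷ []) → - (0# * z) ≐ 0# }) P.refl
    T-0 (suc i) p = solve (g (suc i) ∷ []) (λ { (z ∷ []) → 0# - 0# * z ≐ 0# }) P.refl

    -- Horner's scheme for the sum of aᵢ Tⁱ b over i < k.
    act : ℕ → M → M → M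
    act zero    a b = 0ᴹ
    act (suc k) a b = a 0 · b ⊕ T (act k (a ∘ suc) b)

    act-cong : ∀ k {a a′ b b′} → (∀ i → i < k → a i ≈ a′ i) → b ≋ b′ → act k a b ≋ act k a′ b′
    act-cong zero    e e′ = ≋-refl
    act-cong (suc k) e e′ = ⊕-cong (·-cong (e 0 (s≤s z≤n)) e′) (T-cong (act-cong k (λ i p → e (suc i) (s≤s p)) e′))

    act-⊕ : ∀ k a b c → act k a (b ⊕ c) ≋ act k a b ⊕ act k a c
    act-⊕ zero    a b c i p = sym (+-identityˡ 0#)
    act-⊕ (suc k) a b c i p = trans
      (+-congˡ (trans (T-cong (act-⊕ k (a ∘ suc) b c) i p) (T-⊕ (act k (a ∘ suc) b) (act k (a ∘ suc) c) i p)))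
      (solve (a 0 ∷ b i ∷ c i ∷ T (act k (a ∘ suc) b) i ∷ T (act k (a ∘ suc) c) i ∷ []) (λ { (a ∷ b ∷ c ∷ x ∷ y ∷ []) →
        a * (b + c) + (x + y) ≐ a * b + x + (a * c + y) }) P.refl)

    act-· : ∀ k a r b → act k a (r · b) ≋ r · act k a b
    act-· zero    a r b i p = sym (zeroʳ r)
    act-· (suc k) a r b i p = trans
      (+-congˡ (trans (T-cong (act-· k (a ∘ suc) r b) i p) (T-· r (act k (a ∘ suc) b) i p)))
      (solve (a 0 ∷ r ∷ b i ∷ T (act k (a ∘ suc) b) i ∷ []) (λ { (a ∷ r ∷ b ∷ x ∷ []) →
        a * (r * b) + r * x ≐ r * (a * b + x) }) P.refl)

    act-scalar : ∀ k a r b → act k (r · a) b ≋ r · act k a b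
    act-scalar zero    a r b i p = sym (zeroʳ r)
    act-scalar (suc k) a r b i p = trans
      (+-congˡ (trans (T-cong (act-scalar k (a ∘ suc) r b) i p) (T-· r (act k (a ∘ suc) b) i p)))
      (solve (a 0 ∷ r ∷ b i ∷ T (act k (a ∘ suc) b) i ∷ []) (λ { (a ∷ r ∷ b ∷ x ∷ []) →
        r * a * b + r * x ≐ r * (a * b + x) }) P.refl)

    act-T : ∀ k a b → act k a (T b) ≋ T (act k a b)
    act-T zero    a b = ≋-sym T-0
    act-T (suc k) a b = ≋-trans (⊕-cong (≋-sym (T-· (a 0) b)) (T-cong (act-T k (a ∘ suc) b)))
      (≋-sym (T-⊕ (a 0 · b) (T (act k (a ∘ suc) b))))

    act-0 : ∀ k a → act k a 0ᴹ ≋ 0ᴹ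
    act-0 zero    a = ≋-refl
    act-0 (suc k) a i p = trans (+-cong (zeroʳ _) (trans (T-cong (act-0 k (a ∘ suc)) i p) (T-0 i p))) (+-identityˡ 0#)

    act-comm : ∀ k m a c b → act k a (act m c b) ≋ act m c (act k a b)
    act-comm zero    m a c b = ≋-sym (act-0 m c)
    act-comm (suc k) m a c b = ≋-trans
      (⊕-cong (≋-sym (act-· m c (a 0) b))
        (≋-trans (T-cong (act-comm k m (a ∘ suc) c b)) (≋-sym (act-T m c (act k (a ∘ suc) b)))))
      (≋-sym (act-⊕ m c (a 0 · b) (T (act k (a ∘ suc) b))))

    shift : M → M
    shift f zero    = 0#
    shift f (suc i) = f i

    T-shift : ∀ f → f n ≈ 0# → T f ≋ shift f
    T-shift f h zero    p = linear (f n ∷ g 0 ∷ []) (λ { (x ∷ z ∷ []) → - (x * z) ≐ 0# by (- z , x , 0#) ∷ [] }) P.refl (h , tt)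
    T-shift f h (suc i) p = linear (f i ∷ f n ∷ g (suc i) ∷ []) (λ { (y ∷ x ∷ z ∷ []) →
      y - x * z ≐ y by (- z , x , 0#) ∷ [] }) P.refl (h , tt)

    trunc : ℕ → M → M
    trunc zero    a i       = 0#
    trunc (suc k) a zero    = a 0
    trunc (suc k) a (suc i) = trunc k (a ∘ suc) i

    trunc-≥ : ∀ k a i → k ≤ i → trunc k a i ≈ 0#
    trunc-≥ zero    a i       p = refl
    trunc-≥ (suc k) a (suc i) p = trunc-≥ k (a ∘ suc) i (s≤s⁻¹ p)

    trunc-< : ∀ k a i → i < k → trunc k a i ≈ a i
    trunc-< (suc k) a zero    p = refl
    trunc-< (suc k) a (suc i) p = trunc-< k (a ∘ suc) i (s≤s⁻¹ p)

    -- The truncated sequences met on the way vanish at index n, so nothing overflows and `T` is a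
    -- mere shift.
    act-e₀ : ∀ k a → k ≤ suc n → act k a e₀ ≋ trunc k a
    act-e₀ zero    a k≤n = ≋-refl
    act-e₀ (suc k) a k≤n i p = trans (+-congˡ (trans (T-cong ih i p) (T-shift _ (trunc-≥ k (a ∘ suc) n (s≤s⁻¹ k≤n)) i p))) (at i)
      where
      ih : act k (a ∘ suc) e₀ ≋ trunc k (a ∘ suc)
      ih = act-e₀ k (a ∘ suc) (≤-trans (n≤1+n k) k≤n)
      at : ∀ i → a 0 * e₀ i + shift (trunc k (a ∘ suc)) i ≈ trunc (suc k) a i
      at zero    = solve (a 0 ∷ []) (λ { (a ∷ []) → a * 1# + 0# ≐ a }) P.refl
      at (suc i) = solve (a 0 ∷ trunc k (a ∘ suc) i ∷ []) (λ { (a ∷ t ∷ []) → a * 0# + t ≐ t }) P.refl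

    infixl 7 _⊛_
    _⊛_ : M → M → M
    a ⊛ b = act (suc n) a b

    ⊛-e₀ : ∀ a → a ⊛ e₀ ≋ a
    ⊛-e₀ a = ≋-trans (act-e₀ (suc n) a ≤-refl) (λ i p → trunc-< (suc n) a i (s≤s p))

    ⊛-cong : ∀ {a a′ b b′} → a ≋ a′ → b ≋ b′ → a ⊛ b ≋ a′ ⊛ b′
    ⊛-cong e = act-cong (suc n) (λ i p → e i (s≤s⁻¹ p))

    ⊛-comm : ∀ a b → a ⊛ b ≋ b ⊛ a
    ⊛-comm a b = ≋-trans (⊛-cong (≋-refl {a}) (≋-sym (⊛-e₀ b)))
      (≋-trans (act-comm (suc n) (suc n) a b e₀) (⊛-cong (≋-refl {b}) (⊛-e₀ a)))

    instance
      extensionOps : Ops M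
      extensionOps = record { _+_ = _⊕_ ; _*_ = _⊛_ ; -_ = λ f i → - f i ; 0# = 0ᴹ ; 1# = e₀ }

    extension : Ring
    extension = mkRing _≋_ (record
      { isEquivalence = record { refl = ≋-refl ; sym = ≋-sym ; trans = ≋-trans }
      ; +-cong      = ⊕-cong
      ; *-cong      = ⊛-cong
      ; -‿cong      = λ e i p → -‿cong (e i p)
      ; +-assoc     = λ f h k i p → +-assoc (f i) (h i) (k i)
      ; +-comm      = λ f h i p → +-comm (f i) (h i)
      ; +-identityˡ = λ f i p → +-identityˡ (f i)
      ; -‿inverseˡ  = λ f i p → -‿inverseˡ (f i)
      -- (a b) c = c (a b) = a (c b) = a (b c), where the middle equality is that polynomials in `T`
      -- commute.
      ; *-assoc     = λ a b c → ≋-trans (⊛-comm (a ⊛ b) c)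
                        (≋-trans (act-comm (suc n) (suc n) c a b) (⊛-cong (≋-refl {a}) (⊛-comm c b)))
      ; *-comm      = ⊛-comm
      ; *-identityˡ = λ a → ≋-trans (⊛-comm e₀ a) (⊛-e₀ a)
      ; distribˡ    = act-⊕ (suc n)
      })

    module E = CommutativeRing extension

    ι : Carrier → M
    ι r = r · e₀

    scalar-⊛ : ∀ r b → ι r ⊛ b ≋ r · b
    scalar-⊛ r b = ≋-trans (act-scalar (suc n) e₀ r b) (·-cong refl (E.*-identityˡ b))

    embedding : Hom R extension
    embedding = record
      { ⟪_⟫    = ι
      ; cong   = λ e → ·-cong e ≋-refl
      ; +-homo = λ r s i p → distribʳ (e₀ i) r s
      ; *-homo = λ r s → ≋-trans (λ i p → *-assoc r s (e₀ i)) (≋-sym (scalar-⊛ r (ι s)))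
      ; 0-homo = λ i p → zeroˡ (e₀ i)
      ; 1-homo = λ i p → *-identityˡ (e₀ i)
      }

    -- The class of x. It is written as `T e₀` to cover degree one as well, where it is the constant
    -- - g₀.
    X : M
    X = T e₀

    X-⊛ : ∀ b → X ⊛ b ≋ T b
    X-⊛ b = ≋-trans (⊛-comm X b) (≋-trans (act-T (suc n) b e₀) (T-cong (⊛-e₀ b)))

    monic : ℕ → M → M
    monic zero    h       = e₀
    monic (suc m) h zero    = h 0
    monic (suc m) h (suc i) = monic m (h ∘ suc) i

    monic-> : ∀ m h i → m < i → monic m h i ≈ 0#
    monic-> zero    h (suc i) p = refl
    monic-> (suc m) h (suc i) p = monic-> m (h ∘ suc) i (s≤s⁻¹ p)

    monic-≡ : ∀ m h → monic m h m ≈ 1#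
    monic-≡ zero    h = refl
    monic-≡ (suc m) h = monic-≡ m (h ∘ suc)

    monic-< : ∀ m h i → i < m → monic m h i ≈ h i
    monic-< (suc m) h zero    p = refl
    monic-< (suc m) h (suc i) p = monic-< m (h ∘ suc) i (s≤s⁻¹ p)

    monicEval-X : ∀ m h → m ≤ n → monicEval extension m (ι ∘ h) X ≋ monic m h
    monicEval-X zero    h m≤n = ≋-refl
    monicEval-X (suc m) h m<n i p = trans
      (+-congˡ (trans (X-⊛ _ i p) (trans (T-cong (monicEval-X m (h ∘ suc) (<⇒≤ m<n)) i p) (T-shift _ (monic-> m (h ∘ suc) n m<n) i p))))
      (at i)
      where
      at : ∀ i → h 0 * e₀ i + shift (monic m (h ∘ suc)) i ≈ monic (suc m) h i
      at zero    = solve (h 0 ∷ []) (λ { (a ∷ []) → a * 1# + 0# ≐ a }) P.refl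
      at (suc i) = solve (h 0 ∷ monic m (h ∘ suc) i ∷ []) (λ { (a ∷ t ∷ []) → a * 0# + t ≐ t }) P.refl

    -- Up to degree n, evaluation at `X` only lists coefficients. The last multiplication by `X`
    -- overflows with leading coefficient 1, which subtracts exactly the coefficients of g.
    root : monicEval extension (suc n) (ι ∘ g) X ≋ 0ᴹ
    root i p = trans (+-congˡ (trans (X-⊛ _ i p) (T-cong (monicEval-X n (g ∘ suc) ≤-refl) i p))) (at i p)
      where
      f : M
      f = monic n (g ∘ suc)
      at : ∀ i → i ≤ n → g 0 * e₀ i + T f i ≈ 0#
      at zero    p = linear (g 0 ∷ f n ∷ []) (λ { (g₀ ∷ x ∷ []) →
        g₀ * 1# + - (x * g₀) ≐ 0# by (- g₀ , x , 1#) ∷ [] }) P.refl (monic-≡ n (g ∘ suc) , tt)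
      at (suc i) p = linear (g 0 ∷ f n ∷ f i ∷ g (suc i) ∷ []) (λ { (g₀ ∷ x ∷ y ∷ z ∷ []) →
        g₀ * 0# + (y - x * z) ≐ 0# by (- z , x , 1#) ∷ (1# , y , z) ∷ [] }) P.refl
        (monic-≡ n (g ∘ suc) , monic-< n (g ∘ suc) i p , tt)

    module _ (fin : Finite R) where
      open Finite fin

      cons : Carrier → M → M
      cons r f zero    = r
      cons r f (suc i) = f i

      covers : ℕ → List M
      covers zero    = 0ᴹ ∷ []
      covers (suc k) = cartesianProductWith cons cover (covers k)

      covers-complete : ∀ k (f : M) → Any (λ (h : M) → ∀ i → i < k → f i ≈ h i) (covers k)
      covers-complete zero    f = here (λ i ())
      covers-complete (suc k) f = cartesianProductWith⁺ cons
        (λ { e e′ zero _ → e ; e e′ (suc i) p → e′ i (s≤s⁻¹ p) }) (complete (f 0)) (covers-complete k (f ∘ suc))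

      compare : ∀ k (f h : M) → Dec (∀ i → i < k → f i ≈ h i)
      compare zero    f h = yes (λ i ())
      compare (suc k) f h with f 0 ≟ h 0 | compare k (f ∘ suc) (h ∘ suc)
      ... | yes e | yes e′ = yes λ { zero _ → e ; (suc i) p → e′ i (s≤s⁻¹ p) }
      ... | no ne | _      = no λ e → ne (e 0 (s≤s z≤n))
      ... | _     | no ne  = no λ e → ne (λ i p → e (suc i) (s≤s p))

      extension-finite : Finite extension
      extension-finite = record
        { cover    = covers (suc n)
        ; complete = λ f → Any.map (λ e i p → e i (s≤s p)) (covers-complete (suc n) f)
        ; _≟_      = λ f h → dec (compare (suc n) f h)
        -- Compare constant coefficients: 1 survives because g is monic of positive degree, whether
        -- or not it is irreducible.
        ; 1≉0      = λ e → 1≉0 (e 0 z≤n)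
        }
        where
        dec : {f h : M} → Dec (∀ i → i < suc n → f i ≈ h i) → Dec (f ≋ h)
        dec (yes e) = yes (λ i p → e i (s≤s p))
        dec (no ne) = no (λ e → ne (λ i p → e i (s≤s⁻¹ p)))

-- Existence of finite fields

module FieldExistence where

  open FiniteFields
  open Rings
  open RootAdjunction
  open Solver
  open import Algebra.Bundles using (CommutativeRing; RawRing)
  import Algebra.Morphism.RingMonomorphism as RingMonomorphism
  open import Algebra.Morphism.Structures using (IsRingMonomorphism)
  import Algebra.Properties.CommutativeSemiring.Binomial as Binomial
  import Algebra.Properties.CommutativeSemiring.Exp as CommutativeExp
  import Algebra.Properties.Monoid.Sum as Sum
  import Algebra.Properties.Semiring.Exp as Exp
  import Algebra.Properties.Semiring.Mult as Mult
  open import Data.Empty using (⊥-elim)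
  open import Data.Fin.Base using (Fin; zero; suc; toℕ; fromℕ; inject₁)
  open import Data.Fin.Properties using (toℕ-fromℕ; toℕ-inject₁; toℕ<n) renaming (_≟_ to _≟ᶠ_)
  open import Data.Integer.Base using (ℤ; +_; -[1+_])
  open import Data.Integer.DivMod using (_/ℕ_; n%ℕd<d; a≡a%ℕn+[a/ℕn]*n)
  import Data.Integer.Divisibility.Signed as ℤ∣
  open import Data.Integer.Properties using (+-*-commutativeRing)
  open import Data.List.Base using ([]; _∷_; upTo) renaming (map to mapᴸ)
  open import Data.List.Membership.Propositional.Properties using (∈-upTo⁺)
  open import Data.List.Relation.Unary.Any as Any using (Any)
  open import Data.List.Relation.Unary.Any.Properties using () renaming (map⁺ to any-map⁺)
  open import Data.Nat.Base as ℕ using (ℕ; zero; nonTrivial⇒n>1; suc; _≤_; _<_; z≤n; s≤s; _∸_; _!; NonZero; >-nonZero)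
  open import Data.Nat.Combinatorics using (_C_; nCk≡n!/k![n-k]!; k![n∸k]!∣n!; nCn≡1; nCk≡nC[n∸k])
  open import Data.Nat.DivMod using (m/n*n≡m)
  open import Data.Nat.Divisibility using (_∣_; divides; ∣⇒≤; m∣m*n; ∣1⇒≡1)
  open import Data.Nat.Primality using (Prime; euclidsLemma; ¬prime[1]; prime⇒nonTrivial; prime⇒nonZero)
  open import Data.Nat.Properties using (≤-trans; ≤-refl; <⇒≱; n∸n≡0; ∸-monoʳ-<; m≤m*n; m^n≢0; _!*_!≢0; suc-pred; n≤1+n; <⇒≤)
  open import Data.Product.Base using (Σ; ∃; _×_; _,_; proj₁; proj₂)
  open import Data.Sum.Base using (inj₁; inj₂)
  open import Data.Unit.Base using (tt)
  open import Data.Vec.Base using ([]; _∷_)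
  open import Function.Base using (_∘_)
  open import Function.Construct.Identity using (↔-id)
  open import Level using (0ℓ)
  import Relation.Binary.PropositionalEquality as P
  open import Relation.Nullary using (yes; no; contradiction)
  open import Relation.Nullary.Decidable using (map′)
  open P using (_≡_; _≢_)

  module Powers (S : Ring) where
    open Exp (CommutativeRing.semiring S) public using (_^_; ^-congˡ; ^-congʳ; ^-assocʳ)
    open CommutativeExp (CommutativeRing.commutativeSemiring S) public using (^-distrib-*)
    open Mult (CommutativeRing.semiring S) public using (×-congʳ; ×-assocˡ; ×-comm-*; ×-congˡ; ×-homo-1) renaming (_×_ to _×′_)

  module _ {R S : Ring} (φ : Hom R S) where
    private module R = CommutativeRing R
    open Theory S
    open Hom φ

    neg-homo : ∀ x → ⟪ R.- x ⟫ ≈ - ⟪ x ⟫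
    neg-homo x = linear (⟪ R.- x ⟫ ∷ ⟪ x ⟫ ∷ []) (λ { (y ∷ x ∷ []) → y ≐ - x by (1# , y + x , 0#) ∷ [] }) P.refl
      (trans (sym (+-homo (R.- x) x)) (trans (cong (R.-‿inverseˡ x)) 0-homo) , tt)

    ×1-homo : ∀ n → ⟪ Powers._×′_ R n R.1# ⟫ ≈ Powers._×′_ S n 1#
    ×1-homo zero    = 0-homo
    ×1-homo (suc n) = trans (+-homo _ _) (+-cong 1-homo (×1-homo n))

  prime∣! : ∀ {p} → Prime p → ∀ n → p ∣ n ! → p ≤ n
  prime∣! pr zero    p∣ with P.refl ← ∣1⇒≡1 p∣ = ⊥-elim (¬prime[1] pr)
  prime∣! pr (suc n) p∣ with euclidsLemma (suc n) (n !) pr p∣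
  ... | inj₁ p∣1+n = ∣⇒≤ p∣1+n
  ... | inj₂ p∣n!  = ≤-trans (prime∣! pr n p∣n!) (n≤1+n n)

  -- p divides p! = (p C k) · k! · (p - k)!, but neither factorial, since k and p - k are smaller
  -- than p.
  prime∣C : ∀ {p} → Prime p → ∀ k → 0 < k → k < p → p ∣ p C k
  prime∣C {p@(suc p-1)} pr k 0<k k<p with euclidsLemma (p C k) (k ! ℕ.* (p ∸ k) !) pr p∣
    where
    instance _ = k !* (p ∸ k) !≢0
    p∣ : p ∣ (p C k) ℕ.* (k ! ℕ.* (p ∸ k) !)
    p∣ = P.subst (p ∣_) (P.sym (P.trans (P.cong (ℕ._* (k ! ℕ.* (p ∸ k) !)) (nCk≡n!/k![n-k]! (<⇒≤ k<p)))
           (m/n*n≡m (k![n∸k]!∣n! (<⇒≤ k<p))))) (m∣m*n (p-1 !))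
  ... | inj₁ h = h
  ... | inj₂ h with euclidsLemma (k !) ((p ∸ k) !) pr h
  ...   | inj₁ h′ = contradiction (prime∣! pr k h′) (<⇒≱ k<p)
  ...   | inj₂ h′ = contradiction (prime∣! pr (p ∸ k) h′) (<⇒≱ (∸-monoʳ-< 0<k (<⇒≤ k<p)))

  module Frobenius (S : Ring) {p : ℕ} (pr : Prime p) (char : CommutativeRing._≈_ S (Powers._×′_ S p (CommutativeRing.1# S)) (CommutativeRing.0# S)) where
    open Theory S
    open Powers S

    p×≈0 : ∀ x → p ×′ x ≈ 0#
    p×≈0 x = trans (×-congʳ p (sym (*-identityʳ x))) (trans (sym (×-comm-* p x 1#)) (trans (*-congˡ char) (zeroʳ x)))

    multiple≈0 : ∀ {m} x → p ∣ m → m ×′ x ≈ 0#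
    multiple≈0 x (divides c P.refl) = trans (sym (×-assocˡ x c p)) (trans (×-congʳ c (p×≈0 x)) (×0 c))
      where
      ×0 : ∀ c → c ×′ 0# ≈ 0#
      ×0 zero    = refl
      ×0 (suc c) = trans (+-identityˡ _) (×0 c)

    private
      -- Writing p as a successor lets the first and the last binomial term be split off; the
      -- coefficients of the others are divisible by p.
      frobenius′ : ∀ n → suc n ≡ p → ∀ x y → (x + y) ^ suc n ≈ x ^ suc n + y ^ suc n
      frobenius′ n P.refl x y = trans (theorem (suc n) x y) (trans (+-cong first (trans (sum-init-last (t ∘ suc)) (+-cong middle last′)))
        (solve (x ^ suc n ∷ y ^ suc n ∷ []) (λ { (x ∷ y ∷ []) → y + (0# + x) ≐ x + y }) P.refl))
        where
        open Binomial (CommutativeRing.commutativeSemiring S) using (theorem; binomialTerm)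
        open Sum (CommutativeRing.+-monoid S) using (sum; sum-init-last; sum-cong-≋; sum-replicate-zero)
        t : Fin (suc (suc n)) → Carrier
        t = binomialTerm x y (suc n)

        first : t zero ≈ y ^ suc n
        first = trans (×-congˡ (P.trans (nCk≡nC[n∸k] {0} {suc n} z≤n) (nCn≡1 (suc n)))) (trans (×-homo-1 _) (*-identityˡ _))

        last-term : ∀ k → k ≡ suc n → (suc n C k) ×′ (x ^ k * y ^ (suc n ∸ k)) ≈ x ^ suc n
        last-term _ P.refl = trans (×-congˡ (nCn≡1 (suc n))) (trans (×-homo-1 _)
          (trans (*-congˡ (^-congʳ y (n∸n≡0 n))) (*-identityʳ _)))

        last′ : t (suc (fromℕ n)) ≈ x ^ suc n
        last′ = last-term _ (P.cong suc (toℕ-fromℕ n))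

        middle : sum (λ i → t (suc (inject₁ i))) ≈ 0#
        middle = trans (sum-cong-≋ (λ i → multiple≈0 _ (prime∣C pr (suc (toℕ (inject₁ i))) (s≤s z≤n)
          (s≤s (P.subst (_< n) (P.sym (toℕ-inject₁ i)) (toℕ<n i)))))) (sum-replicate-zero n)

    frobenius : ∀ x y → (x + y) ^ p ≈ x ^ p + y ^ p
    frobenius x y = P.subst (λ m → (x + y) ^ m ≈ x ^ m + y ^ m) eq (frobenius′ (ℕ.pred p) eq x y)
      where
      eq : suc (ℕ.pred p) ≡ p
      eq = suc-pred p ⦃ prime⇒nonZero pr ⦄

    frobenius^ : ∀ k x y → (x + y) ^ (p ℕ.^ k) ≈ x ^ (p ℕ.^ k) + y ^ (p ℕ.^ k)
    frobenius^ zero    x y = distribʳ 1# x y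
    frobenius^ (suc k) x y = trans (sym (^-assocʳ (x + y) p (p ℕ.^ k))) (trans (^-congˡ (p ℕ.^ k) (frobenius x y))
      (trans (frobenius^ k (x ^ p) (y ^ p)) (+-cong (^-assocʳ x p (p ℕ.^ k)) (^-assocʳ y p (p ℕ.^ k)))))

  module Products (S : Ring) where
    open Theory S

    ∏ : ∀ m → (Fin m → Carrier) → Carrier
    ∏ zero    f = 1#
    ∏ (suc m) f = f zero * ∏ m (f ∘ suc)

    ∏-factor : ∀ m f i → ∃ λ c → ∏ m f ≈ f i * c
    ∏-factor (suc m) f zero    = ∏ m (f ∘ suc) , refl
    ∏-factor (suc m) f (suc i) with c , e ← ∏-factor m (f ∘ suc) i = f zero * c ,
      linear (f zero ∷ ∏ m (f ∘ suc) ∷ f (suc i) ∷ c ∷ []) (λ { (x ∷ y ∷ z ∷ c ∷ []) →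
        x * y ≐ z * (x * c) by (x , y , z * c) ∷ [] }) P.refl (e , tt)

    ∏-factors : ∀ m f i j → i ≢ j → ∃ λ c → ∏ m f ≈ f i * f j * c
    ∏-factors (suc m) f zero    zero    i≢j = ⊥-elim (i≢j P.refl)
    ∏-factors (suc m) f zero    (suc j) i≢j with c , e ← ∏-factor m (f ∘ suc) j = c ,
      trans (*-congˡ e) (sym (*-assoc _ _ _))
    ∏-factors (suc m) f (suc i) zero    i≢j with c , e ← ∏-factor m (f ∘ suc) i = c ,
      linear (f zero ∷ ∏ m (f ∘ suc) ∷ f (suc i) ∷ c ∷ []) (λ { (x ∷ y ∷ z ∷ c ∷ []) →
        x * y ≐ z * x * c by (x , y , z * c) ∷ [] }) P.refl (e , tt)
    ∏-factors (suc m) f (suc i) (suc j) i≢j with c , e ← ∏-factors m (f ∘ suc) i j (i≢j ∘ P.cong suc) = f zero * c ,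
      linear (f zero ∷ ∏ m (f ∘ suc) ∷ f (suc i) ∷ f (suc j) ∷ c ∷ []) (λ { (x ∷ y ∷ z ∷ w ∷ c ∷ []) →
        x * y ≐ z * w * (x * c) by (x , y , z * w * c) ∷ [] }) P.refl (e , tt)

    ∏≈0 : IsField S → ∀ m f → ∏ m f ≈ 0# → ∃ λ i → f i ≈ 0#
    ∏≈0 isField zero    f h = ⊥-elim (IsField.1≉0 isField h)
    ∏≈0 isField (suc m) f h with IsField._≟_ isField (f zero) 0#
    ... | yes e = zero , e
    ... | no ne with y , e ← IsField.inverse isField (f zero) ne
      with i , e′ ← ∏≈0 isField m (f ∘ suc) (linear (f zero ∷ ∏ m (f ∘ suc) ∷ y ∷ []) (λ { (x ∷ z ∷ y ∷ []) →
        z ≐ 0# by (- z , x * y , 1#) ∷ (y , x * z , 0#) ∷ [] }) P.refl (e , h , tt)) = suc i , e′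

  -- The factorisation is demanded after every further homomorphism, so that it carries over to
  -- later extensions and to a residue field. The listed roots may coincide.
  record Splitting (R : Ring) (m : ℕ) (g : ℕ → CommutativeRing.Carrier R) : Set₁ where
    field
      ring   : Ring
      finite : Finite ring
      hom    : Hom R ring
      roots  : Fin m → CommutativeRing.Carrier ring
      splits : (S : Ring) (φ : Hom ring S) → let open Theory S in ∀ x →
               monicEval S m (Hom.⟪_⟫ φ ∘ Hom.⟪_⟫ hom ∘ g) x ≈ Products.∏ S m (λ i → x - Hom.⟪_⟫ φ (roots i))

  splitting : ∀ m (R : Ring) → Finite R → (g : ℕ → CommutativeRing.Carrier R) → Splitting R m g
  splitting zero    R fin g = record
    { ring = R ; finite = fin ; hom = idHom ; roots = λ () ; splits = λ S φ x → CommutativeRing.refl S }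
  splitting (suc m) R fin g = record
    { ring = I.ring ; finite = I.finite ; hom = I.hom ∘ʰ embedding ; roots = roots ; splits = splits }
    where
    open Adjoin R m g
    module I = Splitting (splitting m extension (extension-finite fin) (deflate extension (suc m) (ι ∘ g) X))

    roots : Fin (suc m) → CommutativeRing.Carrier I.ring
    roots zero    = Hom.⟪_⟫ I.hom X
    roots (suc i) = I.roots i

    splits : (S : Ring) (φ : Hom I.ring S) → let open Theory S in ∀ x →
      monicEval S (suc m) (Hom.⟪_⟫ φ ∘ Hom.⟪_⟫ (I.hom ∘ʰ embedding) ∘ g) x ≈ Products.∏ S (suc m) (λ i → x - Hom.⟪_⟫ φ (roots i))
    splits S φ x = trans (monicEval-deflate S m (⟪_⟫ ∘ ι ∘ g) ⟪ X ⟫ x)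
      (trans (+-cong vanishes (*-congˡ (trans (monicEval-cong S m (λ i → sym (deflate-homo ψ (suc m) (ι ∘ g) X i)) refl) (I.splits S φ x))))
        (+-identityˡ _))
      where
      open Theory S
      ψ : Hom extension S
      ψ = φ ∘ʰ I.hom
      open Hom ψ using (⟪_⟫)
      vanishes : monicEval S (suc m) (⟪_⟫ ∘ ι ∘ g) ⟪ X ⟫ ≈ 0#
      vanishes = trans (sym (monicEval-homo ψ (suc m) (ι ∘ g) X)) (trans (Hom.cong ψ root) (Hom.0-homo ψ))

  module Integers (p : ℕ) (2≤p : 2 ≤ p) where
    private
      instance
        p≢0 : NonZero p
        p≢0 = >-nonZero (≤-trans (s≤s z≤n) 2≤p)

    open Quotient +-*-commutativeRing (+ p) public using (_~_) renaming (quotient to ℤ/p)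
    open Theory +-*-commutativeRing using (linear; ringOps)

    ℤ/p-finite : Finite ℤ/p
    ℤ/p-finite = record
      { cover    = mapᴸ +_ (upTo p)
      ; complete = λ x → any-map⁺ (Any.map (λ { P.refl → x /ℕ p , a≡a%ℕn+[a/ℕn]*n x p }) (∈-upTo⁺ (n%ℕd<d x p)))
      ; _≟_      = λ x y → map′ (λ { (ℤ∣.divides c e) → c , linear (x ∷ y ∷ c ∷ + p ∷ []) (λ { (x ∷ y ∷ c ∷ p ∷ []) →
                                  x ≐ y + c * p by (1# , x - y , c * p) ∷ [] }) P.refl (e , tt) })
                                (λ { (c , e) → ℤ∣.divides c (linear (x ∷ y ∷ c ∷ + p ∷ []) (λ { (x ∷ y ∷ c ∷ p ∷ []) →
                                  x - y ≐ c * p by (1# , x , y + c * p) ∷ [] }) P.refl (e , tt)) })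
                                (+ p ℤ∣.∣? (x - y))
      ; 1≉0      = λ { (c , e) → <⇒≱ 2≤p (∣⇒≤ (ℤ∣.∣⇒∣ᵤ (ℤ∣.divides c (linear (c ∷ + p ∷ []) (λ { (c ∷ p ∷ []) →
                                  1# ≐ c * p by (1# , 1# , 0# + c * p) ∷ [] }) P.refl (e , tt))))) }
      }

    ℤ/p-char : Powers._×′_ ℤ/p p (+ 1) ~ + 0
    ℤ/p-char = + 1 , P.trans (×1≡ p) (linear (+ p ∷ []) (λ { (p ∷ []) → p ≐ 0# + 1# * p }) P.refl tt)
      where
      ×1≡ : ∀ n → Powers._×′_ ℤ/p n (+ 1) ≡ + n
      ×1≡ zero    = P.refl
      ×1≡ (suc n) = P.cong (Data.Integer.Base._+_ (+ 1)) (×1≡ n)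

  module _ (S : Ring) where
    open Theory S
    open Powers S

    monicEval-0 : ∀ m c x → (∀ i → c i ≈ 0#) → monicEval S m c x ≈ x ^ m
    monicEval-0 zero    c x c≈0 = refl
    monicEval-0 (suc m) c x c≈0 = trans (+-cong (c≈0 0) (*-congˡ (monicEval-0 m (c ∘ suc) x (c≈0 ∘ suc)))) (+-identityˡ _)

    -- The bound on q keeps the coefficient - 1 of x apart from the leading coefficient, which
    -- `monicEval` supplies.
    monicEval-fermat : ∀ q → 2 ≤ q → ∀ c x → c 0 ≈ 0# → c 1 ≈ - 1# → (∀ i → c (suc (suc i)) ≈ 0#) →
                       monicEval S q c x ≈ x ^ q - x
    monicEval-fermat (suc (suc m)) (s≤s (s≤s z≤n)) c x c₀ c₁ c≈0 =
      linear (c 0 ∷ c 1 ∷ x ∷ monicEval S m (λ i → c (suc (suc i))) x ∷ x ^ m ∷ []) (λ { (c₀ ∷ c₁ ∷ x ∷ e ∷ y ∷ []) →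
        c₀ + x * (c₁ + x * e) ≐ x * (x * y) - x by (1# , c₀ , 0#) ∷ (x , c₁ , - 1#) ∷ (x * x , e , y) ∷ [] })
        P.refl (c₀ , c₁ , monicEval-0 m (λ i → c (suc (suc i))) x c≈0 , tt)

  Fermat : (q : ℕ) (S : Ring) → (Fin q → CommutativeRing.Carrier S) → Set
  Fermat q S a = ∀ x → x ^ q - x ≈ ∏ q (λ i → x - a i)
    where
    open Theory S
    open Powers S
    open Products S

  -- Requiring the factorisation of x^q − x in every K-algebra S makes it an
  -- identity of polynomials.
  module RootField {p k : ℕ} (pr : Prime p) (2≤q : 2 ≤ p ℕ.^ k) (K : Ring) (isField : IsField K)
    (a : Fin (p ℕ.^ k) → CommutativeRing.Carrier K)
    (charK : CommutativeRing._≈_ K (Powers._×′_ K p (CommutativeRing.1# K)) (CommutativeRing.0# K))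
    (fermatK : (S : Ring) (θ : Hom K S) → Fermat (p ℕ.^ k) S (Hom.⟪_⟫ θ ∘ a))
    where

    q : ℕ
    q = p ℕ.^ k

    -- This is used twice: over K itself, and over its dual numbers, where the roots are shown to be
    -- distinct.
    module Over (S : Ring) (θ : Hom K S) where
      open Theory S public
      open Powers S public
      open Products S public
      open Hom θ public using (⟪_⟫)

      char : p ×′ 1# ≈ 0#
      char = trans (sym (×1-homo θ p)) (trans (Hom.cong θ charK) (Hom.0-homo θ))

      open Frobenius S pr char public using (frobenius^)

      fermat : Fermat q S (⟪_⟫ ∘ a)
      fermat = fermatK S θ

      fixed : ∀ i → ⟪ a i ⟫ ^ q ≈ ⟪ a i ⟫
      fixed i with c , e ← ∏-factor q (λ j → ⟪ a i ⟫ - ⟪ a j ⟫) i =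
        linear (⟪ a i ⟫ ^ q ∷ ⟪ a i ⟫ ∷ ∏ q (λ j → ⟪ a i ⟫ - ⟪ a j ⟫) ∷ c ∷ []) (λ { (y ∷ x ∷ π ∷ c ∷ []) →
          y ≐ x by (1# , y - x , π) ∷ (1# , π , (x - x) * c) ∷ [] }) P.refl (fermat ⟪ a i ⟫ , e , tt)

      nilpotent : ∀ ε → ε * ε ≈ 0# → ε ^ q ≈ 0#
      nilpotent ε h = go q 2≤q
        where
        go : ∀ q → 2 ≤ q → ε ^ q ≈ 0#
        go (suc (suc m)) (s≤s (s≤s z≤n)) = linear (ε ∷ ε ^ m ∷ []) (λ { (ε ∷ y ∷ []) →
          ε * (ε * y) ≐ 0# by (y , ε * ε , 0#) ∷ [] }) P.refl (h , tt)

      -- A double root makes x^q − x vanish at a + ε.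
      double-root : ∀ ε → ε * ε ≈ 0# → ∀ i j → i ≢ j → ⟪ a i ⟫ ≈ ⟪ a j ⟫ → ε ≈ 0#
      double-root ε ε² i j i≢j e with c , e′ ← ∏-factors q (λ l → ⟪ a i ⟫ + ε - ⟪ a l ⟫) i j i≢j =
        linear (ε ∷ ⟪ a i ⟫ ∷ ⟪ a j ⟫ ∷ (⟪ a i ⟫ + ε) ^ q ∷ ⟪ a i ⟫ ^ q ∷ ε ^ q ∷ ∏ q (λ l → ⟪ a i ⟫ + ε - ⟪ a l ⟫) ∷ c ∷ [])
          (λ { (ε ∷ x ∷ y ∷ s ∷ t ∷ u ∷ π ∷ c ∷ []) →
            ε ≐ 0# by (- 1# , s - (x + ε) , π) ∷ (1# , s , t + u) ∷ (1# , t , x) ∷ (1# , u , 0#) ∷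
                      (- 1# , π , (x + ε - x) * (x + ε - y) * c) ∷ (- (ε * c) , x , y) ∷ (- c , ε * ε , 0#) ∷ [] })
          P.refl (fermat (⟪ a i ⟫ + ε) , frobenius^ k ⟪ a i ⟫ ε , fixed i , nilpotent ε ε² , e′ , e , ε² , tt)

    -- The dual numbers K[x]/(x²): n = 1 means degree two, and all lower coefficients are 0. Its `X`
    -- is ε.
    module D = Adjoin K 1 (λ _ → CommutativeRing.0# K)
    open Over K idHom
    open IsField isField using (inverse; 1≉0)

    a-injective : ∀ {i j} → a i ≈ a j → i ≡ j
    a-injective {i} {j} e with i ≟ᶠ j
    ... | yes i≡j = i≡j
    -- The coefficient of ε in ε is 1, so ε = 0 would give 1 = 0 in K.
    ... | no i≢j = ⊥-elim (1≉0 (trans (sym X₁) (ε≈0 1 (s≤s z≤n))))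
      where
      X₁ : D.X 1 ≈ 1#
      X₁ = solve [] (λ { [] → 1# - 0# * 0# ≐ 1# }) P.refl

      ε² : D.X D.⊛ D.X D.≋ D.0ᴹ
      ε² i p = trans (D.X-⊛ D.X i p) (at i p)
        where
        at : ∀ i → i ≤ 1 → D.T D.X i ≈ 0#
        at zero          p = zeroʳ′ (D.X 1)
          where
          zeroʳ′ : ∀ x → - (x * 0#) ≈ 0#
          zeroʳ′ x = solve (x ∷ []) (λ { (x ∷ []) → - (x * 0#) ≐ 0# }) P.refl
        at (suc zero)    p = solve (D.X 1 ∷ []) (λ { (x ∷ []) → - (0# * 0#) - x * 0# ≐ 0# }) P.refl
        at (suc (suc i)) (s≤s ())

      ε≈0 : D.X D.≋ D.0ᴹ
      ε≈0 = Over.double-root D.extension D.embedding D.X ε² i j i≢j (Hom.cong D.embedding e)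

    -- In a field one of the factors of x^q - x vanishes. Thus the roots are all the fixed points of
    -- the q-th power, and closure under an operation reduces to its result being fixed.
    index : ∀ x → x ^ q ≈ x → ∃ λ i → a i ≈ x
    index x h with i , e ← ∏≈0 isField q (λ i → x - a i) (trans (sym (fermat x))
      (linear (x ^ q ∷ x ∷ []) (λ { (y ∷ x ∷ []) → y - x ≐ 0# by (1# , y , x) ∷ [] }) P.refl (h , tt))) =
      i , linear (a i ∷ x ∷ []) (λ { (a ∷ x ∷ []) → a ≐ x by (- 1# , x - a , 0#) ∷ [] }) P.refl (e , tt)

    +-fixed : ∀ i j → (a i + a j) ^ q ≈ a i + a j
    +-fixed i j = trans (frobenius^ k (a i) (a j)) (+-cong (fixed i) (fixed j))

    *-fixed : ∀ i j → (a i * a j) ^ q ≈ a i * a j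
    *-fixed i j = trans (^-distrib-* (a i) (a j) q) (*-cong (fixed i) (fixed j))

    0-fixed : 0# ^ q ≈ 0#
    0-fixed = nilpotent 0# (zeroˡ 0#)

    1-fixed : 1# ^ q ≈ 1#
    1-fixed = go q
      where
      go : ∀ m → 1# ^ m ≈ 1#
      go zero    = refl
      go (suc m) = trans (*-identityˡ _) (go m)

    -- From 0 = (a + (- a))^q = a^q + (- a)^q, which spares a distinction by the parity of q.
    neg-fixed : ∀ i → (- a i) ^ q ≈ - a i
    neg-fixed i = linear (a i ∷ (- a i) ^ q ∷ a i ^ q ∷ (a i + - a i) ^ q ∷ 0# ^ q ∷ []) (λ { (x ∷ y ∷ z ∷ w ∷ o ∷ []) →
      y ≐ - x by (- 1# , w , z + y) ∷ (- 1# , z , x) ∷ (1# , w , o) ∷ (1# , o , 0#) ∷ [] }) P.refl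
      (frobenius^ k (a i) (- a i) , fixed i , ^-congˡ q (-‿inverseʳ (a i)) , 0-fixed , tt)

    -- With x = `a i`, fixedness gives 1 = (x y)^q = x y^q; multiplication by y gives y = y^q.
    inverse-fixed : ∀ i y → a i * y ≈ 1# → y ^ q ≈ y
    inverse-fixed i y e = linear (a i ∷ y ∷ a i ^ q ∷ y ^ q ∷ (a i * y) ^ q ∷ 1# ^ q ∷ []) (λ { (x ∷ y ∷ x′ ∷ y′ ∷ w ∷ o ∷ []) →
      y′ ≐ y by (- y′ , x * y , 1#) ∷ (- (y * y′) , x′ , x) ∷ (- y , w , x′ * y′) ∷ (y , w , o) ∷ (y , o , 1#) ∷ [] }) P.refl
      (e , fixed i , ^-distrib-* (a i) y q , ^-congˡ q e , 1-fixed , tt)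

    -- The carrier consists of the indices of the roots, so that equality becomes propositional. The
    -- ring laws are then pulled back from K along the injection `a`.
    rootRing : RawRing 0ℓ 0ℓ
    rootRing = record
      { Carrier = Fin q
      ; _≈_     = _≡_
      ; _+_     = λ i j → proj₁ (index (a i + a j) (+-fixed i j))
      ; _*_     = λ i j → proj₁ (index (a i * a j) (*-fixed i j))
      ; -_      = λ i → proj₁ (index (- a i) (neg-fixed i))
      ; 0#      = proj₁ (index 0# 0-fixed)
      ; 1#      = proj₁ (index 1# 1-fixed)
      }

    isMonomorphism : IsRingMonomorphism rootRing (CommutativeRing.rawRing K) a
    isMonomorphism = record
      { isRingHomomorphism = record
        { isSemiringHomomorphism = record
          { isNearSemiringHomomorphism = record
            { +-isMonoidHomomorphism = record
              { isMagmaHomomorphism = record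
                { isRelHomomorphism = record { cong = λ { P.refl → refl } }
                ; homo = λ i j → proj₂ (index (a i + a j) (+-fixed i j)) }
              ; ε-homo = proj₂ (index 0# 0-fixed) }
            ; *-homo = λ i j → proj₂ (index (a i * a j) (*-fixed i j)) }
          ; 1#-homo = proj₂ (index 1# 1-fixed) }
        ; -‿homo = λ i → proj₂ (index (- a i) (neg-fixed i)) }
      ; injective = a-injective
      }

    rootField : FiniteField q
    rootField = record
      { F                 = Fin q
      ; enumeration       = ↔-id (Fin q)
      ; ops               = record { _+_ = R._+_ ; _*_ = R._*_ ; -_ = R.-_ ; 0# = R.0# ; 1# = R.1# }
      ; isCommutativeRing = RingMonomorphism.isCommutativeRing isMonomorphism (CommutativeRing.isCommutativeRing K)
      ; 1≢0               = λ e → 1≉0 (trans (sym 1-homo) (trans (reflexive (P.cong a e)) 0-homo))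
      ; inverse           = λ i i≢0 →
          let y , e = inverse (a i) (λ aᵢ≈0 → i≢0 (a-injective (trans aᵢ≈0 (sym 0-homo))))
              j , f = index y (inverse-fixed i y e)
          in j , a-injective (trans (*-homo i j) (trans (*-congˡ f) (trans e (sym 1-homo))))
      }
      where
      module R = RawRing rootRing
      open IsRingMonomorphism isMonomorphism using (*-homo) renaming (1#-homo to 1-homo; 0#-homo to 0-homo)

  finiteField : ∀ p k → Prime p → 1 ≤ k → FiniteField (p ℕ.^ k)
  finiteField p k pr 1≤k = RootField.rootField {k = k} pr 2≤q (proj₁ residue) (proj₁ (proj₂ residue)) (Hom.⟪_⟫ φ ∘ Sp.roots)
    (CommutativeRing.trans K (CommutativeRing.sym K (×1-homo (φ ∘ʰ Sp.hom) p)) (CommutativeRing.trans K (Hom.cong (φ ∘ʰ Sp.hom) ℤ/p-char) (Hom.0-homo (φ ∘ʰ Sp.hom))))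
    fermat
    where
    q : ℕ
    q = p ℕ.^ k

    2≤p : 2 ≤ p
    2≤p = nonTrivial⇒n>1 p ⦃ prime⇒nonTrivial pr ⦄

    2≤q : 2 ≤ q
    2≤q = go 1≤k
      where
      go : ∀ {k} → 1 ≤ k → 2 ≤ p ℕ.^ k
      go {suc k} _ = ≤-trans 2≤p (m≤m*n p (p ℕ.^ k) ⦃ m^n≢0 p k ⦃ prime⇒nonZero pr ⦄ ⦄)

    open Integers p 2≤p

    -- The coefficients of x^q - x below the leading one.
    g : ℕ → ℤ
    g 1 = -[1+ 0 ]
    g _ = + 0

    module Sp = Splitting (splitting q ℤ/p ℤ/p-finite g)

    residue : Σ Ring λ K → IsField K × Hom Sp.ring K
    residue = residueField _ Sp.ring Sp.finite ≤-refl

    K : Ring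
    K = proj₁ residue

    φ : Hom Sp.ring K
    φ = proj₂ (proj₂ residue)

    fermat : (S : Ring) (θ : Hom K S) → Fermat q S (Hom.⟪_⟫ θ ∘ Hom.⟪_⟫ φ ∘ Sp.roots)
    fermat S θ x = trans (sym (monicEval-fermat S q 2≤q (Hom.⟪_⟫ χ ∘ g) x (Hom.0-homo χ)
        (trans (neg-homo χ (+ 1)) (-‿cong (Hom.1-homo χ))) (λ i → Hom.0-homo χ))) (Sp.splits S (θ ∘ʰ φ) x)
      where
      open Theory S
      χ : Hom ℤ/p S
      χ = θ ∘ʰ φ ∘ʰ Sp.hom

-- Orders and defects

open import Defs
open FieldExistence
open FiniteFields
open GeneralizedHexagon
open Graphs
open import Data.Nat using (ℕ; suc; _+_; _*_; _∸_; _^_; _≤_; _%_; _/_)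
open import Data.Nat.DivMod using (m*n/n≡m; +-distrib-/-∣ʳ; m≡m%n+[m/n]*n)
open import Data.Nat.Divisibility using (n∣m*n)
open import Data.Nat.Properties using (m+n∸n≡m)
open import Data.Nat.Tactic.RingSolver using (solve-∀)
open import Data.Product using (Σ; _×_; _,_)
open import Relation.Binary.PropositionalEquality using (_≡_; refl; sym; trans; cong; cong₂; subst)
open PlaneAndQuadrangle

-- Trades truncated subtraction for addition, so that what remains is an identity in the semiring of
-- natural numbers.
≡+⇒∸≡ : ∀ {m n} k → m ≡ n + k → m ∸ k ≡ n
≡+⇒∸≡ {n = n} k refl = m+n∸n≡m n k

order₃ : ∀ q → 3 * suc q ^ 2 + 3 ∸ 3 * suc q ≡ 2 * words q 2 + words q 2
order₃ q = ≡+⇒∸≡ (3 * suc q) (identity q)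
  where
  -- Powers and `words` are written out as the sums and products to which they compute. The
  -- right-hand side is 3 (1 + q + q²) with the subtracted term moved over.
  identity : ∀ q → 3 * (suc q * (suc q * 1)) + 3 ≡ 2 * (1 + q * (1 + q * 1)) + (1 + q * (1 + q * 1)) + 3 * suc q
  identity = solve-∀

order₄ : ∀ q → 3 * suc q ^ 3 + 6 * suc q ∸ 6 * suc q ^ 2 ≡ 2 * words q 3 + words q 3
order₄ q = ≡+⇒∸≡ (6 * suc q ^ 2) (identity q)
  where
  identity : ∀ q → 3 * (suc q * (suc q * (suc q * 1))) + 6 * suc q ≡
    2 * (1 + q * (1 + q * (1 + q * 1))) + (1 + q * (1 + q * (1 + q * 1))) + 6 * (suc q * (suc q * 1))
  identity = solve-∀

order₆ : ∀ q → 3 * suc q ^ 5 + 21 * suc q ^ 3 + 9 * suc q ∸ (12 * suc q ^ 4 + 18 * suc q ^ 2) ≡ 2 * words q 5 + words q 5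
order₆ q = ≡+⇒∸≡ (12 * suc q ^ 4 + 18 * suc q ^ 2) (identity q)
  where
  identity : ∀ q → 3 * (suc q * (suc q * (suc q * (suc q * (suc q * 1))))) + 21 * (suc q * (suc q * (suc q * 1))) + 9 * suc q ≡
    2 * (1 + q * (1 + q * (1 + q * (1 + q * (1 + q * 1))))) + (1 + q * (1 + q * (1 + q * (1 + q * (1 + q * 1)))))
    + (12 * (suc q * (suc q * (suc q * (suc q * 1)))) + 18 * (suc q * (suc q * 1)))
  identity = solve-∀

defect₃-odd : ∀ r t → r ≡ 1 + t * 2 → defect (moore3 r) (3 * r ^ 2 + 3 ∸ 3 * r) ≡ (3 * (r ∸ 1)) / 2
defect₃-odd _ t refl = trans (cong₂ _∸_ (cong (3 *_) (trans (cong (_/ 2) (half t)) (m*n/n≡m (4 * t * t + 3 * t + 1) 2))) (order₃ (t * 2)))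
  (trans (≡+⇒∸≡ (2 * words (t * 2) 2 + words (t * 2) 2) (identity t)) (sym (trans (cong (_/ 2) (triple t)) (m*n/n≡m (3 * t) 2))))
  where
  -- For r = 2t + 1 the numerator 1 + r (2r - 1) is even, so the floor is exact.
  half : ∀ t → 1 + suc (t * 2) * (t * 2 + suc (t * 2 + 0)) ≡ (4 * t * t + 3 * t + 1) * 2
  half = solve-∀
  identity : ∀ t → 3 * (4 * t * t + 3 * t + 1) ≡
    3 * t + (2 * (1 + t * 2 * (1 + t * 2 * 1)) + (1 + t * 2 * (1 + t * 2 * 1)))
  identity = solve-∀
  triple : ∀ t → 3 * (t * 2) ≡ 3 * t * 2
  triple = solve-∀

defect₃-even : ∀ r u → r ≡ suc u * 2 → defect (moore3 r) (3 * r ^ 2 + 3 ∸ 3 * r) ≡ (3 * r) / 2 ∸ 3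
defect₃-even _ u refl = trans (cong₂ _∸_ (cong (3 *_) (trans (cong (_/ 2) (half u)) floor)) (order₃ (suc (u * 2))))
  (trans (≡+⇒∸≡ (2 * words (suc (u * 2)) 2 + words (suc (u * 2)) 2) (identity u))
    (sym (≡+⇒∸≡ 3 (trans (cong (_/ 2) (triple u)) (m*n/n≡m (3 * u + 3) 2)))))
  where
  m : ℕ
  m = suc u * (4 * u + 3)
  -- For r = 2u + 2 the product r (2r - 1) = 2m is even, and the floor discards the half.
  floor : (1 + m * 2) / 2 ≡ m
  floor = trans (+-distrib-/-∣ʳ 1 {m * 2} {2} (n∣m*n m)) (m*n/n≡m m 2)
  half : ∀ u → 1 + suc (suc (u * 2)) * (suc (u * 2) + suc (suc (u * 2) + 0)) ≡ 1 + suc u * (4 * u + 3) * 2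
  half = solve-∀
  identity : ∀ u → 3 * (suc u * (4 * u + 3)) ≡
    3 * u + (2 * (1 + suc (u * 2) * (1 + suc (u * 2) * 1)) + (1 + suc (u * 2) * (1 + suc (u * 2) * 1)))
  identity = solve-∀
  triple : ∀ u → 3 * suc (suc (u * 2)) ≡ (3 * u + 3) * 2
  triple = solve-∀

defect₄ : ∀ q → let r = suc q in defect (mooreEven r 2) (3 * r ^ 3 + 6 * r ∸ 6 * r ^ 2) ≡ 3 * r ^ 3 ∸ 3 * r ^ 2
defect₄ q = trans (cong (mooreEven (suc q) 2 ∸_) (order₄ q))
  (trans (≡+⇒∸≡ (2 * words q 3 + words q 3) (identity q)) (sym (≡+⇒∸≡ (3 * suc q ^ 2) (identity′ q))))
  where
  identity : ∀ q → 3 * suc q * (1 + (q + suc (q + 0)) * q * (1 + (q + suc (q + 0)) * q * 0)) ≡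
    3 * (suc q * (suc q * 1)) * q + (2 * (1 + q * (1 + q * (1 + q * 1))) + (1 + q * (1 + q * (1 + q * 1))))
  identity = solve-∀
  identity′ : ∀ q → 3 * (suc q * (suc q * (suc q * 1))) ≡ 3 * (suc q * (suc q * 1)) * q + 3 * (suc q * (suc q * 1))
  identity′ = solve-∀

defect₆ : ∀ q → let r = suc q in
  defect (mooreEven r 3) (3 * r ^ 5 + 21 * r ^ 3 + 9 * r ∸ (12 * r ^ 4 + 18 * r ^ 2)) ≡ 9 * r ^ 5 + 24 * r ^ 3 ∸ (24 * r ^ 4 + 9 * r ^ 2)
defect₆ q = trans (cong (mooreEven (suc q) 3 ∸_) (order₆ q))
  (trans (≡+⇒∸≡ (2 * words q 5 + words q 5) (identity q)) (sym (≡+⇒∸≡ (24 * suc q ^ 4 + 9 * suc q ^ 2) (identity′ q))))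
  where
  -- The defect is r² q (9q² + 3q + 3), which is 9r⁵ - 24r⁴ + 24r³ - 9r² factored with r = q + 1;
  -- this form has no subtraction.
  identity : ∀ q → 3 * suc q * (1 + (q + suc (q + 0)) * q * (1 + (q + suc (q + 0)) * q * (1 + (q + suc (q + 0)) * q * 0))) ≡
    (suc q * (suc q * 1)) * q * (9 * q * q + 3 * q + 3)
    + (2 * (1 + q * (1 + q * (1 + q * (1 + q * (1 + q * 1))))) + (1 + q * (1 + q * (1 + q * (1 + q * (1 + q * 1))))))
  identity = solve-∀
  identity′ : ∀ q → 9 * (suc q * (suc q * (suc q * (suc q * (suc q * 1))))) + 24 * (suc q * (suc q * (suc q * 1))) ≡
    (suc q * (suc q * 1)) * q * (9 * q * q + 3 * q + 3) + (24 * (suc q * (suc q * (suc q * (suc q * 1)))) + 9 * (suc q * (suc q * 1)))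
  identity′ = solve-∀

theorem4p5 : (r : ℕ) → 3 ≤ r → IsPrimePower (r ∸ 1) →
    (Σ (Bigraph r (2 * r) 3 (3 * r ^ 2 + 3 ∸ 3 * r)) λ _ →
    ((r % 2 ≡ 1 → defect (moore3 r) (3 * r ^ 2 + 3 ∸ 3 * r) ≡ (3 * (r ∸ 1)) / 2)
    × (r % 2 ≡ 0 → defect (moore3 r) (3 * r ^ 2 + 3 ∸ 3 * r) ≡ (3 * r) / 2 ∸ 3)))
    × (Σ (Bigraph r (2 * r) 4 (3 * r ^ 3 + 6 * r ∸ 6 * r ^ 2)) λ _ →
    defect (mooreEven r 2) (3 * r ^ 3 + 6 * r ∸ 6 * r ^ 2) ≡ 3 * r ^ 3 ∸ 3 * r ^ 2)
    × (Σ (Bigraph r (2 * r) 6 (3 * r ^ 5 + 21 * r ^ 3 + 9 * r ∸ (12 * r ^ 4 + 18 * r ^ 2))) λ _ →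
    defect (mooreEven r 3) (3 * r ^ 5 + 21 * r ^ 3 + 9 * r ∸ (12 * r ^ 4 + 18 * r ^ 2))
    ≡ 9 * r ^ 5 + 24 * r ^ 3 ∸ (24 * r ^ 4 + 9 * r ^ 2))
theorem4p5 r@(suc q) 3≤r (p , k , pr , 1≤k , q≡pᵏ) =
  (subst (Bigraph r (2 * r) 3) (sym (order₃ q)) (Plane.bigraph₃ 𝔽) , odd , even) ,
  (subst (Bigraph r (2 * r) 4) (sym (order₄ q)) (Quadrangle.bigraph₄ 𝔽) , defect₄ q) ,
  (subst (Bigraph r (2 * r) 6) (sym (order₆ q)) (Hexagon.bigraph₆ 𝔽) , defect₆ q)
  where
  𝔽 : FiniteField q
  𝔽 = subst FiniteField (sym q≡pᵏ) (finiteField p k pr 1≤k)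

  odd : r % 2 ≡ 1 → defect (moore3 r) (3 * r ^ 2 + 3 ∸ 3 * r) ≡ (3 * (r ∸ 1)) / 2
  odd h = defect₃-odd r (r / 2) (trans (m≡m%n+[m/n]*n r 2) (cong (_+ r / 2 * 2) h))

  even : r % 2 ≡ 0 → defect (moore3 r) (3 * r ^ 2 + 3 ∸ 3 * r) ≡ (3 * r) / 2 ∸ 3
  -- The half of `r` is a successor: the value 0 would make the equation read `suc q ≡ 0`.
  even h with r / 2 | trans (m≡m%n+[m/n]*n r 2) (cong (_+ r / 2 * 2) h)
  ... | suc u | eq = defect₃-even r u eq
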